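{- Let $k,l\ge 2$, $n,m\ge1$ be integers, $\alpha>0$, and suppose $f=(f_1,\dots,f_m):\mathbb{Z}_k^n\to\mathbb{Z}_l^m$ is $\alpha$-Lipschitz with respect to the $L^1$-norm. Then for any $\delta,\epsilon>0$, there are at least $(1-\delta)m$ coordinates $i\in[m]$ such that $f_i$ is $\epsilon$-close to some $M$-junta $g_i:\mathbb{Z}_k^n\to\mathbb{Z}_l$, where $$M\le l\exp\!\left(\frac{C_2\alpha k}{\delta\epsilon}\right)$$ and $C_2$ is an absolute constant.
   Context: For $s\in\mathbb{Z}_q$, $|s|'$ denotes the cyclic distance from $s$ to $0$ in $\mathbb{Z}_q$. For $x\in\mathbb{Z}_k^n$, $\|x\|_1=\frac1n\sum_{i=1}^n|x_i|'$, and similarly for $y\in\mathbb{Z}_l^m$, $\|y\|_1=\frac1m\sum_{i=1}^m|y_i|'$. $f$ is $\alpha$-Lipschitz with respect to the $L^1$-norm if $\|f(x)-f(y)\|_1\le\alpha\|x-y\|_1$ for all $x,y\in\mathbb{Z}_k^n$. Two functions $h,\tilde h:\mathbb{Z}_k^n\to\mathbb{Z}_l$ are $\epsilon$-close if $k^{ -n}\sum_{x\in\mathbb{Z}_k^n}|h(x)-\tilde h(x)|'\le\epsilon$. A function $g$ on $\mathbb{Z}_k^n$ is an $M$-junta if there is $J\subset[n]$ with $|J|=M$ such that $g(x)$ depends only on $(x_j)_{j\in J}$. -}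

module Defs where

open import Data.Nat as ℕ using (ℕ; zero; suc; _⊓_; _∸_; ∣_-_∣; _^_)
open import Data.Integer as ℤ using (ℤ; +_)
open import Data.Rational as ℚ using (ℚ; 0ℚ; 1/_; ↥_; ↧ₙ_; ≢-nonZero)
open import Data.Rational.Properties using (_≟_)
open import Data.Fin using (Fin; toℕ)
open import Data.Fin.Subset using (Subset; _∈_)
open import Data.Vec.Functional using (Vector; _∷_)
open import Data.List using (List; allFin; map)
open import Data.Nat.ListAction using (sum)
open import Data.Product using (Σ; ∃; _×_)
open import Relation.Nullary using (yes; no)
open import Relation.Binary.PropositionalEquality using (_≡_)

cdist : (q : ℕ) → Fin q → Fin q → ℕ
cdist q a b = ∣ toℕ a - toℕ b ∣ ⊓ (q ∸ ∣ toℕ a - toℕ b ∣)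

sumFin : (n : ℕ) → (Fin n → ℕ) → ℕ
sumFin n g = sum (map g (allFin n))

sumCube : (n k : ℕ) → (Vector (Fin k) n → ℕ) → ℕ
sumCube zero    k h = h (λ ())
sumCube (suc n) k h = sumFin k (λ a → sumCube n k (λ x → h (a ∷ x)))

-- s / d as a rational (d ≥ 1 in all uses; value 0 when d = 0)
frac : ℕ → ℕ → ℚ
frac s zero    = 0ℚ
frac s (suc d) = (+ s) ℚ./ suc d

dist1 : (n q : ℕ) → Vector (Fin q) n → Vector (Fin q) n → ℚ
dist1 n q x y = frac (sumFin n (λ i → cdist q (x i) (y i))) n

Lipschitz : (k l n m : ℕ) → ℚ → (Vector (Fin k) n → Vector (Fin l) m) → Set
Lipschitz k l n m α f =
  ∀ x y → dist1 m l (f x) (f y) ℚ.≤ α ℚ.* dist1 n k x y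

Close : (k l n : ℕ) → ℚ → (Vector (Fin k) n → Fin l) → (Vector (Fin k) n → Fin l) → Set
Close k l n ε h h' = frac (sumCube n k (λ x → cdist l (h x) (h' x))) (k ^ n) ℚ.≤ ε

Junta : (k l n M : ℕ) → (Vector (Fin k) n → Fin l) → Set
Junta k l n M g = Σ (Subset n) λ J → (Data.Fin.Subset.∣ J ∣ ≡ M) ×
  (∀ x y → (∀ j → j ∈ J → x j ≡ y j) → g x ≡ g y)

-- reciprocal of a rational (1/p for p ≠ 0; 0 for p = 0, never used)
recip : ℚ → ℚ
recip p with p ≟ 0ℚ
... | yes _  = 0ℚ
... | no p≢0 = 1/_ p {{≢-nonZero p≢0}}

-- M ≤ l · 2^y for a rational y ≥ 0, written exactly without reals:
-- with y = a/d in lowest terms (a ≥ 0), this is M^d ≤ l^d · 2^a.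
BoundPow2 : ℕ → ℕ → ℚ → Set
BoundPow2 M l y = M ^ (↧ₙ y) ℕ.≤ (l ^ (↧ₙ y)) ℕ.* (2 ^ ℤ.∣ ↥ y ∣)

module Submission where

-- Each coordinate in Z_k is read off R random bits, as the index of one of k blocks of nearly equal length in
-- [0, 2^R).  On average, flipping the i-th bit moves the block index by O(k / 2^i); the Lipschitz condition holds
-- at every point, hence after summation over the bits the pulled back functions f_1, ..., f_m have average total
-- influence O(α k), and by Markov's inequality all but δ m of them have total influence O(α k / δ).
-- Half circles embed Z_l in a Boolean cube with distortion 2, and Friedgut's argument applies to all bits of the
-- embedding at once: the Fourier weight above degree d is at most O(influence / d), while Bonami's lemma bounds the
-- weight of low degree at coordinates of small influence.  With d = ⌊8 α k / (δ ε)⌋ the influential coordinates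
-- number at most l 2^(7d); the junta freezes all others at a value found by averaging.

open import Defs
open import Algebra.Core using (Op₂)
open import Algebra.Structures using (IsCommutativeSemiring)
open import Data.Bool as Bool using (Bool; true; false; _∧_; _∨_; not; if_then_else_; _xor_)
open import Data.Fin using (Fin; zero; suc; toℕ; _↑ˡ_; _↑ʳ_; combine; remQuot)
import Data.Fin.Properties as FinP
open import Data.Fin.Subset using (Subset; _∈_; ∣_∣; ⊥)
open import Data.Fin.Subset.Properties using (∣⊥∣≡0)
open import Data.Integer as ℤ using (ℤ)
import Data.Integer.Properties as ℤP
open import Data.Integer.Tactic.RingSolver using () renaming (solve-∀ to ℤ-ring)
open import Data.List.Properties using (map-tabulate)
open import Data.Nat as ℕ using (ℕ; zero; suc; _≤ᵇ_; _<ᵇ_; ∣_-_∣; _∸_; _⊓_; ⌈_/2⌉; NonZero)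
open import Data.Nat.Coprimality using (Coprime)
open import Data.Nat.DivMod using (_/_; _%_; m≡m%n+[m/n]*n; m%n<n; m/n*n≤m)
open import Data.Nat.ListAction using (sum)
import Data.Nat.Properties as ℕP
open import Data.Nat.Tactic.RingSolver using () renaming (solve-∀ to ℕ-ring)
open import Data.Product using (Σ; ∃; _×_; _,_; proj₁; proj₂)
open import Data.Sum using (inj₁; inj₂; [_,_]′)
open import Data.Unit using (tt)
open import Data.Vec as Vec using (Vec; []; _∷_; lookup; _++_; replicate; concat; tabulate; take; drop; here; there)
open import Data.Vec.Functional using (Vector) renaming (_∷_ to _∷ᶠ_)
open import Data.Vec.Properties using
  (take++drop≡id; lookup-concat; lookup-map; lookup-replicate; lookup∘tabulate; tabulate∘lookup; tabulate-cong; []=⇒lookup)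
open import Function using (_∘_; id)
open import Relation.Binary.PropositionalEquality
  using (_≡_; refl; sym; trans; cong; cong₂; subst; subst₂; module ≡-Reasoning)
open import Relation.Nullary using (yes; no; contradiction)
open import Relation.Nullary.Decidable using (from-yes)

-- Since k need not be a power of two, bit strings reproduce the uniform distribution on Z_k only
-- approximately. Long strings cure this at no cost: the expected movement of a block index, summed
-- over all R bit flips, is at most 2k whatever R is. So R can be taken so large that blocks of
-- length q satisfy (1 + 1/q)^(2n) ≤ 2, and then pairs of strings model pairs of points up to a
-- factor 2. The constant 8 in d is a product of three factors 2: the bit flips, the distortion of
-- the half circles, and this rounding. Influential coordinates are selected by the influence of the
-- Z_l-valued function itself, which dominates that of every half circle up to the factor 2. Hence
-- one set serves all half circles, and their number does not enter the estimates. The factor l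
-- comes from elsewhere: the set has size at most (ε/2) (d+1)^3 9^d, and ε ≤ l may be assumed
-- because distances in Z_l never exceed l. Everything stays in the integers: Fourier coefficients
-- are not normalised, square roots are replaced by comparisons of squares, and fractions are
-- cross-multiplied until the very end.

Cube : ℕ → Set
Cube D = Vec Bool D

infix 30 _⁰ _¹

_⁰ _¹ : ∀ {D} {A : Set} → (Cube (suc D) → A) → Cube D → A
(f ⁰) x = f (false ∷ x)
(f ¹) x = f (true ∷ x)

-- Sums over the Boolean cube and over finite index sets.

module CubeSum {A : Set} {_+_ _*_ : Op₂ A} {0# 1# : A}
  (isCommutativeSemiring : IsCommutativeSemiring _≡_ _+_ _*_ 0# 1#) where

  open IsCommutativeSemiring isCommutativeSemiring
    using (+-assoc; +-comm; distribˡ; +-identityˡ)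

  ∑ : ∀ {D} → (Cube D → A) → A
  ∑ {zero}  f = f []
  ∑ {suc D} f = ∑ (f ⁰) + ∑ (f ¹)

  ∑-cong : ∀ {D} {f g : Cube D → A} → (∀ x → f x ≡ g x) → ∑ f ≡ ∑ g
  ∑-cong {zero}  e = e []
  ∑-cong {suc D} {f} {g} e =
    cong₂ _+_ (∑-cong {f = f ⁰} {g ⁰} λ x → e (false ∷ x)) (∑-cong {f = f ¹} {g ¹} λ x → e (true ∷ x))

  interchange : ∀ a b c d → (a + b) + (c + d) ≡ (a + c) + (b + d)
  interchange a b c d = begin
    (a + b) + (c + d)  ≡⟨ +-assoc a b (c + d) ⟩
    a + (b + (c + d))  ≡⟨ cong (λ s → a + s) (trans (sym (+-assoc b c d)) (trans (cong (λ s → s + d) (+-comm b c)) (+-assoc c b d))) ⟩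
    a + (c + (b + d))  ≡⟨ +-assoc a c (b + d) ⟨
    (a + c) + (b + d)  ∎
    where open ≡-Reasoning

  ∑-+ : ∀ {D} (f g : Cube D → A) → ∑ (λ x → f x + g x) ≡ ∑ f + ∑ g
  ∑-+ {zero}  f g = refl
  ∑-+ {suc D} f g = trans (cong₂ _+_ (∑-+ (f ⁰) (g ⁰)) (∑-+ (f ¹) (g ¹)))
    (interchange (∑ (f ⁰)) (∑ (g ⁰)) (∑ (f ¹)) (∑ (g ¹)))

  ∑-* : ∀ {D} c (f : Cube D → A) → ∑ (λ x → c * f x) ≡ c * ∑ f
  ∑-* {zero}  c f = refl
  ∑-* {suc D} c f = trans (cong₂ _+_ (∑-* c (f ⁰)) (∑-* c (f ¹))) (sym (distribˡ c _ _))

  ∑-0 : ∀ {D} → ∑ {D} (λ _ → 0#) ≡ 0#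
  ∑-0 {zero}  = refl
  ∑-0 {suc D} = trans (cong₂ _+_ (∑-0 {D}) (∑-0 {D})) (+-identityˡ 0#)

  ∑-swap : ∀ {D E} (f : Cube D → Cube E → A) → ∑ (λ x → ∑ (λ y → f x y)) ≡ ∑ (λ y → ∑ (λ x → f x y))
  ∑-swap {zero}  f = refl
  ∑-swap {suc D} f = trans (cong₂ _+_ (∑-swap (f ⁰)) (∑-swap (f ¹)))
    (sym (∑-+ (λ y → ∑ (λ x → (f ⁰) x y)) (λ y → ∑ (λ x → (f ¹) x y))))

  ∑-mono : {_≤_ : A → A → Set} → (∀ {a b c d} → a ≤ b → c ≤ d → (a + c) ≤ (b + d)) →
           ∀ {D} {f g : Cube D → A} → (∀ x → f x ≤ g x) → ∑ f ≤ ∑ g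
  ∑-mono mono {zero}  h = h []
  ∑-mono {_≤_} mono {suc D} {f} {g} h = mono
    (∑-mono {_≤_} mono {f = f ⁰} {g ⁰} λ x → h (false ∷ x)) (∑-mono {_≤_} mono {f = f ¹} {g ¹} λ x → h (true ∷ x))

open CubeSum ℕP.+-*-isCommutativeSemiring using ()
  renaming (∑ to ∑ᴺ; ∑-cong to ∑ᴺ-cong; ∑-+ to ∑ᴺ-+; ∑-* to ∑ᴺ-*; ∑-swap to ∑ᴺ-swap)

∑ᴺ-≤ : ∀ {D} {f g : Cube D → ℕ} → (∀ x → f x ℕ.≤ g x) → ∑ᴺ f ℕ.≤ ∑ᴺ g
∑ᴺ-≤ {f = f} {g} = CubeSum.∑-mono ℕP.+-*-isCommutativeSemiring {ℕ._≤_} ℕP.+-mono-≤ {f = f} {g}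

sumFin-suc : ∀ n (g : Fin (suc n) → ℕ) → sumFin (suc n) g ≡ g zero ℕ.+ sumFin n (g ∘ suc)
sumFin-suc n g = cong (λ s → g zero ℕ.+ sum s) (trans (map-tabulate suc g) (sym (map-tabulate id (g ∘ suc))))

sumFin-cong : ∀ n {f g : Fin n → ℕ} → (∀ i → f i ≡ g i) → sumFin n f ≡ sumFin n g
sumFin-cong zero    e = refl
sumFin-cong (suc n) {f} {g} e = begin
  sumFin (suc n) f                     ≡⟨ sumFin-suc n f ⟩
  f zero ℕ.+ sumFin n (f ∘ suc)        ≡⟨ cong₂ ℕ._+_ (e zero) (sumFin-cong n (e ∘ suc)) ⟩
  g zero ℕ.+ sumFin n (g ∘ suc)        ≡⟨ sumFin-suc n g ⟨
  sumFin (suc n) g                     ∎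
  where open ≡-Reasoning

sumFin-mono : ∀ n {f g : Fin n → ℕ} → (∀ i → f i ℕ.≤ g i) → sumFin n f ℕ.≤ sumFin n g
sumFin-mono zero    h = ℕ.z≤n
sumFin-mono (suc n) {f} {g} h = begin
  sumFin (suc n) f                     ≡⟨ sumFin-suc n f ⟩
  f zero ℕ.+ sumFin n (f ∘ suc)        ≤⟨ ℕP.+-mono-≤ (h zero) (sumFin-mono n (h ∘ suc)) ⟩
  g zero ℕ.+ sumFin n (g ∘ suc)        ≡⟨ sumFin-suc n g ⟨
  sumFin (suc n) g                     ∎
  where open ℕP.≤-Reasoning

sumFin-+ : ∀ n (f g : Fin n → ℕ) → sumFin n (λ i → f i ℕ.+ g i) ≡ sumFin n f ℕ.+ sumFin n g
sumFin-+ zero    f g = refl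
sumFin-+ (suc n) f g = begin
  sumFin (suc n) (λ i → f i ℕ.+ g i)
    ≡⟨ sumFin-suc n (λ i → f i ℕ.+ g i) ⟩
  f zero ℕ.+ g zero ℕ.+ sumFin n (λ i → f (suc i) ℕ.+ g (suc i))
    ≡⟨ cong (f zero ℕ.+ g zero ℕ.+_) (sumFin-+ n (f ∘ suc) (g ∘ suc)) ⟩
  f zero ℕ.+ g zero ℕ.+ (sumFin n (f ∘ suc) ℕ.+ sumFin n (g ∘ suc))
    ≡⟨ lemma (f zero) (g zero) (sumFin n (f ∘ suc)) (sumFin n (g ∘ suc)) ⟩
  (f zero ℕ.+ sumFin n (f ∘ suc)) ℕ.+ (g zero ℕ.+ sumFin n (g ∘ suc))
    ≡⟨ cong₂ ℕ._+_ (sumFin-suc n f) (sumFin-suc n g) ⟨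
  sumFin (suc n) f ℕ.+ sumFin (suc n) g ∎
  where
  open ≡-Reasoning
  lemma : ∀ a b c d → a ℕ.+ b ℕ.+ (c ℕ.+ d) ≡ (a ℕ.+ c) ℕ.+ (b ℕ.+ d)
  lemma = ℕ-ring

sumFin-* : ∀ n c (f : Fin n → ℕ) → sumFin n (λ i → c ℕ.* f i) ≡ c ℕ.* sumFin n f
sumFin-* zero    c f = sym (ℕP.*-zeroʳ c)
sumFin-* (suc n) c f = begin
  sumFin (suc n) (λ i → c ℕ.* f i)                ≡⟨ sumFin-suc n (λ i → c ℕ.* f i) ⟩
  c ℕ.* f zero ℕ.+ sumFin n (λ i → c ℕ.* f (suc i)) ≡⟨ cong (c ℕ.* f zero ℕ.+_) (sumFin-* n c (f ∘ suc)) ⟩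
  c ℕ.* f zero ℕ.+ c ℕ.* sumFin n (f ∘ suc)       ≡⟨ ℕP.*-distribˡ-+ c (f zero) _ ⟨
  c ℕ.* (f zero ℕ.+ sumFin n (f ∘ suc))           ≡⟨ cong (c ℕ.*_) (sumFin-suc n f) ⟨
  c ℕ.* sumFin (suc n) f                          ∎
  where open ≡-Reasoning

sumFin-const : ∀ n c → sumFin n (λ _ → c) ≡ n ℕ.* c
sumFin-const zero    c = refl
sumFin-const (suc n) c = trans (sumFin-suc n (λ _ → c)) (cong (c ℕ.+_) (sumFin-const n c))

sumFin-swap : ∀ n m (f : Fin n → Fin m → ℕ) →
  sumFin n (λ i → sumFin m (f i)) ≡ sumFin m (λ j → sumFin n (λ i → f i j))
sumFin-swap zero    m f = sym (trans (sumFin-const m 0) (ℕP.*-zeroʳ m))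
sumFin-swap (suc n) m f = begin
  sumFin (suc n) (λ i → sumFin m (f i))
    ≡⟨ sumFin-suc n (λ i → sumFin m (f i)) ⟩
  sumFin m (f zero) ℕ.+ sumFin n (λ i → sumFin m (f (suc i)))
    ≡⟨ cong (sumFin m (f zero) ℕ.+_) (sumFin-swap n m (f ∘ suc)) ⟩
  sumFin m (f zero) ℕ.+ sumFin m (λ j → sumFin n (λ i → f (suc i) j))
    ≡⟨ sumFin-+ m (f zero) (λ j → sumFin n (λ i → f (suc i) j)) ⟨
  sumFin m (λ j → f zero j ℕ.+ sumFin n (λ i → f (suc i) j))
    ≡⟨ sumFin-cong m (λ j → sym (sumFin-suc n (λ i → f i j))) ⟩
  sumFin m (λ j → sumFin (suc n) (λ i → f i j)) ∎
  where open ≡-Reasoning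

sumFin-term : ∀ n (f : Fin n → ℕ) i → f i ℕ.≤ sumFin n f
sumFin-term (suc n) f zero    = subst (f zero ℕ.≤_) (sym (sumFin-suc n f)) (ℕP.m≤m+n _ _)
sumFin-term (suc n) f (suc i) =
  subst (f (suc i) ℕ.≤_) (sym (sumFin-suc n f)) (ℕP.≤-trans (sumFin-term n (f ∘ suc) i) (ℕP.m≤n+m _ (f zero)))

∑ᴺ-sumFin : ∀ {D} n (f : Cube D → Fin n → ℕ) →
  ∑ᴺ (λ x → sumFin n (f x)) ≡ sumFin n (λ j → ∑ᴺ (λ x → f x j))
∑ᴺ-sumFin {zero}  n f = refl
∑ᴺ-sumFin {suc D} n f = trans (cong₂ ℕ._+_ (∑ᴺ-sumFin n (f ⁰)) (∑ᴺ-sumFin n (f ¹)))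
  (sym (sumFin-+ n (λ j → ∑ᴺ (λ x → (f ⁰) x j)) (λ j → ∑ᴺ (λ x → (f ¹) x j))))

∑ᴺ-const : ∀ {D} c → ∑ᴺ {D} (λ _ → c) ≡ 2 ℕ.^ D ℕ.* c
∑ᴺ-const {zero}  c = sym (ℕP.*-identityˡ c)
∑ᴺ-const {suc D} c = trans (cong₂ ℕ._+_ (∑ᴺ-const {D} c) (∑ᴺ-const {D} c)) (lemma (2 ℕ.^ D) c)
  where
  lemma : ∀ t c → t ℕ.* c ℕ.+ t ℕ.* c ≡ 2 ℕ.* t ℕ.* c
  lemma = ℕ-ring

-- Fourier analysis on the cube

module Fourier where

  open import Data.Integer using (+_; 0ℤ; 1ℤ; _+_; _*_; _-_; -_; _≤_)

  open CubeSum ℤP.+-*-isCommutativeSemiring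

  ∑-≤ : ∀ {D} {f g : Cube D → ℤ} → (∀ x → f x ℤ.≤ g x) → ∑ f ℤ.≤ ∑ g
  ∑-≤ {f = f} {g} = CubeSum.∑-mono ℤP.+-*-isCommutativeSemiring {ℤ._≤_} ℤP.+-mono-≤ {f = f} {g}

  ∑-pos : ∀ {D} (f : Cube D → ℕ) → ∑ (λ x → + f x) ≡ + ∑ᴺ f
  ∑-pos {zero}  f = refl
  ∑-pos {suc D} f = cong₂ ℤ._+_ (∑-pos (f ⁰)) (∑-pos (f ¹))

  ∑-≥0 : ∀ {D} {f : Cube D → ℤ} → (∀ x → 0ℤ ≤ f x) → 0ℤ ≤ ∑ f
  ∑-≥0 {D} {f} h = subst (_≤ ∑ f) (∑-0 {D}) (∑-≤ {f = λ _ → 0ℤ} {f} h)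

  ∑-linear : ∀ {D} a b (f g : Cube D → ℤ) → ∑ (λ x → a * f x + b * g x) ≡ a * ∑ f + b * ∑ g
  ∑-linear a b f g = trans (∑-+ (λ x → a * f x) (λ x → b * g x)) (cong₂ _+_ (∑-* a f) (∑-* b g))

  ∑-*ʳ : ∀ {D} c (f : Cube D → ℤ) → ∑ (λ x → f x * c) ≡ ∑ f * c
  ∑-*ʳ c f = trans (∑-cong λ x → ℤP.*-comm (f x) c) (trans (∑-* c f) (ℤP.*-comm c (∑ f)))

  2^ : ℕ → ℤ
  2^ D = + (2 ℕ.^ D)

  2^-suc : ∀ D → 2^ (suc D) ≡ + 2 * 2^ D
  2^-suc D = ℤP.pos-* 2 (2 ℕ.^ D)

  *-≥0 : ∀ {a b} → 0ℤ ≤ a → 0ℤ ≤ b → 0ℤ ≤ a * b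
  *-≥0 {+ a} {+ b} _ _ = subst (0ℤ ≤_) (ℤP.pos-* a b) (ℤ.+≤+ ℕ.z≤n)

  sq-≥0 : ∀ a → 0ℤ ≤ a * a
  sq-≥0 (+ n)        = *-≥0 {+ n} {+ n} (ℤ.+≤+ ℕ.z≤n) (ℤ.+≤+ ℕ.z≤n)
  sq-≥0 (ℤ.-[1+ n ]) = ℤ.+≤+ ℕ.z≤n

  *ˡ-≤ : ∀ a {c d} → 0ℤ ≤ a → c ≤ d → a * c ≤ a * d
  *ˡ-≤ a 0≤a = ℤP.*-monoˡ-≤-nonNeg a {{ℤ.nonNegative 0≤a}}

  *ʳ-≤ : ∀ a {c d} → 0ℤ ≤ a → c ≤ d → c * a ≤ d * a
  *ʳ-≤ a 0≤a = ℤP.*-monoʳ-≤-nonNeg a {{ℤ.nonNegative 0≤a}}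

  ≤-by : ∀ {a b} r → 0ℤ ≤ r → a + r ≡ b → a ≤ b
  ≤-by {a} r 0≤r refl = subst (_≤ a + r) (ℤP.+-identityʳ a) (ℤP.+-monoʳ-≤ a 0≤r)

  -- Stands in for square roots, so that estimates obtained from Cauchy-Schwarz remain statements
  -- about integers.
  sq-cancel-≤ : ∀ a b → 0ℤ ≤ b → a * a ≤ b * b → a ≤ b
  sq-cancel-≤ a b 0≤b aa≤bb with a ℤP.≤? b
  ... | yes a≤b = a≤b
  ... | no  a≰b = contradiction (ℤP.≤-<-trans aa≤bb (ℤP.≤-<-trans
      (*ˡ-≤ b 0≤b (ℤP.<⇒≤ b<a)) (ℤP.*-monoʳ-<-pos a {{ℤ.positive (ℤP.≤-<-trans 0≤b b<a)}} b<a)))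
      (ℤP.<-irrefl refl)
    where
    b<a = ℤP.≰⇒> a≰b

  ∑-sq-≥0 : ∀ {D} (f : Cube D → ℤ) → 0ℤ ≤ ∑ (λ x → f x * f x)
  ∑-sq-≥0 f = ∑-≥0 {f = λ x → f x * f x} λ x → sq-≥0 (f x)

  -- Lagrange's identity: 2 (∑ a²)(∑ b²) − 2 (∑ a b)² is the sum of (a x · b y − a y · b x)².
  cauchy-schwarz : ∀ {D} (a b : Cube D → ℤ) →
    ∑ (λ x → a x * b x) * ∑ (λ x → a x * b x) ≤ ∑ (λ x → a x * a x) * ∑ (λ x → b x * b x)
  cauchy-schwarz {D} a b = ℤP.*-cancelˡ-≤-pos (P * P) (A * B) (+ 2)
    (≤-by (∑ λ x → ∑ (sq x)) (∑-≥0 {f = λ x → ∑ (sq x)} λ x → ∑-sq-≥0 λ y → a x * b y - a y * b x)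
      (trans (cong (_+_ (+ 2 * (P * P))) expand) (total (A * B) (P * P))))
    where
    open ≡-Reasoning
    P = ∑ (λ x → a x * b x)
    A = ∑ (λ x → a x * a x)
    B = ∑ (λ x → b x * b x)
    sq : Cube D → Cube D → ℤ
    sq x y = (a x * b y - a y * b x) * (a x * b y - a y * b x)
    total : ∀ q p → + 2 * p + (+ 2 * q + - (+ 2) * p) ≡ + 2 * q
    total = ℤ-ring
    pointwise : ∀ ax ay bx by → (ax * by - ay * bx) * (ax * by - ay * bx) ≡
      ((ax * ax) * (by * by) + (bx * bx) * (ay * ay)) + (- (+ 2) * (ax * bx)) * (ay * by)
    pointwise = ℤ-ring
    inner : ∀ x → ∑ (sq x) ≡ ((a x * a x) * B + (b x * b x) * A) + (- (+ 2) * (a x * b x)) * P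
    inner x = begin
      ∑ (sq x) ≡⟨ ∑-cong (λ y → pointwise (a x) (a y) (b x) (b y)) ⟩
      _ ≡⟨ ∑-+ (λ y → (a x * a x) * (b y * b y) + (b x * b x) * (a y * a y)) (λ y → (- (+ 2) * (a x * b x)) * (a y * b y)) ⟩
      _ ≡⟨ cong₂ _+_ (∑-linear (a x * a x) (b x * b x) (λ y → b y * b y) (λ y → a y * a y)) (∑-* (- (+ 2) * (a x * b x)) (λ y → a y * b y)) ⟩
      _ ∎
    collect : ∀ a b p → (a * b + b * a) + (- (+ 2) * p) * p ≡ + 2 * (a * b) + - (+ 2) * (p * p)
    collect = ℤ-ring
    expand : (∑ λ x → ∑ (sq x)) ≡ + 2 * (A * B) + - (+ 2) * (P * P)
    expand = begin
      _ ≡⟨ ∑-cong inner ⟩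
      _ ≡⟨ ∑-+ (λ x → (a x * a x) * B + (b x * b x) * A) (λ x → (- (+ 2) * (a x * b x)) * P) ⟩
      _ ≡⟨ cong₂ _+_
             (trans (∑-+ (λ x → (a x * a x) * B) (λ x → (b x * b x) * A)) (cong₂ _+_ (∑-*ʳ B λ x → a x * a x) (∑-*ʳ A λ x → b x * b x)))
             (trans (∑-*ʳ P λ x → - (+ 2) * (a x * b x)) (cong (_* P) (∑-* (- (+ 2)) λ x → a x * b x))) ⟩
      _ ≡⟨ collect A B P ⟩
      _ ∎

  -- The unnormalised Walsh–Fourier transform; characters are indexed by the elements of the cube.
  hat : ∀ {D} → (Cube D → ℤ) → Cube D → ℤ
  hat f []          = f []
  hat f (false ∷ S) = hat (f ⁰) S + hat (f ¹) S
  hat f (true ∷ S)  = hat (f ⁰) S - hat (f ¹) S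

  hat-- : ∀ {D} (f g : Cube D → ℤ) S → hat (λ x → f x - g x) S ≡ hat f S - hat g S
  hat-- f g []          = refl
  hat-- f g (false ∷ S) = trans (cong₂ _+_ (hat-- (f ⁰) (g ⁰) S) (hat-- (f ¹) (g ¹) S))
    (lemma (hat (f ⁰) S) (hat (g ⁰) S) (hat (f ¹) S) (hat (g ¹) S))
    where
    lemma : ∀ a b c d → (a - b) + (c - d) ≡ (a + c) - (b + d)
    lemma = ℤ-ring
  hat-- f g (true ∷ S) = trans (cong₂ _-_ (hat-- (f ⁰) (g ⁰) S) (hat-- (f ¹) (g ¹) S))
    (lemma (hat (f ⁰) S) (hat (g ⁰) S) (hat (f ¹) S) (hat (g ¹) S))
    where
    lemma : ∀ a b c d → (a - b) - (c - d) ≡ (a - c) - (b - d)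
    lemma = ℤ-ring

  -- The kernel (-1)^|x ∩ S| is symmetric in `x` and `S`. For the same reason `hat` also
  -- synthesises: applied to coefficients `c`, it gives the function with Fourier expansion `c`,
  -- which is how `bonami` uses it.
  hat-selfadjoint : ∀ {D} (f g : Cube D → ℤ) → ∑ (λ x → f x * hat g x) ≡ ∑ (λ x → hat f x * g x)
  hat-selfadjoint {zero}  f g = refl
  hat-selfadjoint {suc D} f g = begin
    ∑ (λ x → (f ⁰) x * (hat (g ⁰) x + hat (g ¹) x)) + ∑ (λ x → (f ¹) x * (hat (g ⁰) x - hat (g ¹) x))
      ≡⟨ merge (λ x → (f ⁰) x * (hat (g ⁰) x + hat (g ¹) x)) (λ x → (f ¹) x * (hat (g ⁰) x - hat (g ¹) x))
           (λ x → ((f ⁰) x * hat (g ⁰) x) + ((f ⁰) x * hat (g ¹) x)) (λ x → ((f ¹) x * hat (g ⁰) x) - ((f ¹) x * hat (g ¹) x))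
           (λ x → distrib ((f ⁰) x) ((f ¹) x) (hat (g ⁰) x) (hat (g ¹) x)) ⟩
    ∑ (λ x → ((f ⁰) x * hat (g ⁰) x) + ((f ⁰) x * hat (g ¹) x)) + ∑ (λ x → ((f ¹) x * hat (g ⁰) x) - ((f ¹) x * hat (g ¹) x))
      ≡⟨ cong₂ _+_ (∑-+ (λ x → (f ⁰) x * hat (g ⁰) x) (λ x → (f ⁰) x * hat (g ¹) x))
                   (∑-- (λ x → (f ¹) x * hat (g ⁰) x) (λ x → (f ¹) x * hat (g ¹) x)) ⟩
    (∑ (λ x → (f ⁰) x * hat (g ⁰) x) + ∑ (λ x → (f ⁰) x * hat (g ¹) x)) +
    (∑ (λ x → (f ¹) x * hat (g ⁰) x) - ∑ (λ x → (f ¹) x * hat (g ¹) x))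
      ≡⟨ cong₂ _+_ (cong₂ _+_ (hat-selfadjoint (f ⁰) (g ⁰)) (hat-selfadjoint (f ⁰) (g ¹)))
                   (cong₂ _-_ (hat-selfadjoint (f ¹) (g ⁰)) (hat-selfadjoint (f ¹) (g ¹))) ⟩
    (∑ (λ x → hat (f ⁰) x * (g ⁰) x) + ∑ (λ x → hat (f ⁰) x * (g ¹) x)) +
    (∑ (λ x → hat (f ¹) x * (g ⁰) x) - ∑ (λ x → hat (f ¹) x * (g ¹) x))
      ≡⟨ cong₂ _+_ (∑-+ (λ x → hat (f ⁰) x * (g ⁰) x) (λ x → hat (f ⁰) x * (g ¹) x))
                   (∑-- (λ x → hat (f ¹) x * (g ⁰) x) (λ x → hat (f ¹) x * (g ¹) x)) ⟨
    ∑ (λ x → (hat (f ⁰) x * (g ⁰) x) + (hat (f ⁰) x * (g ¹) x)) + ∑ (λ x → (hat (f ¹) x * (g ⁰) x) - (hat (f ¹) x * (g ¹) x))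
      ≡⟨ merge (λ x → (hat (f ⁰) x * (g ⁰) x) + (hat (f ⁰) x * (g ¹) x)) (λ x → (hat (f ¹) x * (g ⁰) x) - (hat (f ¹) x * (g ¹) x))
           (λ x → (hat (f ⁰) x + hat (f ¹) x) * (g ⁰) x) (λ x → (hat (f ⁰) x - hat (f ¹) x) * (g ¹) x)
           (λ x → regroup (hat (f ⁰) x) (hat (f ¹) x) ((g ⁰) x) ((g ¹) x)) ⟩
    ∑ (λ x → (hat (f ⁰) x + hat (f ¹) x) * (g ⁰) x) + ∑ (λ x → (hat (f ⁰) x - hat (f ¹) x) * (g ¹) x) ∎
    where
    open ≡-Reasoning
    merge : ∀ (a b c d : Cube D → ℤ) → (∀ x → a x + b x ≡ c x + d x) → ∑ a + ∑ b ≡ ∑ c + ∑ d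
    merge a b c d e = trans (sym (∑-+ a b)) (trans (∑-cong e) (∑-+ c d))
    ∑-- : (a b : Cube D → ℤ) → ∑ (λ x → a x - b x) ≡ ∑ a - ∑ b
    ∑-- a b = trans (∑-cong λ x → minus (a x) (b x)) (trans (∑-linear 1ℤ (- 1ℤ) a b) (sym (minus (∑ a) (∑ b))))
      where
      minus : ∀ a b → a - b ≡ 1ℤ * a + - 1ℤ * b
      minus = ℤ-ring
    distrib : ∀ a b c d → a * (c + d) + b * (c - d) ≡ (a * c + a * d) + (b * c - b * d)
    distrib = ℤ-ring
    regroup : ∀ a b c d → (a * c + a * d) + (b * c - b * d) ≡ (a + b) * c + (a - b) * d
    regroup = ℤ-ring

  parseval : ∀ {D} (f : Cube D → ℤ) → ∑ (λ S → hat f S * hat f S) ≡ 2^ D * ∑ (λ x → f x * f x)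
  parseval {zero}  f = sym (ℤP.*-identityˡ _)
  parseval {suc D} f = begin
    ∑ (λ S → (a S + b S) * (a S + b S)) + ∑ (λ S → (a S - b S) * (a S - b S))
      ≡⟨ ∑-+ (λ S → (a S + b S) * (a S + b S)) (λ S → (a S - b S) * (a S - b S)) ⟨
    ∑ (λ S → (a S + b S) * (a S + b S) + (a S - b S) * (a S - b S))
      ≡⟨ ∑-cong (λ S → parallelogram (a S) (b S)) ⟩
    ∑ (λ S → + 2 * (a S * a S) + + 2 * (b S * b S))
      ≡⟨ ∑-linear (+ 2) (+ 2) (λ S → a S * a S) (λ S → b S * b S) ⟩
    + 2 * ∑ (λ S → a S * a S) + + 2 * ∑ (λ S → b S * b S)
      ≡⟨ cong₂ (λ u v → + 2 * u + + 2 * v) (parseval (f ⁰)) (parseval (f ¹)) ⟩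
    + 2 * (2^ D * ∑ (λ x → (f ⁰) x * (f ⁰) x)) + + 2 * (2^ D * ∑ (λ x → (f ¹) x * (f ¹) x))
      ≡⟨ collect (2^ D) (∑ (λ x → (f ⁰) x * (f ⁰) x)) (∑ (λ x → (f ¹) x * (f ¹) x)) ⟩
    + 2 * 2^ D * (∑ (λ x → (f ⁰) x * (f ⁰) x) + ∑ (λ x → (f ¹) x * (f ¹) x))
      ≡⟨ cong (_* (∑ (λ x → f x * f x))) (2^-suc D) ⟨
    2^ (suc D) * ∑ (λ x → f x * f x) ∎
    where
    open ≡-Reasoning
    a = hat (f ⁰)
    b = hat (f ¹)
    parallelogram : ∀ a b → (a + b) * (a + b) + (a - b) * (a - b) ≡ + 2 * (a * a) + + 2 * (b * b)
    parallelogram = ℤ-ring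
    collect : ∀ t u v → + 2 * (t * u) + + 2 * (t * v) ≡ + 2 * t * (u + v)
    collect = ℤ-ring

  -- The squared L² norm with weight 3^|S| in place of the truncation in degree in Bonami's lemma.
  weighted : ∀ {D} → (Cube D → ℤ) → ℤ
  weighted {zero}  c = c [] * c []
  weighted {suc D} c = weighted (c ⁰) + + 3 * weighted (c ¹)

  weighted-≥0 : ∀ {D} (c : Cube D → ℤ) → 0ℤ ≤ weighted c
  weighted-≥0 {zero}  c = sq-≥0 (c [])
  weighted-≥0 {suc D} c = ℤP.+-mono-≤ (weighted-≥0 (c ⁰)) (*ˡ-≤ (+ 3) (ℤ.+≤+ ℕ.z≤n) (weighted-≥0 (c ¹)))

  -- Hypercontractivity from L² to L⁴, by induction on the dimension. In (u+v)⁴ + (u-v)⁴ the odd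
  -- terms cancel; the cross term 12 u²v² is handled by Cauchy-Schwarz and the two induction
  -- hypotheses. The weight 3 is just enough: 2 (A + 3B)² contains 12 A B exactly, and 16 B² is left
  -- over.
  bonami : ∀ {D} (c : Cube D → ℤ) →
    ∑ (λ x → (hat c x * hat c x) * (hat c x * hat c x)) ≤ 2^ D * (weighted c * weighted c)
  bonami {zero}  c = ℤP.≤-reflexive (sym (ℤP.*-identityˡ _))
  bonami {suc D} c = begin
    ∑ (λ x → fourth (u x + v x)) + ∑ (λ x → fourth (u x - v x))
      ≡⟨ ∑-+ (λ x → fourth (u x + v x)) (λ x → fourth (u x - v x)) ⟨
    ∑ (λ x → fourth (u x + v x) + fourth (u x - v x))
      ≡⟨ ∑-cong (λ x → expand (u x) (v x)) ⟩
    ∑ (λ x → + 2 * (fourth (u x) + fourth (v x)) + + 12 * ((u x * u x) * (v x * v x)))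
      ≡⟨ ∑-linear (+ 2) (+ 12) (λ x → fourth (u x) + fourth (v x)) (λ x → (u x * u x) * (v x * v x)) ⟩
    + 2 * ∑ (λ x → fourth (u x) + fourth (v x)) + + 12 * X
      ≡⟨ cong (λ s → + 2 * s + + 12 * X) (∑-+ (λ x → fourth (u x)) (λ x → fourth (v x))) ⟩
    + 2 * (U + V) + + 12 * X
      ≤⟨ ℤP.+-mono-≤ (*ˡ-≤ (+ 2) (ℤ.+≤+ ℕ.z≤n) (ℤP.+-mono-≤ U≤ V≤)) (*ˡ-≤ (+ 12) (ℤ.+≤+ ℕ.z≤n) X≤) ⟩
    + 2 * (T * (A * A) + T * (B * B)) + + 12 * (T * (A * B))
      ≤⟨ ≤-by (+ 16 * (T * (B * B))) (*-≥0 {+ 16} (ℤ.+≤+ ℕ.z≤n) (*-≥0 {T} (ℤ.+≤+ ℕ.z≤n) (sq-≥0 B))) (complete T A B) ⟩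
    + 2 * T * ((A + + 3 * B) * (A + + 3 * B))
      ≡⟨ cong (_* ((A + + 3 * B) * (A + + 3 * B))) (2^-suc D) ⟨
    2^ (suc D) * ((A + + 3 * B) * (A + + 3 * B)) ∎
    where
    open ℤP.≤-Reasoning
    fourth : ℤ → ℤ
    fourth a = (a * a) * (a * a)
    T = 2^ D
    u = hat (c ⁰)
    v = hat (c ¹)
    A = weighted (c ⁰)
    B = weighted (c ¹)
    U = ∑ (λ x → fourth (u x))
    V = ∑ (λ x → fourth (v x))
    X = ∑ (λ x → (u x * u x) * (v x * v x))
    U≤ : U ≤ T * (A * A)
    U≤ = bonami (c ⁰)
    V≤ : V ≤ T * (B * B)
    V≤ = bonami (c ¹)
    expand : ∀ u v → ((u + v) * (u + v)) * ((u + v) * (u + v)) + ((u - v) * (u - v)) * ((u - v) * (u - v)) ≡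
      + 2 * ((u * u) * (u * u) + (v * v) * (v * v)) + + 12 * ((u * u) * (v * v))
    expand = ℤ-ring
    complete : ∀ t a b → + 2 * (t * (a * a) + t * (b * b)) + + 12 * (t * (a * b)) + + 16 * (t * (b * b)) ≡
      + 2 * t * ((a + + 3 * b) * (a + + 3 * b))
    complete = ℤ-ring
    square : ∀ t a b → (t * (a * a)) * (t * (b * b)) ≡ (t * (a * b)) * (t * (a * b))
    square = ℤ-ring
    X≤ : X ≤ T * (A * B)
    X≤ = sq-cancel-≤ X (T * (A * B)) (*-≥0 {T} (ℤ.+≤+ ℕ.z≤n) (*-≥0 (weighted-≥0 (c ⁰)) (weighted-≥0 (c ¹)))) (begin
      X * X                            ≤⟨ cauchy-schwarz (λ x → u x * u x) (λ x → v x * v x) ⟩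
      U * V                            ≤⟨ *ˡ-≤ U (∑-sq-≥0 (λ x → u x * u x)) V≤ ⟩
      U * (T * (B * B))                ≤⟨ *ʳ-≤ (T * (B * B)) (*-≥0 {T} (ℤ.+≤+ ℕ.z≤n) (sq-≥0 B)) U≤ ⟩
      (T * (A * A)) * (T * (B * B))    ≡⟨ square T A B ⟩
      (T * (A * B)) * (T * (A * B))    ∎)

  -- Resampling the coordinates outside a set.

  b2n : Bool → ℕ
  b2n b = if b then 1 else 0

  flip : ∀ {D} → Fin D → Cube D → Cube D
  flip zero    (b ∷ x) = not b ∷ x
  flip (suc j) (b ∷ x) = b ∷ flip j x

  mix : ∀ {D} {A : Set} → Cube D → Vec A D → Vec A D → Vec A D
  mix []      []       []       = []
  mix (j ∷ J) (x ∷ xs) (y ∷ ys) = (if j then x else y) ∷ mix J xs ys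

  _⊑_ : ∀ {D} → Cube D → Cube D → Bool
  []      ⊑ []      = true
  (s ∷ S) ⊑ (j ∷ J) = (not s ∨ j) ∧ (S ⊑ J)

  weight : ∀ {D} → Cube D → ℕ
  weight []      = 0
  weight (b ∷ S) = b2n b ℕ.+ weight S

  sub : ∀ {D} → Cube D → Cube D → ℤ
  sub S J = + b2n (S ⊑ J)

  -- If `x` and `y` are independent and uniform, so is each bit of their mixture; every point of the
  -- cube arises from 2^D pairs.
  ∑-mix : ∀ {D} (J : Cube D) (h : Cube D → ℤ) → ∑ (λ x → ∑ (λ y → h (mix J x y))) ≡ 2^ D * ∑ h
  ∑-mix []      h = sym (ℤP.*-identityˡ _)
  ∑-mix {suc D} (j ∷ J) h = begin
    ∑ (λ x → m₀ j true x + m₀ j false x) + ∑ (λ x → m₁ j true x + m₁ j false x)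
      ≡⟨ cong₂ _+_ (∑-+ (m₀ j true) (m₀ j false)) (∑-+ (m₁ j true) (m₁ j false)) ⟩
    (∑ (m₀ j true) + ∑ (m₀ j false)) + (∑ (m₁ j true) + ∑ (m₁ j false))
      ≡⟨ by-cases j ⟩
    + 2 * (∑ (λ x → ∑ (λ y → (h ⁰) (mix J x y))) + ∑ (λ x → ∑ (λ y → (h ¹) (mix J x y))))
      ≡⟨ cong₂ (λ u v → + 2 * (u + v)) (∑-mix J (h ⁰)) (∑-mix J (h ¹)) ⟩
    + 2 * (2^ D * ∑ (h ⁰) + 2^ D * ∑ (h ¹))
      ≡⟨ collect (2^ D) (∑ (h ⁰)) (∑ (h ¹)) ⟩
    + 2 * 2^ D * ∑ h
      ≡⟨ cong (_* ∑ h) (2^-suc D) ⟨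
    2^ (suc D) * ∑ h ∎
    where
    open ≡-Reasoning
    m₀ m₁ : Bool → Bool → Cube D → ℤ
    m₀ j b x = ∑ (λ y → h ((if j then false else not b) ∷ mix J x y))
    m₁ j b x = ∑ (λ y → h ((if j then true else not b) ∷ mix J x y))
    collect : ∀ t u v → + 2 * (t * u + t * v) ≡ + 2 * t * (u + v)
    collect = ℤ-ring
    out : ∀ a b → (a + b) + (a + b) ≡ + 2 * (a + b)
    out = ℤ-ring
    inn : ∀ a b → (a + a) + (b + b) ≡ + 2 * (a + b)
    inn = ℤ-ring
    by-cases : ∀ j → (∑ (m₀ j true) + ∑ (m₀ j false)) + (∑ (m₁ j true) + ∑ (m₁ j false)) ≡
      + 2 * (∑ (λ x → ∑ (λ y → (h ⁰) (mix J x y))) + ∑ (λ x → ∑ (λ y → (h ¹) (mix J x y))))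
    by-cases true  = inn (∑ (m₀ true true)) (∑ (m₁ true true))
    by-cases false = out (∑ (m₀ false true)) (∑ (m₀ false false))

  corr : ∀ {D} → Cube D → (Cube D → ℤ) → (Cube D → ℤ) → ℤ
  corr J f g = ∑ (λ x → ∑ (λ y → f x * g (mix J x y)))

  -- Averaging over the coordinates outside `J` is the projection onto the characters supported in
  -- `J`, so this is Plancherel for the projected function.
  corr-hat : ∀ {D} (J : Cube D) (f g : Cube D → ℤ) → corr J f g ≡ ∑ (λ S → sub S J * (hat f S * hat g S))
  corr-hat []      f g = sym (ℤP.*-identityˡ _)
  corr-hat {suc D} (false ∷ J) f g = begin
    ∑ (λ x → ∑ (λ y → (f ⁰) x * (g ⁰) (mix J x y)) + ∑ (λ y → (f ⁰) x * (g ¹) (mix J x y))) +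
    ∑ (λ x → ∑ (λ y → (f ¹) x * (g ⁰) (mix J x y)) + ∑ (λ y → (f ¹) x * (g ¹) (mix J x y)))
      ≡⟨ cong₂ _+_ (∑-+ (λ x → ∑ (λ y → (f ⁰) x * (g ⁰) (mix J x y))) (λ x → ∑ (λ y → (f ⁰) x * (g ¹) (mix J x y))))
                   (∑-+ (λ x → ∑ (λ y → (f ¹) x * (g ⁰) (mix J x y))) (λ x → ∑ (λ y → (f ¹) x * (g ¹) (mix J x y)))) ⟩
    (corr J (f ⁰) (g ⁰) + corr J (f ⁰) (g ¹)) + (corr J (f ¹) (g ⁰) + corr J (f ¹) (g ¹))
      ≡⟨ cong₂ _+_ (cong₂ _+_ (corr-hat J (f ⁰) (g ⁰)) (corr-hat J (f ⁰) (g ¹)))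
                   (cong₂ _+_ (corr-hat J (f ¹) (g ⁰)) (corr-hat J (f ¹) (g ¹))) ⟩
    (∑ (λ S → sub S J * (hat (f ⁰) S * hat (g ⁰) S)) + ∑ (λ S → sub S J * (hat (f ⁰) S * hat (g ¹) S))) +
    (∑ (λ S → sub S J * (hat (f ¹) S * hat (g ⁰) S)) + ∑ (λ S → sub S J * (hat (f ¹) S * hat (g ¹) S)))
      ≡⟨ cong₂ _+_ (∑-+ (λ S → sub S J * (hat (f ⁰) S * hat (g ⁰) S)) (λ S → sub S J * (hat (f ⁰) S * hat (g ¹) S)))
                   (∑-+ (λ S → sub S J * (hat (f ¹) S * hat (g ⁰) S)) (λ S → sub S J * (hat (f ¹) S * hat (g ¹) S))) ⟨
    _ ≡⟨ ∑-+ (λ S → sub S J * (hat (f ⁰) S * hat (g ⁰) S) + sub S J * (hat (f ⁰) S * hat (g ¹) S))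
             (λ S → sub S J * (hat (f ¹) S * hat (g ⁰) S) + sub S J * (hat (f ¹) S * hat (g ¹) S)) ⟨
    _ ≡⟨ ∑-cong (λ S → factor (sub S J) (hat (f ⁰) S) (hat (f ¹) S) (hat (g ⁰) S) (hat (g ¹) S)) ⟩
    ∑ (λ S → sub S J * ((hat (f ⁰) S + hat (f ¹) S) * (hat (g ⁰) S + hat (g ¹) S)))
      -- The other half of the sum over `S`: sets containing the head coordinate are not contained
      -- in `false ∷ J` and contribute zero.
      ≡⟨ ℤP.+-identityʳ _ ⟨
    ∑ (λ S → sub S J * ((hat (f ⁰) S + hat (f ¹) S) * (hat (g ⁰) S + hat (g ¹) S))) + 0ℤ
      ≡⟨ cong (_+_ (∑ (λ S → sub S J * ((hat (f ⁰) S + hat (f ¹) S) * (hat (g ⁰) S + hat (g ¹) S))))) (∑-0 {D}) ⟨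
    _ ∎
    where
    open ≡-Reasoning
    factor : ∀ s a b c d → (s * (a * c) + s * (a * d)) + (s * (b * c) + s * (b * d)) ≡ s * ((a + b) * (c + d))
    factor = ℤ-ring
  corr-hat (true ∷ J) f g = begin
    ∑ (λ x → ∑ (λ y → (f ⁰) x * (g ⁰) (mix J x y)) + ∑ (λ y → (f ⁰) x * (g ⁰) (mix J x y))) +
    ∑ (λ x → ∑ (λ y → (f ¹) x * (g ¹) (mix J x y)) + ∑ (λ y → (f ¹) x * (g ¹) (mix J x y)))
      ≡⟨ cong₂ _+_ (∑-+ (λ x → ∑ (λ y → (f ⁰) x * (g ⁰) (mix J x y))) (λ x → ∑ (λ y → (f ⁰) x * (g ⁰) (mix J x y))))
                   (∑-+ (λ x → ∑ (λ y → (f ¹) x * (g ¹) (mix J x y))) (λ x → ∑ (λ y → (f ¹) x * (g ¹) (mix J x y)))) ⟩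
    (corr J (f ⁰) (g ⁰) + corr J (f ⁰) (g ⁰)) + (corr J (f ¹) (g ¹) + corr J (f ¹) (g ¹))
      ≡⟨ cong₂ (λ u v → (u + u) + (v + v)) (corr-hat J (f ⁰) (g ⁰)) (corr-hat J (f ¹) (g ¹)) ⟩
    (∑ p + ∑ p) + (∑ q + ∑ q)
      ≡⟨ double (∑ p) (∑ q) ⟩
    + 2 * ∑ p + + 2 * ∑ q
      ≡⟨ ∑-linear (+ 2) (+ 2) p q ⟨
    ∑ (λ S → + 2 * p S + + 2 * q S)
      ≡⟨ ∑-cong (λ S → factor (sub S J) (hat (f ⁰) S) (hat (f ¹) S) (hat (g ⁰) S) (hat (g ¹) S)) ⟩
    _ ≡⟨ ∑-+ (λ S → sub S J * ((hat (f ⁰) S + hat (f ¹) S) * (hat (g ⁰) S + hat (g ¹) S)))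
             (λ S → sub S J * ((hat (f ⁰) S - hat (f ¹) S) * (hat (g ⁰) S - hat (g ¹) S))) ⟩
    _ ∎
    where
    open ≡-Reasoning
    p = λ S → sub S J * (hat (f ⁰) S * hat (g ⁰) S)
    q = λ S → sub S J * (hat (f ¹) S * hat (g ¹) S)
    double : ∀ a b → (a + a) + (b + b) ≡ + 2 * a + + 2 * b
    double = ℤ-ring
    factor : ∀ s a b c d → + 2 * (s * (a * c)) + + 2 * (s * (b * d)) ≡
      s * ((a + b) * (c + d)) + s * ((a - b) * (c - d))
    factor = ℤ-ring

  -- Discrete derivatives and their low-degree weight.

  ∂ : ∀ {D} → Fin D → (Cube D → ℤ) → Cube D → ℤ
  ∂ j f x = f x - f (flip j x)

  ind : Bool → ℤ
  ind b = + b2n b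

  -- A flip of bit `j` negates the characters containing `j` and fixes the others, so the difference
  -- doubles the former and kills the latter.
  hat-∂ : ∀ {D} j (f : Cube D → ℤ) S → hat (∂ j f) S ≡ ind (lookup S j) * (+ 2 * hat f S)
  hat-∂ zero f (false ∷ S) = trans
    (cong₂ _+_ (hat-- (f ⁰) (f ¹) S) (hat-- (f ¹) (f ⁰) S)) (lemma (hat (f ⁰) S) (hat (f ¹) S))
    where
    lemma : ∀ a b → (a - b) + (b - a) ≡ 0ℤ
    lemma = ℤ-ring
  hat-∂ zero f (true ∷ S) = trans
    (cong₂ _-_ (hat-- (f ⁰) (f ¹) S) (hat-- (f ¹) (f ⁰) S)) (lemma (hat (f ⁰) S) (hat (f ¹) S))
    where
    lemma : ∀ a b → (a - b) - (b - a) ≡ 1ℤ * (+ 2 * (a - b))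
    lemma = ℤ-ring
  hat-∂ (suc j) f (false ∷ S) = trans
    (cong₂ _+_ (hat-∂ j (f ⁰) S) (hat-∂ j (f ¹) S)) (lemma (ind (lookup S j)) (hat (f ⁰) S) (hat (f ¹) S))
    where
    lemma : ∀ i a b → i * (+ 2 * a) + i * (+ 2 * b) ≡ i * (+ 2 * (a + b))
    lemma = ℤ-ring
  hat-∂ (suc j) f (true ∷ S) = trans
    (cong₂ _-_ (hat-∂ j (f ⁰) S) (hat-∂ j (f ¹) S)) (lemma (ind (lookup S j)) (hat (f ⁰) S) (hat (f ¹) S))
    where
    lemma : ∀ i a b → i * (+ 2 * a) - i * (+ 2 * b) ≡ i * (+ 2 * (a - b))
    lemma = ℤ-ring

  ^-distribʳ-* : ∀ d a b → (a ℕ.* b) ℕ.^ d ≡ a ℕ.^ d ℕ.* b ℕ.^ d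
  ^-distribʳ-* zero    a b = refl
  ^-distribʳ-* (suc d) a b = trans (cong (a ℕ.* b ℕ.*_) (^-distribʳ-* d a b)) (lemma a b (a ℕ.^ d) (b ℕ.^ d))
    where
    lemma : ∀ a b p q → a ℕ.* b ℕ.* (p ℕ.* q) ≡ a ℕ.* p ℕ.* (b ℕ.* q)
    lemma = ℕ-ring

  weighted-∑ : ∀ {D} (c : Cube D → ℤ) → weighted c ≡ ∑ (λ S → + (3 ℕ.^ weight S) * (c S * c S))
  weighted-∑ {zero}  c = sym (ℤP.*-identityˡ _)
  weighted-∑ {suc D} c = cong₂ _+_ (weighted-∑ (c ⁰))
    (trans (cong (+ 3 *_) (weighted-∑ (c ¹))) (trans (sym (∑-* (+ 3) (λ S → + (3 ℕ.^ weight S) * ((c ¹) S * (c ¹) S))))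
      (∑-cong λ S → trans (sym (ℤP.*-assoc (+ 3) (+ (3 ℕ.^ weight S)) ((c ¹) S * (c ¹) S)))
        (cong (_* ((c ¹) S * (c ¹) S)) (sym (ℤP.pos-* 3 (3 ℕ.^ weight S)))))))

  ≤ᵇ-true : ∀ m n → (m ≤ᵇ n) ≡ true → m ℕ.≤ n
  ≤ᵇ-true m n e = ℕP.≤ᵇ⇒≤ m n (subst Bool.T (sym e) tt)

  low : ∀ {D} → ℕ → Cube D → Bool
  low d S = weight S ≤ᵇ d

  -- Truncated coefficients vanish above degree `d`, and below it each weight is at most 3^d.
  weighted-low : ∀ {D} d (h : Cube D → ℤ) → let c = λ S → ind (low d S) * h S in
    weighted c ≤ + (3 ℕ.^ d) * ∑ (λ S → c S * c S)
  weighted-low {D} d h = begin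
    weighted c                                        ≡⟨ weighted-∑ c ⟩
    ∑ (λ S → + (3 ℕ.^ weight S) * (c S * c S))        ≤⟨ ∑-≤ pointwise ⟩
    ∑ (λ S → + (3 ℕ.^ d) * (c S * c S))               ≡⟨ ∑-* (+ (3 ℕ.^ d)) (λ S → c S * c S) ⟩
    + (3 ℕ.^ d) * ∑ (λ S → c S * c S)                 ∎
    where
    open ℤP.≤-Reasoning
    c : Cube D → ℤ
    c S = ind (low d S) * h S
    pointwise : ∀ S → + (3 ℕ.^ weight S) * (c S * c S) ≤ + (3 ℕ.^ d) * (c S * c S)
    pointwise S with weight S ≤ᵇ d in eq
    ... | true  = *ʳ-≤ ((1ℤ * h S) * (1ℤ * h S)) (sq-≥0 (1ℤ * h S)) (ℤ.+≤+ (ℕP.^-monoʳ-≤ 3 (≤ᵇ-true (weight S) d eq)))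
    ... | false = ℤP.≤-reflexive (trans (ℤP.*-zeroʳ (+ (3 ℕ.^ weight S))) (sym (ℤP.*-zeroʳ (+ (3 ℕ.^ d)))))

  ham : Bool → Bool → ℕ
  ham true  true  = 0
  ham true  false = 1
  ham false true  = 1
  ham false false = 0

  sq-ind : ∀ a b → (ind a - ind b) * (ind a - ind b) ≡ + ham a b
  sq-ind true  true  = refl
  sq-ind true  false = refl
  sq-ind false true  = refl
  sq-ind false false = refl

  cube-ind : ∀ a b → (ind a - ind b) * ((ind a - ind b) * (ind a - ind b)) ≡ ind a - ind b
  cube-ind true  true  = refl
  cube-ind true  false = refl
  cube-ind false true  = refl
  cube-ind false false = refl

  -- Every edge of the cube is counted from both ends.
  infl : ∀ {D} → (Cube D → Bool) → Fin D → ℕ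
  infl F j = ∑ᴺ (λ x → ham (F x) (F (flip j x)))

  module _ {D : ℕ} (F : Cube D → Bool) where

    private
      f : Cube D → ℤ
      f x = ind (F x)

      T = 2^ D

    ∂-sq : ∀ j → ∑ (λ x → ∂ j f x * ∂ j f x) ≡ + infl F j
    ∂-sq j = trans (∑-cong λ x → sq-ind (F x) (F (flip j x))) (∑-pos λ x → ham (F x) (F (flip j x)))

    -- Testing the low-degree part of ∂ⱼ f against ∂ⱼ f itself gains from ∂ⱼ f having small support.
    module _ (d : ℕ) (j : Fin D) where

      private
        g : Cube D → ℤ
        g = ∂ j f

        c : Cube D → ℤ
        c S = ind (low d S) * hat g S

        u : Cube D → ℤ
        u = hat c

        W = ∑ (λ S → c S * c S)
        N = + infl F j
        Q = ∑ (λ x → (g x * g x) * (u x * u x))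
        U = ∑ (λ x → (u x * u x) * (u x * u x))

        W≥0 : 0ℤ ≤ W
        W≥0 = ∑-sq-≥0 c

        -- The low-degree weight is the inner product of ĝ with its truncation; self-adjointness
        -- moves the transform from g to `c`.
        W≡ : W ≡ ∑ (λ x → g x * u x)
        W≡ = sym (trans (hat-selfadjoint g c) (∑-cong λ S → idem (low d S) (hat g S)))
          where
          ring₁ : ∀ h → h * (1ℤ * h) ≡ (1ℤ * h) * (1ℤ * h)
          ring₁ = ℤ-ring
          idem : ∀ b h → h * (ind b * h) ≡ (ind b * h) * (ind b * h)
          idem true  h = ring₁ h
          idem false h = ℤP.*-zeroʳ h

        -- Because g = g³, the inner product sees `u` only on the support of g. Cauchy-Schwarz then
        -- costs `N`, the size of that support, rather than the size of the cube.
        W²≤ : W * W ≤ N * Q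
        W²≤ = begin
          W * W
            ≡⟨ cong₂ _*_ W≡′ W≡′ ⟩
          ∑ (λ x → g x * ((g x * g x) * u x)) * ∑ (λ x → g x * ((g x * g x) * u x))
            ≤⟨ cauchy-schwarz g (λ x → (g x * g x) * u x) ⟩
          ∑ (λ x → g x * g x) * ∑ (λ x → ((g x * g x) * u x) * ((g x * g x) * u x))
            ≡⟨ cong₂ _*_ (∂-sq j) (∑-cong λ x → shrink (g x) (u x) (g³ x)) ⟩
          N * Q ∎
          where
          open ℤP.≤-Reasoning
          g³ : ∀ x → g x * (g x * g x) ≡ g x
          g³ x = cube-ind (F x) (F (flip j x))
          assoc : ∀ g u → g * ((g * g) * u) ≡ (g * (g * g)) * u
          assoc = ℤ-ring
          W≡′ : W ≡ ∑ (λ x → g x * ((g x * g x) * u x))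
          W≡′ = trans W≡ (∑-cong λ x → sym (trans (assoc (g x) (u x)) (cong (_* u x) (g³ x))))
          ring₁ : ∀ g u → ((g * g) * u) * ((g * g) * u) ≡ (g * (g * (g * g))) * (u * u)
          ring₁ = ℤ-ring
          shrink : ∀ g u → g * (g * g) ≡ g → ((g * g) * u) * ((g * g) * u) ≡ (g * g) * (u * u)
          shrink g u e = trans (ring₁ g u) (cong (λ s → (g * s) * (u * u)) e)

        -- The same gain a second time; it brings in the fourth moment `U`, which `bonami` controls.
        Q²≤ : Q * Q ≤ N * U
        Q²≤ = begin
          Q * Q  ≤⟨ cauchy-schwarz (λ x → g x * g x) (λ x → u x * u x) ⟩
          ∑ (λ x → (g x * g x) * (g x * g x)) * U
                 ≡⟨ cong (_* U) (trans (∑-cong λ x → ring₁ (g x) (cube-ind (F x) (F (flip j x)))) (∂-sq j)) ⟩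
          N * U  ∎
          where
          open ℤP.≤-Reasoning
          ring₀ : ∀ g → (g * g) * (g * g) ≡ g * (g * (g * g))
          ring₀ = ℤ-ring
          ring₁ : ∀ g → g * (g * g) ≡ g → (g * g) * (g * g) ≡ g * g
          ring₁ g e = trans (ring₀ g) (cong (g *_) e)

        P = + (3 ℕ.^ d)

        U≤ : U ≤ T * ((P * W) * (P * W))
        U≤ = ℤP.≤-trans (bonami c) (*ˡ-≤ T (ℤ.+≤+ ℕ.z≤n) (begin
          weighted c * weighted c  ≤⟨ *ˡ-≤ (weighted c) (weighted-≥0 c) (weighted-low d (hat g)) ⟩
          weighted c * (P * W)     ≤⟨ *ʳ-≤ (P * W) (*-≥0 {P} (ℤ.+≤+ ℕ.z≤n) W≥0) (weighted-low d (hat g)) ⟩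
          (P * W) * (P * W)        ∎))
          where open ℤP.≤-Reasoning

      -- By Parseval the total weight of the derivative is `N * T`; the threshold is set so that at
      -- most a 1/(d+1) fraction of it lies in low degree, the same loss as in the tail above degree
      -- `d`. The estimates chain to W⁴ ≤ N² Q² ≤ N³ U ≤ N³ T P² W², where W² must be cancelled,
      -- whence the case distinction on `W`. The hypothesis is N P² K² ≤ T, with P² = 9^d.
      low-weight : infl F j ℕ.* (9 ℕ.^ d ℕ.* (suc d ℕ.* suc d)) ℕ.≤ 2 ℕ.^ D → + suc d * W ≤ N * T
      low-weight small with W ℤP.≤? 0ℤ
      ... | yes W≤0 = begin
        + suc d * W   ≤⟨ *ˡ-≤ (+ suc d) (ℤ.+≤+ ℕ.z≤n) W≤0 ⟩
        + suc d * 0ℤ  ≡⟨ ℤP.*-zeroʳ (+ suc d) ⟩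
        0ℤ            ≤⟨ *-≥0 {N} {T} (ℤ.+≤+ ℕ.z≤n) (ℤ.+≤+ ℕ.z≤n) ⟩
        N * T         ∎
        where open ℤP.≤-Reasoning
      ... | no  W≰0 = sq-cancel-≤ (K * W) (N * T) (*-≥0 {N} {T} (ℤ.+≤+ ℕ.z≤n) (ℤ.+≤+ ℕ.z≤n))
        (ℤP.*-cancelˡ-≤-pos ((K * W) * (K * W)) ((N * T) * (N * T)) (W * W) {{ℤ.positive W²>0}} (begin
          (W * W) * ((K * W) * (K * W))
            ≡⟨ ring₁ K W ⟩
          (K * K) * ((W * W) * (W * W))
            ≤⟨ *ˡ-≤ (K * K) (sq-≥0 K) (ℤP.≤-trans (*ˡ-≤ (W * W) (sq-≥0 W) W²≤) (*ʳ-≤ (N * Q) NQ≥0 W²≤)) ⟩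
          (K * K) * ((N * Q) * (N * Q))
            ≡⟨ ring₂ K N Q ⟩
          (K * K) * (N * N) * (Q * Q)
            ≤⟨ *ˡ-≤ ((K * K) * (N * N)) (*-≥0 (sq-≥0 K) (sq-≥0 N)) (ℤP.≤-trans Q²≤ (*ˡ-≤ N (ℤ.+≤+ ℕ.z≤n) U≤)) ⟩
          (K * K) * (N * N) * (N * (T * ((P * W) * (P * W))))
            ≡⟨ ring₃ K N T P W ⟩
          ((N * N) * T * (W * W)) * (N * ((P * P) * (K * K)))
            ≤⟨ *ˡ-≤ ((N * N) * T * (W * W)) (*-≥0 (*-≥0 (sq-≥0 N) (ℤ.+≤+ ℕ.z≤n)) (sq-≥0 W)) small′ ⟩
          ((N * N) * T * (W * W)) * T
            ≡⟨ ring₄ N T W ⟩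
          (W * W) * ((N * T) * (N * T)) ∎))
        where
        open ℤP.≤-Reasoning
        K = + suc d
        W>0 : 0ℤ ℤ.< W
        W>0 = ℤP.≰⇒> W≰0
        W²>0 : 0ℤ ℤ.< W * W
        W²>0 = subst (ℤ._< W * W) (ℤP.*-zeroʳ W) (ℤP.*-monoˡ-<-pos W {{ℤ.positive W>0}} W>0)
        NQ≥0 : 0ℤ ≤ N * Q
        NQ≥0 = ℤP.≤-trans (sq-≥0 W) W²≤
        P² : + (9 ℕ.^ d) ≡ P * P
        P² = trans (cong +_ (^-distribʳ-* d 3 3)) (ℤP.pos-* (3 ℕ.^ d) (3 ℕ.^ d))
        small′ : N * ((P * P) * (K * K)) ≤ T
        small′ = subst (_≤ T) (trans (ℤP.pos-* (infl F j) (9 ℕ.^ d ℕ.* (suc d ℕ.* suc d)))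
          (cong (N *_) (trans (ℤP.pos-* (9 ℕ.^ d) (suc d ℕ.* suc d)) (cong₂ _*_ P² (ℤP.pos-* (suc d) (suc d))))))
          (ℤ.+≤+ small)
        ring₁ : ∀ k w → (w * w) * ((k * w) * (k * w)) ≡ (k * k) * ((w * w) * (w * w))
        ring₁ = ℤ-ring
        ring₂ : ∀ k n q → (k * k) * ((n * q) * (n * q)) ≡ (k * k) * (n * n) * (q * q)
        ring₂ = ℤ-ring
        ring₃ : ∀ k n t p w → (k * k) * (n * n) * (n * (t * ((p * w) * (p * w)))) ≡
          ((n * n) * t * (w * w)) * (n * ((p * p) * (k * k)))
        ring₃ = ℤ-ring
        ring₄ : ∀ n t w → ((n * n) * t * (w * w)) * t ≡ (w * w) * ((n * t) * (n * t))
        ring₄ = ℤ-ring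

  -- Friedgut's junta bound for one Boolean function.

  ∑-const : ∀ {D} c → ∑ {D} (λ _ → c) ≡ 2^ D * c
  ∑-const {zero}  c = sym (ℤP.*-identityˡ c)
  ∑-const {suc D} c = trans (cong₂ _+_ (∑-const {D} c) (∑-const {D} c))
    (trans (lemma (2^ D) c) (cong (_* c) (sym (2^-suc D))))
    where
    lemma : ∀ t c → t * c + t * c ≡ + 2 * t * c
    lemma = ℤ-ring

  -- Up to the factor 4^D, the probability that `F` changes when all coordinates outside `J` are
  -- resampled.
  dep : ∀ {D} → Cube D → (Cube D → Bool) → ℕ
  dep J F = ∑ᴺ (λ x → ∑ᴺ (λ y → ham (F x) (F (mix J x y))))

  weight-sumFin : ∀ {D} (S : Cube D) → weight S ≡ sumFin D (λ j → b2n (lookup S j))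
  weight-sumFin []      = refl
  weight-sumFin {suc D} (b ∷ S) = trans (cong (b2n b ℕ.+_) (weight-sumFin S))
    (sym (sumFin-suc D (λ j → b2n (lookup (b ∷ S) j))))

  ⋢-witness : ∀ {D} (S J : Cube D) →
    b2n (not (S ⊑ J)) ℕ.≤ sumFin D (λ j → b2n (not (lookup J j)) ℕ.* b2n (lookup S j))
  ⋢-witness []      []      = ℕ.z≤n
  ⋢-witness {suc D} (s ∷ S) (j ∷ J) =
    ℕP.≤-trans (head s j) (ℕP.≤-reflexive (sym (sumFin-suc D (λ i → b2n (not (lookup (j ∷ J) i)) ℕ.* b2n (lookup (s ∷ S) i)))))
    where
    rest = sumFin D (λ i → b2n (not (lookup J i)) ℕ.* b2n (lookup S i))
    head : ∀ s j → b2n (not ((s ∷ S) ⊑ (j ∷ J))) ℕ.≤ b2n (not j) ℕ.* b2n s ℕ.+ rest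
    head false true  = ⋢-witness S J
    head false false = ⋢-witness S J
    head true  true  = ⋢-witness S J
    head true  false = ℕ.s≤s ℕ.z≤n

  b2n-≤1 : ∀ b → b2n b ℕ.≤ 1
  b2n-≤1 true  = ℕP.≤-refl
  b2n-≤1 false = ℕ.z≤n

  ≤ᵇ-false : ∀ m n → (m ≤ᵇ n) ≡ false → n ℕ.< m
  ≤ᵇ-false m n e = ℕP.≰⇒> λ m≤n → subst Bool.T e (ℕP.≤⇒≤ᵇ m≤n)

  -- S is charged to a coordinate outside J if its degree is at most d, and to all its coordinates otherwise.
  escape : ∀ {D} d (S J : Cube D) → suc d ℕ.* b2n (not (S ⊑ J)) ℕ.≤
    suc d ℕ.* sumFin D (λ j → b2n (not (lookup J j)) ℕ.* (b2n (low d S) ℕ.* b2n (lookup S j))) ℕ.+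
    sumFin D (λ j → b2n (lookup S j))
  escape {D} d S J with weight S ≤ᵇ d in eq
  ... | true  = ℕP.≤-trans (ℕP.*-monoʳ-≤ (suc d) (ℕP.≤-trans (⋢-witness S J)
      (ℕP.≤-reflexive (sumFin-cong D λ j → cong (b2n (not (lookup J j)) ℕ.*_) (sym (ℕP.*-identityˡ _))))))
      (ℕP.m≤m+n _ _)
  ... | false = begin
    suc d ℕ.* b2n (not (S ⊑ J))              ≤⟨ ℕP.*-monoʳ-≤ (suc d) (b2n-≤1 (not (S ⊑ J))) ⟩
    suc d ℕ.* 1                              ≡⟨ ℕP.*-identityʳ (suc d) ⟩
    suc d                                    ≤⟨ ≤ᵇ-false (weight S) d eq ⟩
    weight S                                 ≡⟨ weight-sumFin S ⟩
    sumFin D (λ j → b2n (lookup S j))        ≤⟨ ℕP.m≤n+m _ _ ⟩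
    _ ∎
    where open ℕP.≤-Reasoning

  module _ {D : ℕ} (F : Cube D → Bool) where

    private
      f : Cube D → ℤ
      f x = ind (F x)

      T = 2^ D

      -- The squared coefficients as natural numbers, so that the charging argument of `escape` can
      -- be summed without signs.
      w : Cube D → ℕ
      w S = ℤ.∣ hat f S * hat f S ∣

      w-sq : ∀ S → + w S ≡ hat f S * hat f S
      w-sq S = ℤP.0≤i⇒+∣i∣≡i (sq-≥0 (hat f S))

      pos-indicator : ∀ b n → + (b2n b ℕ.* n) ≡ ind b * + n
      pos-indicator b n = ℤP.pos-* (b2n b) n

      ind-idem : ∀ b → ind b * ind b ≡ ind b
      ind-idem true  = refl
      ind-idem false = refl

    -- Parseval for the derivative; the 4 is the square of the 2 in `hat-∂`.
    level-sum : ∀ j → ∑ᴺ (λ S → b2n (lookup S j) ℕ.* (4 ℕ.* w S)) ≡ 2 ℕ.^ D ℕ.* infl F j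
    level-sum j = ℤP.+-injective (begin
      + ∑ᴺ (λ S → b2n (lookup S j) ℕ.* (4 ℕ.* w S))
        ≡⟨ ∑-pos (λ S → b2n (lookup S j) ℕ.* (4 ℕ.* w S)) ⟨
      ∑ (λ S → + (b2n (lookup S j) ℕ.* (4 ℕ.* w S)))
        ≡⟨ ∑-cong pointwise ⟩
      ∑ (λ S → hat (∂ j f) S * hat (∂ j f) S)
        ≡⟨ parseval (∂ j f) ⟩
      T * ∑ (λ x → ∂ j f x * ∂ j f x)
        ≡⟨ cong (T *_) (∂-sq F j) ⟩
      T * + infl F j
        ≡⟨ ℤP.pos-* (2 ℕ.^ D) (infl F j) ⟨
      + (2 ℕ.^ D ℕ.* infl F j) ∎)
      where
      open ≡-Reasoning
      ring₁ : ∀ i h → i * i * (+ 4 * (h * h)) ≡ (i * (+ 2 * h)) * (i * (+ 2 * h))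
      ring₁ = ℤ-ring
      pointwise : ∀ S → + (b2n (lookup S j) ℕ.* (4 ℕ.* w S)) ≡ hat (∂ j f) S * hat (∂ j f) S
      pointwise S = begin
        + (b2n (lookup S j) ℕ.* (4 ℕ.* w S))
          ≡⟨ pos-indicator (lookup S j) (4 ℕ.* w S) ⟩
        ind (lookup S j) * + (4 ℕ.* w S)
          ≡⟨ cong₂ _*_ (sym (ind-idem (lookup S j))) (trans (ℤP.pos-* 4 (w S)) (cong (+ 4 *_) (w-sq S))) ⟩
        ind (lookup S j) * ind (lookup S j) * (+ 4 * (hat f S * hat f S))
          ≡⟨ ring₁ (ind (lookup S j)) (hat f S) ⟩
        (ind (lookup S j) * (+ 2 * hat f S)) * (ind (lookup S j) * (+ 2 * hat f S))
          ≡⟨ cong₂ _*_ (hat-∂ j f S) (hat-∂ j f S) ⟨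
        hat (∂ j f) S * hat (∂ j f) S ∎

    low-sum : ∀ d j → infl F j ℕ.* (9 ℕ.^ d ℕ.* (suc d ℕ.* suc d)) ℕ.≤ 2 ℕ.^ D →
      suc d ℕ.* ∑ᴺ (λ S → (b2n (low d S) ℕ.* b2n (lookup S j)) ℕ.* (4 ℕ.* w S)) ℕ.≤ 2 ℕ.^ D ℕ.* infl F j
    low-sum d j small = ℤP.drop‿+≤+ (begin
      + (suc d ℕ.* ∑ᴺ summand)
        ≡⟨ ℤP.pos-* (suc d) (∑ᴺ summand) ⟩
      + suc d * + ∑ᴺ summand
        ≡⟨ cong (+ suc d *_) (trans (sym (∑-pos summand)) (∑-cong pointwise)) ⟩
      + suc d * ∑ (λ S → (ind (low d S) * hat (∂ j f) S) * (ind (low d S) * hat (∂ j f) S))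
        ≤⟨ low-weight F d j small ⟩
      + infl F j * T
        ≡⟨ ℤP.*-comm (+ infl F j) T ⟩
      T * + infl F j
        ≡⟨ ℤP.pos-* (2 ℕ.^ D) (infl F j) ⟨
      + (2 ℕ.^ D ℕ.* infl F j) ∎)
      where
      open ℤP.≤-Reasoning
      summand : Cube D → ℕ
      summand S = (b2n (low d S) ℕ.* b2n (lookup S j)) ℕ.* (4 ℕ.* w S)
      ring₁ : ∀ a i h → (a * a) * (i * i) * (+ 4 * (h * h)) ≡ (a * (i * (+ 2 * h))) * (a * (i * (+ 2 * h)))
      ring₁ = ℤ-ring
      pointwise : ∀ S → + summand S ≡ (ind (low d S) * hat (∂ j f) S) * (ind (low d S) * hat (∂ j f) S)
      pointwise S = begin-equality
        + summand S
          ≡⟨ ℤP.pos-* (b2n (low d S) ℕ.* b2n (lookup S j)) (4 ℕ.* w S) ⟩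
        + (b2n (low d S) ℕ.* b2n (lookup S j)) * + (4 ℕ.* w S)
          ≡⟨ cong₂ _*_ (pos-indicator (low d S) (b2n (lookup S j))) (trans (ℤP.pos-* 4 (w S)) (cong (+ 4 *_) (w-sq S))) ⟩
        (ind (low d S) * ind (lookup S j)) * (+ 4 * (hat f S * hat f S))
          ≡⟨ cong (_* (+ 4 * (hat f S * hat f S))) (cong₂ _*_ (ind-idem (low d S)) (ind-idem (lookup S j))) ⟨
        (ind (low d S) * ind (low d S)) * (ind (lookup S j) * ind (lookup S j)) * (+ 4 * (hat f S * hat f S))
          ≡⟨ ring₁ (ind (low d S)) (ind (lookup S j)) (hat f S) ⟩
        (ind (low d S) * (ind (lookup S j) * (+ 2 * hat f S))) * (ind (low d S) * (ind (lookup S j) * (+ 2 * hat f S)))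
          ≡⟨ cong₂ _*_ (cong (ind (low d S) *_) (hat-∂ j f S)) (cong (ind (low d S) *_) (hat-∂ j f S)) ⟨
        (ind (low d S) * hat (∂ j f) S) * (ind (low d S) * hat (∂ j f) S) ∎

    -- For bits, disagreement is (a - b)². Both squares sum to the full Fourier weight because the
    -- mixture is uniform, and the product sums to the weight inside `J` by `corr-hat`; what
    -- survives is twice the weight outside.
    dep-hat : ∀ J → dep J F ≡ 2 ℕ.* ∑ᴺ (λ S → b2n (not (S ⊑ J)) ℕ.* w S)
    dep-hat J = ℤP.+-injective (begin
      + dep J F
        ≡⟨ trans (sym (∑-pos (λ x → ∑ᴺ (λ y → ham (F x) (F (mix J x y)))))) (∑-cong λ x → sym (∑-pos (λ y → ham (F x) (F (mix J x y))))) ⟩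
      ∑ (λ x → ∑ (λ y → + ham (F x) (F (mix J x y))))
        ≡⟨ ∑-cong (λ x → trans (∑-cong λ y → pointwise x y) (inner x)) ⟩
      ∑ (λ x → (T * (f x * f x) + ∑ (λ y → f (mix J x y) * f (mix J x y))) + - (+ 2) * ∑ (λ y → f x * f (mix J x y)))
        ≡⟨ trans (∑-+ (λ x → T * (f x * f x) + ∑ (λ y → f (mix J x y) * f (mix J x y))) (λ x → - (+ 2) * ∑ (λ y → f x * f (mix J x y))))
             (cong₂ _+_ (∑-+ (λ x → T * (f x * f x)) (λ x → ∑ (λ y → f (mix J x y) * f (mix J x y))))
                        (∑-* (- (+ 2)) (λ x → ∑ (λ y → f x * f (mix J x y))))) ⟩
      (∑ (λ x → T * (f x * f x)) + ∑ (λ x → ∑ (λ y → f (mix J x y) * f (mix J x y)))) + - (+ 2) * corr J f f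
        ≡⟨ cong₂ (λ u v → u + - (+ 2) * v)
             (cong₂ _+_ (∑-* T (λ x → f x * f x)) (∑-mix J (λ x → f x * f x))) (corr-hat J f f) ⟩
      (T * E + T * E) + - (+ 2) * ∑ (λ S → sub S J * (hat f S * hat f S))
        ≡⟨ cong (λ u → (u + u) + - (+ 2) * ∑ (λ S → sub S J * (hat f S * hat f S))) (parseval f) ⟨
      (∑ (λ S → hat f S * hat f S) + ∑ (λ S → hat f S * hat f S)) + - (+ 2) * ∑ (λ S → sub S J * (hat f S * hat f S))
        ≡⟨ ring₁ (∑ (λ S → hat f S * hat f S)) (∑ (λ S → sub S J * (hat f S * hat f S))) ⟩
      + 2 * (1ℤ * ∑ (λ S → hat f S * hat f S) + - 1ℤ * ∑ (λ S → sub S J * (hat f S * hat f S)))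
        ≡⟨ cong (+ 2 *_) (∑-linear 1ℤ (- 1ℤ) (λ S → hat f S * hat f S) (λ S → sub S J * (hat f S * hat f S))) ⟨
      + 2 * ∑ (λ S → 1ℤ * (hat f S * hat f S) + - 1ℤ * (sub S J * (hat f S * hat f S)))
        ≡⟨ cong (+ 2 *_) (∑-cong λ S → sym (complement S (S ⊑ J))) ⟩
      + 2 * ∑ (λ S → + (b2n (not (S ⊑ J)) ℕ.* w S))
        ≡⟨ cong (+ 2 *_) (∑-pos (λ S → b2n (not (S ⊑ J)) ℕ.* w S)) ⟩
      + 2 * + ∑ᴺ (λ S → b2n (not (S ⊑ J)) ℕ.* w S)
        ≡⟨ ℤP.pos-* 2 (∑ᴺ (λ S → b2n (not (S ⊑ J)) ℕ.* w S)) ⟨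
      + (2 ℕ.* ∑ᴺ (λ S → b2n (not (S ⊑ J)) ℕ.* w S)) ∎)
      where
      open ≡-Reasoning
      E = ∑ (λ x → f x * f x)
      ring₀ : ∀ a b → (a - b) * (a - b) ≡ (a * a + b * b) + - (+ 2) * (a * b)
      ring₀ = ℤ-ring
      ring₁ : ∀ a b → (a + a) + - (+ 2) * b ≡ + 2 * (1ℤ * a + - 1ℤ * b)
      ring₁ = ℤ-ring
      pointwise : ∀ x y → + ham (F x) (F (mix J x y)) ≡
        (f x * f x + f (mix J x y) * f (mix J x y)) + - (+ 2) * (f x * f (mix J x y))
      pointwise x y = trans (sym (sq-ind (F x) (F (mix J x y)))) (ring₀ (f x) (f (mix J x y)))
      inner : ∀ x → ∑ (λ y → (f x * f x + f (mix J x y) * f (mix J x y)) + - (+ 2) * (f x * f (mix J x y))) ≡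
        (T * (f x * f x) + ∑ (λ y → f (mix J x y) * f (mix J x y))) + - (+ 2) * ∑ (λ y → f x * f (mix J x y))
      inner x = trans (∑-+ (λ y → f x * f x + f (mix J x y) * f (mix J x y)) (λ y → - (+ 2) * (f x * f (mix J x y))))
        (cong₂ _+_ (trans (∑-+ {D} (λ y → f x * f x) (λ y → f (mix J x y) * f (mix J x y)))
                          (cong (_+ ∑ (λ y → f (mix J x y) * f (mix J x y))) (∑-const {D} (f x * f x))))
                   (∑-* (- (+ 2)) (λ y → f x * f (mix J x y))))
      ring₂ : ∀ h → 0ℤ ≡ 1ℤ * h + - 1ℤ * (1ℤ * h)
      ring₂ = ℤ-ring
      ring₃ : ∀ h → h ≡ 1ℤ * h + 0ℤ
      ring₃ = ℤ-ring
      complement : ∀ S b → + (b2n (not b) ℕ.* w S) ≡ 1ℤ * (hat f S * hat f S) + - 1ℤ * (ind b * (hat f S * hat f S))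
      complement S true  = ring₂ (hat f S * hat f S)
      complement S false = trans (cong +_ (ℕP.*-identityˡ (w S))) (trans (w-sq S) (ring₃ (hat f S * hat f S)))

    -- The weight outside `J` is charged to coordinates by `escape`. A coordinate pays at most
    -- `2 ^ D * infl F j` for low degrees, by `low-sum`, and the same for the tail, by `level-sum`.
    -- Doubling the claim supplies the factor 4 that both lemmas carry, and these two equal payments
    -- cancel it again.
    junta-bound : ∀ d (J : Cube D) →
      (∀ j → lookup J j ≡ false → infl F j ℕ.* (9 ℕ.^ d ℕ.* (suc d ℕ.* suc d)) ℕ.≤ 2 ℕ.^ D) →
      suc d ℕ.* dep J F ℕ.≤ 2 ℕ.^ D ℕ.* sumFin D (infl F)
    junta-bound d J small = ℕP.*-cancelˡ-≤ 2 (begin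
      2 ℕ.* (suc d ℕ.* dep J F)
        ≡⟨ cong (λ s → 2 ℕ.* (suc d ℕ.* s)) (dep-hat J) ⟩
      2 ℕ.* (suc d ℕ.* (2 ℕ.* ∑ᴺ (λ S → b2n (not (S ⊑ J)) ℕ.* w S)))
        ≡⟨ trans (ring₁ (suc d) (∑ᴺ (λ S → b2n (not (S ⊑ J)) ℕ.* w S))) (sym (∑ᴺ-* (4 ℕ.* suc d) (λ S → b2n (not (S ⊑ J)) ℕ.* w S))) ⟩
      ∑ᴺ (λ S → 4 ℕ.* suc d ℕ.* (b2n (not (S ⊑ J)) ℕ.* w S))
        ≤⟨ ∑ᴺ-≤ pointwise ⟩
      ∑ᴺ (λ S → sumFin D (λ j → suc d ℕ.* (b2n (not (lookup J j)) ℕ.* p S j) ℕ.+ q S j))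
        ≡⟨ ∑ᴺ-sumFin D (λ S j → suc d ℕ.* (b2n (not (lookup J j)) ℕ.* p S j) ℕ.+ q S j) ⟩
      sumFin D (λ j → ∑ᴺ (λ S → suc d ℕ.* (b2n (not (lookup J j)) ℕ.* p S j) ℕ.+ q S j))
        ≤⟨ sumFin-mono D per-coordinate ⟩
      sumFin D (λ j → 2 ℕ.* 2 ℕ.^ D ℕ.* infl F j)
        ≡⟨ sumFin-* D (2 ℕ.* 2 ℕ.^ D) (infl F) ⟩
      2 ℕ.* 2 ℕ.^ D ℕ.* sumFin D (infl F)
        ≡⟨ ℕP.*-assoc 2 (2 ℕ.^ D) (sumFin D (infl F)) ⟩
      2 ℕ.* (2 ℕ.^ D ℕ.* sumFin D (infl F)) ∎)
      where
      open ℕP.≤-Reasoning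
      p q : Cube D → Fin D → ℕ
      p S j = (b2n (low d S) ℕ.* b2n (lookup S j)) ℕ.* (4 ℕ.* w S)
      q S j = b2n (lookup S j) ℕ.* (4 ℕ.* w S)
      ring₁ : ∀ k a → 2 ℕ.* (k ℕ.* (2 ℕ.* a)) ≡ 4 ℕ.* k ℕ.* a
      ring₁ = ℕ-ring
      ring₂ : ∀ k b w → 4 ℕ.* k ℕ.* (b ℕ.* w) ≡ 4 ℕ.* w ℕ.* (k ℕ.* b)
      ring₂ = ℕ-ring
      ring₃ : ∀ k b l w → 4 ℕ.* w ℕ.* (k ℕ.* b ℕ.+ l) ≡ k ℕ.* (4 ℕ.* w ℕ.* b) ℕ.+ 4 ℕ.* w ℕ.* l
      ring₃ = ℕ-ring
      ring₄ : ∀ k n l b w → k ℕ.* (4 ℕ.* w ℕ.* (n ℕ.* (l ℕ.* b))) ℕ.+ 4 ℕ.* w ℕ.* b ≡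
        k ℕ.* (n ℕ.* ((l ℕ.* b) ℕ.* (4 ℕ.* w))) ℕ.+ b ℕ.* (4 ℕ.* w)
      ring₄ = ℕ-ring
      pointwise : ∀ S → 4 ℕ.* suc d ℕ.* (b2n (not (S ⊑ J)) ℕ.* w S) ℕ.≤
        sumFin D (λ j → suc d ℕ.* (b2n (not (lookup J j)) ℕ.* p S j) ℕ.+ q S j)
      pointwise S = begin
        4 ℕ.* suc d ℕ.* (b2n (not (S ⊑ J)) ℕ.* w S)
          ≡⟨ ring₂ (suc d) (b2n (not (S ⊑ J))) (w S) ⟩
        4 ℕ.* w S ℕ.* (suc d ℕ.* b2n (not (S ⊑ J)))
          ≤⟨ ℕP.*-monoʳ-≤ (4 ℕ.* w S) (escape d S J) ⟩
        4 ℕ.* w S ℕ.* (suc d ℕ.* sumFin D a ℕ.+ sumFin D b)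
          ≡⟨ ring₃ (suc d) (sumFin D a) (sumFin D b) (w S) ⟩
        suc d ℕ.* (4 ℕ.* w S ℕ.* sumFin D a) ℕ.+ 4 ℕ.* w S ℕ.* sumFin D b
          ≡⟨ cong₂ (λ u v → suc d ℕ.* u ℕ.+ v) (sumFin-* D (4 ℕ.* w S) a) (sumFin-* D (4 ℕ.* w S) b) ⟨
        suc d ℕ.* sumFin D (λ j → 4 ℕ.* w S ℕ.* a j) ℕ.+ sumFin D (λ j → 4 ℕ.* w S ℕ.* b j)
          ≡⟨ cong (ℕ._+ sumFin D (λ j → 4 ℕ.* w S ℕ.* b j)) (sumFin-* D (suc d) (λ j → 4 ℕ.* w S ℕ.* a j)) ⟨
        sumFin D (λ j → suc d ℕ.* (4 ℕ.* w S ℕ.* a j)) ℕ.+ sumFin D (λ j → 4 ℕ.* w S ℕ.* b j)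
          ≡⟨ sumFin-+ D (λ j → suc d ℕ.* (4 ℕ.* w S ℕ.* a j)) (λ j → 4 ℕ.* w S ℕ.* b j) ⟨
        sumFin D (λ j → suc d ℕ.* (4 ℕ.* w S ℕ.* a j) ℕ.+ 4 ℕ.* w S ℕ.* b j)
          ≡⟨ sumFin-cong D (λ j → ring₄ (suc d) (b2n (not (lookup J j))) (b2n (low d S)) (b2n (lookup S j)) (w S)) ⟩
        sumFin D (λ j → suc d ℕ.* (b2n (not (lookup J j)) ℕ.* p S j) ℕ.+ q S j) ∎
        where
        a b : Fin D → ℕ
        a j = b2n (not (lookup J j)) ℕ.* (b2n (low d S) ℕ.* b2n (lookup S j))
        b j = b2n (lookup S j)
      low-part : ∀ j b → lookup J j ≡ b → suc d ℕ.* (b2n (not b) ℕ.* ∑ᴺ (λ S → p S j)) ℕ.≤ 2 ℕ.^ D ℕ.* infl F j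
      low-part j true  _ = subst (ℕ._≤ 2 ℕ.^ D ℕ.* infl F j) (sym (ℕP.*-zeroʳ (suc d))) ℕ.z≤n
      low-part j false e = subst (λ s → suc d ℕ.* s ℕ.≤ 2 ℕ.^ D ℕ.* infl F j)
        (sym (ℕP.*-identityˡ (∑ᴺ (λ S → p S j)))) (low-sum d j (small j e))
      per-coordinate : ∀ j → ∑ᴺ (λ S → suc d ℕ.* (b2n (not (lookup J j)) ℕ.* p S j) ℕ.+ q S j) ℕ.≤ 2 ℕ.* 2 ℕ.^ D ℕ.* infl F j
      per-coordinate j = begin
        ∑ᴺ (λ S → suc d ℕ.* (b2n (not (lookup J j)) ℕ.* p S j) ℕ.+ q S j)
          ≡⟨ ∑ᴺ-+ (λ S → suc d ℕ.* (b2n (not (lookup J j)) ℕ.* p S j)) (λ S → q S j) ⟩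
        ∑ᴺ (λ S → suc d ℕ.* (b2n (not (lookup J j)) ℕ.* p S j)) ℕ.+ ∑ᴺ (λ S → q S j)
          ≡⟨ cong₂ ℕ._+_ (trans (∑ᴺ-* (suc d) (λ S → b2n (not (lookup J j)) ℕ.* p S j))
                                (cong (suc d ℕ.*_) (∑ᴺ-* (b2n (not (lookup J j))) (λ S → p S j)))) (level-sum j) ⟩
        suc d ℕ.* (b2n (not (lookup J j)) ℕ.* ∑ᴺ (λ S → p S j)) ℕ.+ 2 ℕ.^ D ℕ.* infl F j
          ≤⟨ ℕP.+-monoˡ-≤ (2 ℕ.^ D ℕ.* infl F j) (low-part j (lookup J j) refl) ⟩
        2 ℕ.^ D ℕ.* infl F j ℕ.+ 2 ℕ.^ D ℕ.* infl F j
          ≡⟨ ring₅ (2 ℕ.^ D) (infl F j) ⟩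
        2 ℕ.* 2 ℕ.^ D ℕ.* infl F j ∎
        where
        ring₅ : ∀ t i → t ℕ.* i ℕ.+ t ℕ.* i ≡ 2 ℕ.* t ℕ.* i
        ring₅ = ℕ-ring

open Fourier

module Counting where

  open import Data.Nat using (_+_; _*_; _≤_; _<_; _^_)

  sumFin-↑ : ∀ m n (g : Fin (m + n) → ℕ) → sumFin (m + n) g ≡ sumFin m (λ i → g (i ↑ˡ n)) + sumFin n (λ i → g (m ↑ʳ i))
  sumFin-↑ zero    n g = refl
  sumFin-↑ (suc m) n g = begin
    sumFin (suc m + n) g
      ≡⟨ sumFin-suc (m + n) g ⟩
    g zero + sumFin (m + n) (g ∘ suc)
      ≡⟨ cong (g zero +_) (sumFin-↑ m n (g ∘ suc)) ⟩
    g zero + (sumFin m (λ i → g (suc i ↑ˡ n)) + sumFin n (λ i → g (suc m ↑ʳ i)))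
      ≡⟨ ℕP.+-assoc (g zero) _ _ ⟨
    g zero + sumFin m (λ i → g (suc i ↑ˡ n)) + sumFin n (λ i → g (suc m ↑ʳ i))
      ≡⟨ cong (_+ sumFin n (λ i → g (suc m ↑ʳ i))) (sumFin-suc m (λ i → g (i ↑ˡ n))) ⟨
    sumFin (suc m) (λ i → g (i ↑ˡ n)) + sumFin n (λ i → g (suc m ↑ʳ i)) ∎
    where open ≡-Reasoning

  -- The half-circle embedding of the cycle.

  ham-sym : ∀ a b → ham a b ≡ ham b a
  ham-sym true  true  = refl
  ham-sym true  false = refl
  ham-sym false true  = refl
  ham-sym false false = refl

  ham-triangle : ∀ a b c → ham a c ≤ ham a b + ham b c
  ham-triangle true  true  c     = ℕP.≤-refl
  ham-triangle false false c     = ℕP.≤-refl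
  ham-triangle true  false true  = ℕ.z≤n
  ham-triangle true  false false = ℕP.≤-refl
  ham-triangle false true  false = ℕ.z≤n
  ham-triangle false true  true  = ℕP.≤-refl

  ham-≤1 : ∀ a b {n} → ham a b ≤ suc n
  ham-≤1 true  true  = ℕ.z≤n
  ham-≤1 true  false = ℕ.s≤s ℕ.z≤n
  ham-≤1 false true  = ℕ.s≤s ℕ.z≤n
  ham-≤1 false false = ℕ.z≤n

  ham-not : ∀ a b → ham (not a) (not b) ≡ ham a b
  ham-not true  true  = refl
  ham-not true  false = refl
  ham-not false true  = refl
  ham-not false false = refl

  ham-xor : ∀ a b c d → ham (a xor b) (c xor d) ≤ ham a c + ham b d
  ham-xor true  b true  d = ℕP.≤-reflexive (ham-not b d)
  ham-xor true  b false d = ham-≤1 (not b) d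
  ham-xor false b true  d = ham-≤1 b (not d)
  ham-xor false b false d = ℕP.≤-refl

  -- The thresholds separating `a` from `b` are those from the smaller number up to just below the
  -- larger; some may lie beyond `n`, hence an inequality.
  thresholds : ∀ n a b → sumFin n (λ s → ham (toℕ s <ᵇ a) (toℕ s <ᵇ b)) ≤ ∣ a - b ∣
  thresholds zero    a b = ℕ.z≤n
  thresholds (suc n) a b = ℕP.≤-trans (ℕP.≤-reflexive (sumFin-suc n (λ s → ham (toℕ s <ᵇ a) (toℕ s <ᵇ b)))) (rest a b)
    where
    rest : ∀ a b → ham (0 <ᵇ a) (0 <ᵇ b) + sumFin n (λ s → ham (suc (toℕ s) <ᵇ a) (suc (toℕ s) <ᵇ b)) ≤ ∣ a - b ∣
    rest zero    zero    = thresholds n zero zero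
    rest zero    (suc b) = ℕ.s≤s (thresholds n zero b)
    rest (suc a) zero    = ℕ.s≤s (ℕP.≤-trans (thresholds n a zero) (ℕP.≤-reflexive (ℕP.∣-∣-identityʳ a)))
    rest (suc a) (suc b) = thresholds n a b

  -- The half circles of the cycle of length 2r: bit t of a changes at a = t and at a = r + t.
  code : ℕ → ℕ → ℕ → Bool
  code r t a = (t <ᵇ a) xor (r + t <ᵇ a)

  codeDist : ℕ → ℕ → ℕ → ℕ
  codeDist r a b = sumFin r (λ t → ham (code r (toℕ t) a) (code r (toℕ t) b))

  <ᵇ-true : ∀ {m n} → m < n → (m <ᵇ n) ≡ true
  <ᵇ-true {m} {n} m<n with m <ᵇ n in eq
  ... | true  = refl
  ... | false = contradiction (subst Bool.T eq (ℕP.<⇒<ᵇ m<n)) λ ()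

  <ᵇ-false : ∀ {m n} → n ≤ m → (m <ᵇ n) ≡ false
  <ᵇ-false {m} {n} n≤m with m <ᵇ n in eq
  ... | false = refl
  ... | true  = contradiction (ℕP.<ᵇ⇒< m n (subst Bool.T (sym eq) _)) (ℕP.≤⇒≯ n≤m)

  +-<ᵇ : ∀ r t a → (r + t <ᵇ r + a) ≡ (t <ᵇ a)
  +-<ᵇ zero    t a = refl
  +-<ᵇ (suc r) t a = +-<ᵇ r t a

  module _ (r : ℕ) where

    codeDist-triangle : ∀ a b c → codeDist r a c ≤ codeDist r a b + codeDist r b c
    codeDist-triangle a b c = ℕP.≤-trans
      (sumFin-mono r λ t → ham-triangle (code r (toℕ t) a) (code r (toℕ t) b) (code r (toℕ t) c))
      (ℕP.≤-reflexive (sumFin-+ r (λ t → ham (code r (toℕ t) a) (code r (toℕ t) b)) (λ t → ham (code r (toℕ t) b) (code r (toℕ t) c))))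

    codeDist-sym : ∀ a b → codeDist r a b ≡ codeDist r b a
    codeDist-sym a b = sumFin-cong r λ t → ham-sym (code r (toℕ t) a) (code r (toℕ t) b)

    codeDist-≤ : ∀ a b → codeDist r a b ≤ ∣ a - b ∣
    codeDist-≤ a b = begin
      codeDist r a b
        ≤⟨ sumFin-mono r (λ t → ham-xor (toℕ t <ᵇ a) (r + toℕ t <ᵇ a) (toℕ t <ᵇ b) (r + toℕ t <ᵇ b)) ⟩
      sumFin r (λ t → ham (toℕ t <ᵇ a) (toℕ t <ᵇ b) + ham (r + toℕ t <ᵇ a) (r + toℕ t <ᵇ b))
        ≡⟨ sumFin-+ r (λ t → ham (toℕ t <ᵇ a) (toℕ t <ᵇ b)) (λ t → ham (r + toℕ t <ᵇ a) (r + toℕ t <ᵇ b)) ⟩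
      sumFin r (λ t → ham (toℕ t <ᵇ a) (toℕ t <ᵇ b)) + sumFin r (λ t → ham (r + toℕ t <ᵇ a) (r + toℕ t <ᵇ b))
        ≡⟨ cong₂ _+_ (sumFin-cong r (λ t → cong (λ s → ham (s <ᵇ a) (s <ᵇ b)) (FinP.toℕ-↑ˡ t r)))
                     (sumFin-cong r (λ t → cong (λ s → ham (s <ᵇ a) (s <ᵇ b)) (FinP.toℕ-↑ʳ r t))) ⟨
      sumFin r (λ t → ham (toℕ (t ↑ˡ r) <ᵇ a) (toℕ (t ↑ˡ r) <ᵇ b)) + sumFin r (λ t → ham (toℕ (r ↑ʳ t) <ᵇ a) (toℕ (r ↑ʳ t) <ᵇ b))
        ≡⟨ sumFin-↑ r r (λ s → ham (toℕ s <ᵇ a) (toℕ s <ᵇ b)) ⟨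
      sumFin (r + r) (λ s → ham (toℕ s <ᵇ a) (toℕ s <ᵇ b))
        ≤⟨ thresholds (r + r) a b ⟩
      ∣ a - b ∣ ∎
      where open ℕP.≤-Reasoning

    -- A move by half the circle passes exactly one of the two change points of each bit, so all r
    -- bits flip. Together with the triangle inequality this is the source of all lower bounds on
    -- `codeDist`.
    codeDist-antipode : ∀ a → a ≤ r → r ≤ codeDist r a (r + a)
    codeDist-antipode a a≤r = ℕP.≤-trans (ℕP.≤-reflexive (sym (trans (sumFin-const r 1) (ℕP.*-identityʳ r))))
      (sumFin-mono r λ t → ℕP.≤-reflexive (sym (differ t)))
      where
      differ : ∀ t → ham (code r (toℕ t) a) (code r (toℕ t) (r + a)) ≡ 1
      differ t rewrite <ᵇ-false (ℕP.≤-trans a≤r (ℕP.m≤m+n r (toℕ t))) | +-<ᵇ r (toℕ t) a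
        | <ᵇ-true (ℕP.<-≤-trans (FinP.toℕ<n t) (ℕP.m≤m+n r a)) with toℕ t <ᵇ a
      ... | true  = refl
      ... | false = refl

    -- The points 0 and 2r get the same code, which closes the segment to a circle.
    codeDist-period : codeDist r 0 (r + r) ≡ 0
    codeDist-period = trans (sumFin-cong r agree) (trans (sumFin-const r 0) (ℕP.*-zeroʳ r))
      where
      agree : ∀ t → ham (code r (toℕ t) 0) (code r (toℕ t) (r + r)) ≡ 0
      agree t rewrite +-<ᵇ r (toℕ t) r | <ᵇ-true {toℕ t} {r} (FinP.toℕ<n t)
        | <ᵇ-true {toℕ t} {r + r} (ℕP.<-≤-trans (FinP.toℕ<n t) (ℕP.m≤m+n r r)) = refl

    module _ {l : ℕ} (l≤2r : l ≤ r + r) (2r≤1+l : r + r ≤ suc l) where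

      -- The way round through 0, identified with 2r, has length at most l + 1 - x. The excess 1,
      -- which occurs when l is odd, is absorbed by the factor 2 because l - x ≥ 1.
      codeDist-upper : ∀ a x → a + x < l → codeDist r a (a + x) ≤ 2 * (x ⊓ (l ∸ x))
      codeDist-upper a x a+x<l with ℕP.⊓-sel x (l ∸ x)
      ... | inj₁ e rewrite e = ℕP.≤-trans (codeDist-≤ a (a + x))
            (ℕP.≤-trans (ℕP.≤-reflexive (ℕP.∣m-m+n∣≡n a x)) (ℕP.m≤m+n x _))
      ... | inj₂ e rewrite e = begin
        codeDist r a (a + x)
          ≤⟨ codeDist-triangle a 0 (a + x) ⟩
        codeDist r a 0 + codeDist r 0 (a + x)
          ≤⟨ ℕP.+-mono-≤ (codeDist-≤ a 0) (codeDist-triangle 0 (r + r) (a + x)) ⟩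
        ∣ a - 0 ∣ + (codeDist r 0 (r + r) + codeDist r (r + r) (a + x))
          ≤⟨ ℕP.+-mono-≤ (ℕP.≤-reflexive (ℕP.∣-∣-identityʳ a)) (ℕP.+-mono-≤ (ℕP.≤-reflexive codeDist-period) (codeDist-≤ (r + r) (a + x))) ⟩
        a + ∣ r + r - a + x ∣
          ≡⟨ cong (a +_) (ℕP.m≤n⇒∣n-m∣≡n∸m a+x≤2r) ⟩
        a + (r + r ∸ (a + x))
          ≤⟨ ℕP.+-monoʳ-≤ a (ℕP.∸-monoˡ-≤ (a + x) 2r≤1+l) ⟩
        a + (suc l ∸ (a + x))
          ≡⟨ cong (λ s → a + (suc s ∸ (a + x))) (sym l≡) ⟩
        a + (suc (suc (a + x) + y) ∸ (a + x))
          ≡⟨ cong (a +_) (trans (cong (_∸ (a + x)) (ring₁ (a + x) y)) (ℕP.m+n∸m≡n (a + x) (2 + y))) ⟩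
        a + (2 + y)
          ≤⟨ ℕP.≤-trans (ℕP.m≤m+n (a + (2 + y)) (a + y)) (ℕP.≤-reflexive (ring₂ a y)) ⟩
        2 * (suc (a + y))
          ≡⟨ cong (2 *_) (sym (trans (cong (_∸ x) (sym l≡)) (trans (cong (_∸ x) (ring₃ a x y)) (ℕP.m+n∸m≡n x (suc (a + y)))))) ⟩
        2 * (l ∸ x) ∎
        where
        open ℕP.≤-Reasoning
        y = l ∸ suc (a + x)
        l≡ : suc (a + x) + y ≡ l
        l≡ = ℕP.m+[n∸m]≡n a+x<l
        a+x≤2r : a + x ≤ r + r
        a+x≤2r = ℕP.≤-trans (ℕP.<⇒≤ a+x<l) l≤2r
        ring₁ : ∀ c y → suc (suc c + y) ≡ c + (2 + y)
        ring₁ = ℕ-ring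
        ring₂ : ∀ a y → a + (2 + y) + (a + y) ≡ 2 * (suc (a + y))
        ring₂ = ℕ-ring
        ring₃ : ∀ a x y → suc (a + x) + y ≡ x + suc (a + y)
        ring₃ = ℕ-ring

      -- Antipodes have distance r, and a detour through a third point cannot be shorter. When x ≤
      -- r, the remaining piece of a half circle has length r - x, which leaves x for the given
      -- pair. When x ≥ r, the antipode of `a` lies between the two points, which leaves 2r - x ≥ l
      -- - x.
      codeDist-lower : ∀ a x → a + x < l → x ⊓ (l ∸ x) ≤ codeDist r a (a + x)
      codeDist-lower a x a+x<l with ℕP.≤-total x r | ℕP.≤-total a r
      ... | inj₁ x≤r | inj₁ a≤r = ℕP.≤-trans (ℕP.m⊓n≤m x (l ∸ x)) (ℕP.+-cancelʳ-≤ y x _ (begin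
        x + y                                                  ≡⟨ r≡ ⟩
        r                                                      ≤⟨ codeDist-antipode a a≤r ⟩
        codeDist r a (r + a)                                   ≤⟨ codeDist-triangle a (a + x) (r + a) ⟩
        codeDist r a (a + x) + codeDist r (a + x) (r + a)      ≤⟨ ℕP.+-monoʳ-≤ _ (codeDist-≤ (a + x) (r + a)) ⟩
        codeDist r a (a + x) + ∣ a + x - r + a ∣               ≡⟨ cong (codeDist r a (a + x) +_) gap ⟩
        codeDist r a (a + x) + y                               ∎))
        where
        open ℕP.≤-Reasoning
        y = r ∸ x
        r≡ : x + y ≡ r
        r≡ = ℕP.m+[n∸m]≡n x≤r
        ring₁ : ∀ a x y → x + y + a ≡ a + x + y
        ring₁ = ℕ-ring
        gap : ∣ a + x - r + a ∣ ≡ y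
        gap = trans (cong (λ s → ∣ a + x - s ∣) (trans (cong (_+ a) (sym r≡)) (ring₁ a x y))) (ℕP.∣m-m+n∣≡n (a + x) y)
      -- The point r + a may lie past 2r here, so the half circle ends at a + x instead and starts
      -- at its antipode `b`.
      ... | inj₁ x≤r | inj₂ r≤a = ℕP.≤-trans (ℕP.m⊓n≤m x (l ∸ x)) (ℕP.+-cancelˡ-≤ y x _ (begin
        y + x                                                  ≡⟨ r≡ ⟩
        r                                                      ≤⟨ codeDist-antipode b b≤r ⟩
        codeDist r b (r + b)                                   ≤⟨ codeDist-triangle b a (r + b) ⟩
        codeDist r b a + codeDist r a (r + b)                  ≤⟨ ℕP.+-mono-≤ (codeDist-≤ b a) (ℕP.≤-reflexive (cong (codeDist r a) r+b≡)) ⟩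
        ∣ b - a ∣ + codeDist r a (a + x)                       ≡⟨ cong (_+ codeDist r a (a + x)) gap ⟩
        y + codeDist r a (a + x)                               ∎))
        where
        open ℕP.≤-Reasoning
        y = r ∸ x
        b = (a ∸ r) + x
        r≡ : y + x ≡ r
        r≡ = ℕP.m∸n+n≡m x≤r
        r+b≡ : r + b ≡ a + x
        r+b≡ = trans (sym (ℕP.+-assoc r (a ∸ r) x)) (cong (_+ x) (ℕP.m+[n∸m]≡n r≤a))
        b≤r : b ≤ r
        b≤r = ℕP.+-cancelˡ-≤ r b r (ℕP.≤-trans (ℕP.≤-reflexive r+b≡) (ℕP.≤-trans (ℕP.<⇒≤ a+x<l) l≤2r))
        b+y≡a : b + y ≡ a
        b+y≡a = ℕP.+-cancelʳ-≡ x (b + y) a (trans (trans (ℕP.+-assoc b y x) (trans (cong (b +_) r≡) (ℕP.+-comm b r))) r+b≡)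
        gap : ∣ b - a ∣ ≡ y
        gap = trans (cong (λ s → ∣ b - s ∣) (sym b+y≡a)) (ℕP.∣m-m+n∣≡n b y)
      ... | inj₂ r≤x | _ = ℕP.≤-trans (ℕP.m⊓n≤n x (l ∸ x)) (ℕP.≤-trans (ℕP.∸-monoˡ-≤ x l≤2r)
          (ℕP.m≤n+o⇒m∸n≤o (r + r) x (begin
        r + r                                                  ≤⟨ ℕP.+-monoʳ-≤ r (codeDist-antipode a a≤r) ⟩
        r + codeDist r a (r + a)                               ≤⟨ ℕP.+-monoʳ-≤ r (codeDist-triangle a (a + x) (r + a)) ⟩
        r + (codeDist r a (a + x) + codeDist r (a + x) (r + a)) ≤⟨ ℕP.+-monoʳ-≤ r (ℕP.+-monoʳ-≤ (codeDist r a (a + x)) (codeDist-≤ (a + x) (r + a))) ⟩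
        r + (codeDist r a (a + x) + ∣ a + x - r + a ∣)         ≡⟨ cong (λ s → r + (codeDist r a (a + x) + s)) gap ⟩
        r + (codeDist r a (a + x) + y)                         ≡⟨ ring₂ r (codeDist r a (a + x)) y ⟩
        (r + y) + codeDist r a (a + x)                         ≡⟨ cong (_+ codeDist r a (a + x)) x≡ ⟩
        x + codeDist r a (a + x)                               ∎)))
        where
        open ℕP.≤-Reasoning
        y = x ∸ r
        x≡ : r + y ≡ x
        x≡ = ℕP.m+[n∸m]≡n r≤x
        a≤r : a ≤ r
        a≤r = ℕP.+-cancelʳ-≤ r a r (ℕP.≤-trans (ℕP.+-monoʳ-≤ a r≤x) (ℕP.≤-trans (ℕP.<⇒≤ a+x<l) l≤2r))
        ring₁ : ∀ a r y → a + (r + y) ≡ r + a + y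
        ring₁ = ℕ-ring
        ring₂ : ∀ r c y → r + (c + y) ≡ (r + y) + c
        ring₂ = ℕ-ring
        gap : ∣ a + x - r + a ∣ ≡ y
        gap = trans (cong (λ s → ∣ s - r + a ∣) (trans (cong (a +_) (sym x≡)) (ring₁ a r y)))
          (trans (ℕP.∣-∣-comm (r + a + y) (r + a)) (ℕP.∣m-m+n∣≡n (r + a) y))

      cdist-sym : (a b : Fin l) → cdist l a b ≡ cdist l b a
      cdist-sym a b = cong (λ s → s ⊓ (l ∸ s)) (ℕP.∣-∣-comm (toℕ a) (toℕ b))

      private
        ordered : ∀ (a b : Fin l) → toℕ a ≤ toℕ b →
          cdist l a b ≤ codeDist r (toℕ a) (toℕ b) × codeDist r (toℕ a) (toℕ b) ≤ 2 * cdist l a b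
        ordered a b a≤b = subst (λ s → s ⊓ (l ∸ s) ≤ C × C ≤ 2 * (s ⊓ (l ∸ s))) (sym (ℕP.m≤n⇒∣m-n∣≡n∸m a≤b))
          (subst (λ s → x ⊓ (l ∸ x) ≤ codeDist r (toℕ a) s × codeDist r (toℕ a) s ≤ 2 * (x ⊓ (l ∸ x)))
            b≡ (codeDist-lower (toℕ a) x b<l , codeDist-upper (toℕ a) x b<l))
          where
          C = codeDist r (toℕ a) (toℕ b)
          x = toℕ b ∸ toℕ a
          b≡ : toℕ a + x ≡ toℕ b
          b≡ = ℕP.m+[n∸m]≡n a≤b
          b<l : toℕ a + x < l
          b<l = subst (_< l) (sym b≡) (FinP.toℕ<n b)

      code-distortion : (a b : Fin l) →
        cdist l a b ≤ codeDist r (toℕ a) (toℕ b) × codeDist r (toℕ a) (toℕ b) ≤ 2 * cdist l a b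
      code-distortion a b with ℕP.≤-total (toℕ a) (toℕ b)
      ... | inj₁ a≤b = ordered a b a≤b
      ... | inj₂ b≤a = subst₂ (λ u v → u ≤ v × v ≤ 2 * u) (cdist-sym b a) (codeDist-sym (toℕ b) (toℕ a)) (ordered b a b≤a)

  half-cover : ∀ l → l ≤ ⌈ l /2⌉ + ⌈ l /2⌉ × ⌈ l /2⌉ + ⌈ l /2⌉ ≤ suc l
  half-cover zero          = ℕ.z≤n , ℕ.z≤n
  half-cover (suc zero)    = ℕ.s≤s ℕ.z≤n , ℕP.≤-refl
  half-cover (suc (suc l)) with half-cover l
  ... | p , q = subst (λ s → suc (suc l) ≤ s × s ≤ suc (suc (suc l))) (cong suc (sym (ℕP.+-suc ⌈ l /2⌉ ⌈ l /2⌉)))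
        (ℕ.s≤s (ℕ.s≤s p) , ℕ.s≤s (ℕ.s≤s q))

  -- Resampling bounds for functions with values in Z_l.

  module _ {D l : ℕ} (h : Cube D → Fin l) where

    influence : Fin D → ℕ
    influence j = ∑ᴺ (λ x → cdist l (h x) (h (flip j x)))

    dependence : Cube D → ℕ
    dependence J = ∑ᴺ (λ x → ∑ᴺ (λ y → cdist l (h x) (h (mix J x y))))

    private
      r = ⌈ l /2⌉

      H : Fin r → Cube D → Bool
      H t x = code r (toℕ t) (toℕ (h x))

      distortion : (a b : Fin l) → cdist l a b ≤ codeDist r (toℕ a) (toℕ b) × codeDist r (toℕ a) (toℕ b) ≤ 2 * cdist l a b
      distortion = code-distortion r (proj₁ (half-cover l)) (proj₂ (half-cover l))

      sum-infl : ∀ j → sumFin r (λ t → infl (H t) j) ≤ 2 * influence j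
      sum-infl j = begin
        sumFin r (λ t → infl (H t) j)
          ≡⟨ ∑ᴺ-sumFin r (λ x t → ham (H t x) (H t (flip j x))) ⟨
        ∑ᴺ (λ x → codeDist r (toℕ (h x)) (toℕ (h (flip j x))))
          ≤⟨ ∑ᴺ-≤ (λ x → proj₂ (distortion (h x) (h (flip j x)))) ⟩
        ∑ᴺ (λ x → 2 * cdist l (h x) (h (flip j x)))
          ≡⟨ ∑ᴺ-* 2 (λ x → cdist l (h x) (h (flip j x))) ⟩
        2 * influence j ∎
        where open ℕP.≤-Reasoning

      dependence-≤ : ∀ J → dependence J ≤ sumFin r (λ t → dep J (H t))
      dependence-≤ J = begin
        dependence J
          ≤⟨ ∑ᴺ-≤ (λ x → ∑ᴺ-≤ (λ y → proj₁ (distortion (h x) (h (mix J x y))))) ⟩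
        ∑ᴺ (λ x → ∑ᴺ (λ y → codeDist r (toℕ (h x)) (toℕ (h (mix J x y)))))
          ≡⟨ ∑ᴺ-cong (λ x → ∑ᴺ-sumFin r (λ y t → ham (H t x) (H t (mix J x y)))) ⟩
        ∑ᴺ (λ x → sumFin r (λ t → ∑ᴺ (λ y → ham (H t x) (H t (mix J x y)))))
          ≡⟨ ∑ᴺ-sumFin r (λ x t → ∑ᴺ (λ y → ham (H t x) (H t (mix J x y)))) ⟩
        sumFin r (λ t → dep J (H t)) ∎
        where open ℕP.≤-Reasoning

    -- Each code bit has influence at most twice that of `h`, so the single set `J` satisfies the
    -- hypothesis of `junta-bound` for every bit. Summed over all bits, the influences again amount
    -- to at most twice those of `h`: the distortion is lost once in total, not once per bit.
    dependence-bound : ∀ d (J : Cube D) →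
      (∀ j → lookup J j ≡ false → 2 * influence j * (9 ^ d * (suc d * suc d)) ≤ 2 ^ D) →
      suc d * dependence J ≤ 2 ^ D * (2 * sumFin D influence)
    dependence-bound d J small = begin
      suc d * dependence J
        ≤⟨ ℕP.*-monoʳ-≤ (suc d) (dependence-≤ J) ⟩
      suc d * sumFin r (λ t → dep J (H t))
        ≡⟨ sumFin-* r (suc d) (λ t → dep J (H t)) ⟨
      sumFin r (λ t → suc d * dep J (H t))
        ≤⟨ sumFin-mono r (λ t → junta-bound (H t) d J (λ j j∉J → ℕP.≤-trans (ℕP.*-monoˡ-≤ K (infl-≤ t j)) (small j j∉J))) ⟩
      sumFin r (λ t → 2 ^ D * sumFin D (infl (H t)))
        ≡⟨ sumFin-* r (2 ^ D) (λ t → sumFin D (infl (H t))) ⟩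
      2 ^ D * sumFin r (λ t → sumFin D (infl (H t)))
        ≡⟨ cong (2 ^ D *_) (sumFin-swap r D (λ t j → infl (H t) j)) ⟩
      2 ^ D * sumFin D (λ j → sumFin r (λ t → infl (H t) j))
        ≤⟨ ℕP.*-monoʳ-≤ (2 ^ D) (sumFin-mono D sum-infl) ⟩
      2 ^ D * sumFin D (λ j → 2 * influence j)
        ≡⟨ cong (2 ^ D *_) (sumFin-* D 2 influence) ⟩
      2 ^ D * (2 * sumFin D influence) ∎
      where
      open ℕP.≤-Reasoning
      K = 9 ^ d * (suc d * suc d)
      infl-≤ : ∀ t j → infl (H t) j ≤ 2 * influence j
      infl-≤ t j = ℕP.≤-trans (sumFin-term r (λ t → infl (H t) j) t) (sum-infl j)

  -- Encoding Z_k by bit strings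

  -- The last block has no upper end.
  block : ∀ k → ℕ → ℕ → Fin (suc k)
  block zero    q u = zero
  block (suc k) q u = if u <ᵇ q then zero else suc (block k q (u ∸ q))

  block-mono : ∀ k q {u v} → u ≤ v → toℕ (block k q u) ≤ toℕ (block k q v)
  block-mono zero    q u≤v = ℕ.z≤n
  block-mono (suc k) q {u} {v} u≤v with u <ᵇ q in u<q | v <ᵇ q in v<q
  ... | true  | _     = ℕ.z≤n
  ... | false | false = ℕ.s≤s (block-mono k q (ℕP.∸-monoˡ-≤ q u≤v))
  ... | false | true  = contradiction
        (trans (sym u<q) (<ᵇ-true (ℕP.≤-<-trans u≤v (ℕP.<ᵇ⇒< v q (subst Bool.T (sym v<q) _))))) λ ()

  block-fibres : ∀ k q N (g : Fin (suc k) → ℕ) → suc k * q ≤ N →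
    q * sumFin (suc k) g ≤ sumFin N (λ i → g (block k q (toℕ i)))
  block-fibres zero q N g le = begin
    q * (g zero + 0)             ≡⟨ cong (q *_) (ℕP.+-identityʳ (g zero)) ⟩
    q * g zero                   ≤⟨ ℕP.*-monoˡ-≤ (g zero) (ℕP.≤-trans (ℕP.≤-reflexive (sym (ℕP.+-identityʳ q))) le) ⟩
    N * g zero                   ≡⟨ sumFin-const N (g zero) ⟨
    sumFin N (λ _ → g zero)      ∎
    where open ℕP.≤-Reasoning
  block-fibres (suc k) q N g le = begin
    q * sumFin (suc (suc k)) g
      ≡⟨ trans (cong (q *_) (sumFin-suc (suc k) g)) (ℕP.*-distribˡ-+ q (g zero) (sumFin (suc k) (g ∘ suc))) ⟩
    q * g zero + q * sumFin (suc k) (g ∘ suc)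
      ≤⟨ ℕP.+-mono-≤ (ℕP.≤-reflexive (sym (trans (sumFin-cong q first) (sumFin-const q (g zero)))))
          (ℕP.≤-trans (block-fibres k q M (g ∘ suc) rest≤) (ℕP.≤-reflexive (sumFin-cong M (sym ∘ later)))) ⟩
    sumFin q (λ i → G (i ↑ˡ M)) + sumFin M (λ i → G (q ↑ʳ i))
      ≡⟨ sumFin-↑ q M G ⟨
    sumFin (q + M) G
      ≡⟨ cong (λ n → sumFin n (λ i → g (block (suc k) q (toℕ i)))) N≡ ⟩
    sumFin N (λ i → g (block (suc k) q (toℕ i))) ∎
    where
    open ℕP.≤-Reasoning
    M = N ∸ q
    G : Fin (q + M) → ℕ
    G i = g (block (suc k) q (toℕ i))
    N≡ : q + M ≡ N
    N≡ = ℕP.m+[n∸m]≡n (ℕP.≤-trans (ℕP.m≤m+n q (suc k * q)) le)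
    rest≤ : suc k * q ≤ M
    rest≤ = ℕP.m+n≤o⇒m≤o∸n (suc k * q) (ℕP.≤-trans (ℕP.≤-reflexive (ℕP.+-comm (suc k * q) q)) le)
    first : ∀ i → G (i ↑ˡ M) ≡ g zero
    first i rewrite FinP.toℕ-↑ˡ i M | <ᵇ-true (FinP.toℕ<n i) = refl
    later : ∀ i → G (q ↑ʳ i) ≡ g (suc (block k q (toℕ i)))
    later i rewrite FinP.toℕ-↑ʳ q i | <ᵇ-false (ℕP.m≤m+n q (toℕ i)) | ℕP.m+n∸m≡n q (toℕ i) = refl

  value : ∀ {R} → Cube R → ℕ
  value []                = 0
  value {suc R} (b ∷ u)   = (if b then 2 ^ R else 0) + value u

  value-bound : ∀ {R} (u : Cube R) → value u < 2 ^ R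
  value-bound []          = ℕ.s≤s ℕ.z≤n
  value-bound {suc R} (true  ∷ u) = ℕP.+-monoʳ-< (2 ^ R) (ℕP.<-≤-trans (value-bound u) (ℕP.m≤m+n (2 ^ R) 0))
  value-bound {suc R} (false ∷ u) = ℕP.<-≤-trans (value-bound u) (ℕP.m≤m+n (2 ^ R) _)

  ∑ᴺ-value : ∀ R (g : ℕ → ℕ) → ∑ᴺ {R} (λ u → g (value u)) ≡ sumFin (2 ^ R) (λ i → g (toℕ i))
  ∑ᴺ-value zero    g = sym (ℕP.+-identityʳ (g 0))
  ∑ᴺ-value (suc R) g = begin
    ∑ᴺ {R} (λ u → g (value u)) + ∑ᴺ {R} (λ u → g (N + value u))
      ≡⟨ cong₂ _+_ (∑ᴺ-value R g) (∑ᴺ-value R (λ v → g (N + v))) ⟩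
    sumFin N (λ i → g (toℕ i)) + sumFin N (λ i → g (N + toℕ i))
      ≡⟨ cong₂ _+_ (sumFin-cong N (λ i → cong g (sym (FinP.toℕ-↑ˡ i N)))) (sumFin-cong N (λ i → cong g (sym (FinP.toℕ-↑ʳ N i)))) ⟩
    sumFin N (λ i → g (toℕ (i ↑ˡ N))) + sumFin N (λ i → g (toℕ (N ↑ʳ i)))
      ≡⟨ sumFin-↑ N N (λ i → g (toℕ i)) ⟨
    sumFin (N + N) (λ i → g (toℕ i))
      ≡⟨ cong (λ s → sumFin (N + s) (λ i → g (toℕ i))) (sym (ℕP.+-identityʳ N)) ⟩
    sumFin (2 ^ suc R) (λ i → g (toℕ i)) ∎
    where
    open ≡-Reasoning
    N = 2 ^ R

  -- The bound reproduces itself: the top bit contributes at most 2 · 2^R times the total increase of H, and the lower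
  -- bits contribute the same, since the increases over the two halves add up.
  module _ (H : ℕ → ℕ) (mono : ∀ {u v} → u ≤ v → H u ≤ H v) where

    spread : ∀ {a u v b} → a ≤ u → u ≤ b → a ≤ v → v ≤ b → ∣ H u - H v ∣ ≤ H b ∸ H a
    spread {a} {u} {v} {b} a≤u u≤b a≤v v≤b with ℕP.≤-total (H u) (H v)
    ... | inj₁ le rewrite ℕP.m≤n⇒∣m-n∣≡n∸m le = ℕP.∸-mono (mono v≤b) (mono a≤u)
    ... | inj₂ le rewrite ℕP.m≤n⇒∣n-m∣≡n∸m le = ℕP.∸-mono (mono u≤b) (mono a≤v)

    edges : ∀ R → ℕ → ℕ
    edges R a = ∑ᴺ {R} (λ u → sumFin R (λ r → ∣ H (a + value u) - H (a + value (flip r u)) ∣))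

    edges-bound : ∀ R a → edges R a ≤ 2 * 2 ^ R * (H (a + 2 ^ R) ∸ H a)
    edges-bound zero    a = ℕ.z≤n
    edges-bound (suc R) a = begin
      edges (suc R) a
        ≡⟨ cong₂ _+_ (∑ᴺ-cong λ u → sumFin-suc R (λ r → ∣ H (a + value (false ∷ u)) - H (a + value (flip r (false ∷ u))) ∣))
                     (∑ᴺ-cong λ u → sumFin-suc R (λ r → ∣ H (a + value (true ∷ u)) - H (a + value (flip r (true ∷ u))) ∣)) ⟩
      ∑ᴺ (λ u → top₀ u + low₀ u) + ∑ᴺ (λ u → top₁ u + low₁ u)
        ≤⟨ ℕP.+-mono-≤ (∑ᴺ-≤ λ u → ℕP.+-monoˡ-≤ (low₀ u) (top≤ (lo u) (hi u)))
                       (∑ᴺ-≤ λ u → ℕP.+-mono-≤ (top≤ (hi u) (lo u)) (ℕP.≤-reflexive (shift u))) ⟩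
      ∑ᴺ (λ u → V + low₀ u) + ∑ᴺ (λ u → V + low₁′ u)
        ≡⟨ cong₂ _+_ (trans (∑ᴺ-+ (λ _ → V) low₀) (cong (_+ edges R a) (∑ᴺ-const {R} V)))
                     (trans (∑ᴺ-+ (λ _ → V) low₁′) (cong (_+ edges R (a + N)) (∑ᴺ-const {R} V))) ⟩
      (N * V + edges R a) + (N * V + edges R (a + N))
        ≤⟨ ℕP.+-mono-≤ (ℕP.+-monoʳ-≤ (N * V) (edges-bound R a)) (ℕP.+-monoʳ-≤ (N * V) (edges-bound R (a + N))) ⟩
      (N * V + 2 * N * (H (a + N) ∸ H a)) + (N * V + 2 * N * (H (a + N + N) ∸ H (a + N)))
        ≡⟨ ring₁ N V (H (a + N) ∸ H a) (H (a + N + N) ∸ H (a + N)) ⟩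
      2 * N * V + 2 * N * ((H (a + N) ∸ H a) + (H (a + N + N) ∸ H (a + N)))
        ≡⟨ cong (λ s → 2 * N * V + 2 * N * s) telescope ⟩
      2 * N * V + 2 * N * V
        ≡⟨ ring₂ N V ⟩
      2 * 2 ^ suc R * V ∎
      where
      open ℕP.≤-Reasoning
      N = 2 ^ R
      V = H (a + 2 ^ suc R) ∸ H a
      top₀ top₁ low₀ low₁ low₁′ : Cube R → ℕ
      top₀ u = ∣ H (a + value u) - H (a + (N + value u)) ∣
      top₁ u = ∣ H (a + (N + value u)) - H (a + value u) ∣
      low₀ u = sumFin R (λ r → ∣ H (a + value u) - H (a + value (flip r u)) ∣)
      low₁ u = sumFin R (λ r → ∣ H (a + (N + value u)) - H (a + (N + value (flip r u))) ∣)
      low₁′ u = sumFin R (λ r → ∣ H (a + N + value u) - H (a + N + value (flip r u)) ∣)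
      shift : ∀ u → low₁ u ≡ low₁′ u
      shift u = sumFin-cong R λ r → sym (cong₂ (λ s t → ∣ H s - H t ∣) (ℕP.+-assoc a N (value u)) (ℕP.+-assoc a N (value (flip r u))))
      Between : ℕ → Set
      Between v = a ≤ v × v ≤ a + 2 ^ suc R
      top≤ : ∀ {u v} → Between u → Between v → ∣ H u - H v ∣ ≤ V
      top≤ (p , q) (s , t) = spread p q s t
      lo : ∀ u → Between (a + value {R} u)
      lo u = ℕP.m≤m+n a (value u) , ℕP.+-monoʳ-≤ a (ℕP.≤-trans (ℕP.<⇒≤ (value-bound u)) (ℕP.m≤m+n N _))
      hi : ∀ u → Between (a + (N + value {R} u))
      hi u = ℕP.m≤m+n a (N + value u) , ℕP.+-monoʳ-≤ a (ℕP.<⇒≤ (value-bound (true ∷ u)))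
      double : a + N + N ≡ a + 2 ^ suc R
      double = trans (ℕP.+-assoc a N N) (cong (λ s → a + (N + s)) (sym (ℕP.+-identityʳ N)))
      +∸ : ∀ {a b c} → a ≤ b → b ≤ c → (b ∸ a) + (c ∸ b) ≡ c ∸ a
      +∸ {a} {b} {c} a≤b b≤c = trans (ℕP.+-comm (b ∸ a) (c ∸ b)) (trans (sym (ℕP.+-∸-assoc (c ∸ b) a≤b)) (cong (_∸ a) (ℕP.m∸n+n≡m b≤c)))
      telescope : (H (a + N) ∸ H a) + (H (a + N + N) ∸ H (a + N)) ≡ V
      telescope = trans (+∸ (mono (ℕP.m≤m+n a N)) (mono (ℕP.m≤m+n (a + N) N))) (cong (λ s → H s ∸ H a) double)
      ring₁ : ∀ n v x y → (n * v + 2 * n * x) + (n * v + 2 * n * y) ≡ 2 * n * v + 2 * n * (x + y)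
      ring₁ = ℕ-ring
      ring₂ : ∀ n v → 2 * n * v + 2 * n * v ≡ 2 * (2 * n) * v
      ring₂ = ℕ-ring

  -- Concatenated bit strings and sums over Z_k^n.

  ∑ᴺ-++ : ∀ m {n} (f : Cube (m + n) → ℕ) → ∑ᴺ f ≡ ∑ᴺ (λ (x : Cube m) → ∑ᴺ (λ (y : Cube n) → f (x ++ y)))
  ∑ᴺ-++ zero    f = refl
  ∑ᴺ-++ (suc m) f = cong₂ _+_ (∑ᴺ-++ m (f ⁰)) (∑ᴺ-++ m (f ¹))

  flip-↑ˡ : ∀ {m n} (r : Fin m) (x : Cube m) (y : Cube n) → flip (r ↑ˡ n) (x ++ y) ≡ flip r x ++ y
  flip-↑ˡ zero    (b ∷ x) y = refl
  flip-↑ˡ (suc r) (b ∷ x) y = cong (b ∷_) (flip-↑ˡ r x y)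

  flip-↑ʳ : ∀ {m n} (j : Fin n) (x : Cube m) (y : Cube n) → flip (m ↑ʳ j) (x ++ y) ≡ x ++ flip j y
  flip-↑ʳ j []      y = refl
  flip-↑ʳ j (b ∷ x) y = cong (b ∷_) (flip-↑ʳ j x y)

  mix-++ : ∀ {m n} {A : Set} (J : Cube m) (K : Cube n) (x x′ : Vec A m) (y y′ : Vec A n) →
    mix (J ++ K) (x ++ y) (x′ ++ y′) ≡ mix J x x′ ++ mix K y y′
  mix-++ []      K []      []        y y′ = refl
  mix-++ (j ∷ J) K (x ∷ xs) (x′ ∷ xs′) y y′ = cong ((if j then x else x′) ∷_) (mix-++ J K xs xs′ y y′)

  mix-replicate : ∀ {n} {A : Set} b (x y : Vec A n) → mix (replicate n b) x y ≡ (if b then x else y)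
  mix-replicate true  []      []      = refl
  mix-replicate false []      []      = refl
  mix-replicate true  (x ∷ xs) (y ∷ ys) = cong (x ∷_) (mix-replicate true xs ys)
  mix-replicate false (x ∷ xs) (y ∷ ys) = cong (y ∷_) (mix-replicate false xs ys)

  sumFin-combine : ∀ n R (g : Fin (n * R) → ℕ) → sumFin (n * R) g ≡ sumFin n (λ i → sumFin R (λ r → g (combine i r)))
  sumFin-combine zero    R g = refl
  sumFin-combine (suc n) R g = trans (sumFin-↑ R (n * R) g)
    (trans (cong (sumFin R (λ r → g (r ↑ˡ (n * R))) +_) (sumFin-combine n R (λ j → g (R ↑ʳ j))))
      (sym (sumFin-suc n (λ i → sumFin R (λ r → g (combine i r))))))

  take-++ : ∀ {m n} {A : Set} (x : Vec A m) (y : Vec A n) → take m (x ++ y) ≡ x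
  take-++ []      y = refl
  take-++ (a ∷ x) y = cong (a ∷_) (take-++ x y)

  drop-++ : ∀ {m n} {A : Set} (x : Vec A m) (y : Vec A n) → drop m (x ++ y) ≡ y
  drop-++ []      y = refl
  drop-++ (a ∷ x) y = drop-++ x y

  sumVec : ∀ {k} n → (Vec (Fin k) n → ℕ) → ℕ
  sumVec {k} zero    h = h []
  sumVec {k} (suc n) h = sumFin k (λ a → sumVec n (λ x → h (a ∷ x)))

  sumVec-mono : ∀ {k} n {g h : Vec (Fin k) n → ℕ} → (∀ x → g x ≤ h x) → sumVec n g ≤ sumVec n h
  sumVec-mono     zero    le = le []
  sumVec-mono {k} (suc n) le = sumFin-mono k λ a → sumVec-mono n λ x → le (a ∷ x)

  sumVec-* : ∀ {k} n c (h : Vec (Fin k) n → ℕ) → sumVec n (λ x → c * h x) ≡ c * sumVec n h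
  sumVec-*     zero    c h = refl
  sumVec-* {k} (suc n) c h = trans (sumFin-cong k λ a → sumVec-* n c (λ x → h (a ∷ x))) (sumFin-* k c (λ a → sumVec n (λ x → h (a ∷ x))))

  distance : ∀ {k n} → Vec (Fin k) n → Vec (Fin k) n → ℕ
  distance         []      []      = 0
  distance {k} (a ∷ x) (b ∷ y) = cdist k a b + distance x y

  cdist-refl : ∀ {q} (a : Fin q) → cdist q a a ≡ 0
  cdist-refl {q} a = cong (λ s → s ⊓ (q ∸ s)) (ℕP.∣n-n∣≡0 (toℕ a))

  distance-refl : ∀ {k n} (x : Vec (Fin k) n) → distance x x ≡ 0
  distance-refl []      = refl
  distance-refl (a ∷ x) = cong₂ _+_ (cdist-refl a) (distance-refl x)

  module Encoding (k′ R q : ℕ) (fits : suc k′ * q ≤ 2 ^ R) where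

    private
      k = suc k′

    symbol : Cube R → Fin k
    symbol u = block k′ q (value u)

    encode : ∀ n → Cube (n * R) → Vec (Fin k) n
    encode zero    w = []
    encode (suc n) w = symbol (take R w) ∷ encode n (drop R w)

    encode-++ : ∀ {n} (u : Cube R) (w : Cube (n * R)) → encode (suc n) (u ++ w) ≡ symbol u ∷ encode n w
    encode-++ {n} u w = cong₂ (λ u w → symbol u ∷ encode n w) (take-++ u w) (drop-++ u w)

    expand : ∀ {n} → Cube n → Cube (n * R)
    expand J = concat (Vec.map (replicate R) J)

    lookup-expand : ∀ {n} (J : Cube n) i r → lookup (expand J) (combine i r) ≡ lookup J i
    lookup-expand J i r = trans (lookup-concat (Vec.map (replicate R) J) i r)
      (trans (cong (λ v → lookup v r) (lookup-map i (replicate R) J)) (lookup-replicate r (lookup J i)))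

    -- `expand` keeps or resamples the R bits of a coordinate as one group, so no symbol is ever
    -- assembled from bits of two different strings.
    encode-mix : ∀ n (J : Cube n) (w v : Cube (n * R)) →
      encode n (mix (expand J) w v) ≡ mix J (encode n w) (encode n v)
    encode-mix zero    []      w v = refl
    encode-mix (suc n) (j ∷ J) w v = subst₂ P (take++drop≡id R w) (take++drop≡id R v)
      (appended (take R w) (drop R w) (take R v) (drop R v))
      where
      open ≡-Reasoning
      P : Cube (R + n * R) → Cube (R + n * R) → Set
      P w v = encode (suc n) (mix (expand (j ∷ J)) w v) ≡ mix (j ∷ J) (encode (suc n) w) (encode (suc n) v)
      symbol-if : ∀ j u u′ → symbol (if j then u else u′) ≡ (if j then symbol u else symbol u′)
      symbol-if true  u u′ = refl
      symbol-if false u u′ = refl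
      appended : ∀ u w u′ v → P (u ++ w) (u′ ++ v)
      appended u w u′ v = begin
        encode (suc n) (mix (replicate R j ++ expand J) (u ++ w) (u′ ++ v))
          ≡⟨ cong (encode (suc n)) (mix-++ (replicate R j) (expand J) u u′ w v) ⟩
        encode (suc n) (mix (replicate R j) u u′ ++ mix (expand J) w v)
          ≡⟨ encode-++ (mix (replicate R j) u u′) (mix (expand J) w v) ⟩
        symbol (mix (replicate R j) u u′) ∷ encode n (mix (expand J) w v)
          ≡⟨ cong₂ _∷_ (trans (cong symbol (mix-replicate j u u′)) (symbol-if j u u′)) (encode-mix n J w v) ⟩
        (if j then symbol u else symbol u′) ∷ mix J (encode n w) (encode n v)
          ≡⟨ cong₂ (mix (j ∷ J)) (encode-++ u w) (encode-++ u′ v) ⟨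
        mix (j ∷ J) (encode (suc n) (u ++ w)) (encode (suc n) (u′ ++ v)) ∎

    -- Every point has at least q^n codewords. As `G` is non-negative, such a lower bound on the
    -- fibres suffices to transfer upper bounds from strings to points.
    pushforward : ∀ n (G : Vec (Fin k) n → ℕ) → q ^ n * sumVec n G ≤ ∑ᴺ (λ w → G (encode n w))
    pushforward zero    G = ℕP.≤-reflexive (ℕP.*-identityˡ (G []))
    pushforward (suc n) G = begin
      q * q ^ n * sumFin k (λ a → sumVec n (λ x → G (a ∷ x)))
        ≡⟨ trans (ℕP.*-assoc q (q ^ n) (sumFin k (λ a → sumVec n (λ x → G (a ∷ x))))) (cong (q *_) (sym (sumFin-* k (q ^ n) (λ a → sumVec n (λ x → G (a ∷ x)))))) ⟩
      q * sumFin k (λ a → q ^ n * sumVec n (λ x → G (a ∷ x)))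
        ≤⟨ ℕP.*-monoʳ-≤ q (sumFin-mono k λ a → pushforward n (λ x → G (a ∷ x))) ⟩
      q * sumFin k g
        ≤⟨ block-fibres k′ q (2 ^ R) g fits ⟩
      sumFin (2 ^ R) (λ i → g (block k′ q (toℕ i)))
        ≡⟨ ∑ᴺ-value R (λ v → g (block k′ q v)) ⟨
      ∑ᴺ (λ u → ∑ᴺ (λ w → G (symbol u ∷ encode n w)))
        ≡⟨ ∑ᴺ-cong (λ u → ∑ᴺ-cong (λ w → cong G (sym (encode-++ u w)))) ⟩
      ∑ᴺ {R} (λ u → ∑ᴺ (λ w → G (encode (suc n) (u ++ w))))
        ≡⟨ ∑ᴺ-++ R (λ w → G (encode (suc n) w)) ⟨
      ∑ᴺ (λ w → G (encode (suc n) w)) ∎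
      where
      open ℕP.≤-Reasoning
      g : Fin k → ℕ
      g a = ∑ᴺ (λ w → G (a ∷ encode n w))

    -- The cyclic distance is relaxed to the difference of block indices, which are monotone in the
    -- value with total increase below k. The mean over `u` is at most 2k independently of `R`,
    -- which is what leaves `R` free to be large.
    symbol-edges : ∑ᴺ (λ u → sumFin R (λ r → cdist k (symbol u) (symbol (flip r u)))) ≤ 2 * 2 ^ R * k
    symbol-edges = begin
      ∑ᴺ (λ u → sumFin R (λ r → cdist k (symbol u) (symbol (flip r u))))
        ≤⟨ ∑ᴺ-≤ {R} (λ u → sumFin-mono R (λ r → ℕP.m⊓n≤m ∣ H (value u) - H (value (flip r u)) ∣ _)) ⟩
      edges H mono R 0
        ≤⟨ edges-bound H mono R 0 ⟩
      2 * 2 ^ R * (H (2 ^ R) ∸ H 0)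
        ≤⟨ ℕP.*-monoʳ-≤ (2 * 2 ^ R) (ℕP.≤-trans (ℕP.m∸n≤m (H (2 ^ R)) (H 0)) (ℕP.<⇒≤ (FinP.toℕ<n (block k′ q (2 ^ R))))) ⟩
      2 * 2 ^ R * k ∎
      where
      open ℕP.≤-Reasoning
      H : ℕ → ℕ
      H v = toℕ (block k′ q v)
      mono : ∀ {u v} → u ≤ v → H u ≤ H v
      mono = block-mono k′ q

    encode-edges : ∀ n → ∑ᴺ (λ w → sumFin (n * R) (λ j → distance (encode n w) (encode n (flip j w)))) ≤
      n * (2 * 2 ^ (n * R) * k)
    encode-edges zero    = ℕ.z≤n
    encode-edges (suc n) = begin
      ∑ᴺ (λ w → sumFin (R + n * R) (λ j → E w (flip j w)))
        ≡⟨ trans (∑ᴺ-++ R (λ w → sumFin (R + n * R) (λ j → E w (flip j w)))) (∑ᴺ-cong λ u → ∑ᴺ-cong λ w → split u w) ⟩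
      ∑ᴺ (λ u → ∑ᴺ {n * R} (λ w → first u + rest w))
        ≡⟨ ∑ᴺ-cong (λ u → trans (∑ᴺ-+ (λ w → first u) rest) (cong (_+ ∑ᴺ rest) (∑ᴺ-const {n * R} (first u)))) ⟩
      ∑ᴺ (λ u → 2 ^ (n * R) * first u + ∑ᴺ rest)
        ≡⟨ trans (∑ᴺ-+ (λ u → 2 ^ (n * R) * first u) (λ _ → ∑ᴺ rest))
             (cong₂ _+_ (∑ᴺ-* (2 ^ (n * R)) first) (∑ᴺ-const {R} (∑ᴺ rest))) ⟩
      2 ^ (n * R) * ∑ᴺ first + 2 ^ R * ∑ᴺ rest
        ≤⟨ ℕP.+-mono-≤ (ℕP.*-monoʳ-≤ (2 ^ (n * R)) symbol-edges) (ℕP.*-monoʳ-≤ (2 ^ R) (encode-edges n)) ⟩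
      2 ^ (n * R) * (2 * 2 ^ R * k) + 2 ^ R * (n * (2 * 2 ^ (n * R) * k))
        ≡⟨ ring₁ (2 ^ (n * R)) (2 ^ R) k n ⟩
      suc n * (2 * (2 ^ R * 2 ^ (n * R)) * k)
        ≡⟨ cong (λ s → suc n * (2 * s * k)) (ℕP.^-distribˡ-+-* 2 R (n * R)) ⟨
      suc n * (2 * 2 ^ (R + n * R) * k) ∎
      where
      open ℕP.≤-Reasoning
      E : Cube (R + n * R) → Cube (R + n * R) → ℕ
      E w w′ = distance (encode (suc n) w) (encode (suc n) w′)
      first : Cube R → ℕ
      first u = sumFin R (λ r → cdist k (symbol u) (symbol (flip r u)))
      rest : Cube (n * R) → ℕ
      rest w = sumFin (n * R) (λ j → distance (encode n w) (encode n (flip j w)))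
      E-++ : ∀ u w u′ w′ → E (u ++ w) (u′ ++ w′) ≡ cdist k (symbol u) (symbol u′) + distance (encode n w) (encode n w′)
      E-++ u w u′ w′ = cong₂ distance (encode-++ {n} u w) (encode-++ {n} u′ w′)
      split : ∀ u w → sumFin (R + n * R) (λ j → E (u ++ w) (flip j (u ++ w))) ≡ first u + rest w
      split u w = trans (sumFin-↑ R (n * R) (λ j → E (u ++ w) (flip j (u ++ w))))
        (cong₂ _+_
          (sumFin-cong R λ r → trans (cong (E (u ++ w)) (flip-↑ˡ r u w))
            (trans (E-++ u w (flip r u) w) (trans (cong (cdist k (symbol u) (symbol (flip r u)) +_) (distance-refl (encode n w))) (ℕP.+-identityʳ _))))
          (sumFin-cong (n * R) λ j → trans (cong (E (u ++ w)) (flip-↑ʳ j u w))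
            (trans (E-++ u w u (flip j w)) (cong (_+ distance (encode n w) (encode n (flip j w))) (cdist-refl (symbol u))))))
      ring₁ : ∀ t s k n → t * (2 * s * k) + s * (n * (2 * t * k)) ≡ suc n * (2 * (s * t) * k)
      ring₁ = ℕ-ring

  -- Counting by thresholds, and the choice of the string length.

  count-bound : ∀ {n} (b : Fin n → Bool) (T : ℕ) (s : Fin n → ℕ) → (∀ i → b i ≡ true → T ≤ s i) →
    ∣ tabulate b ∣ * T ≤ sumFin n s
  count-bound {zero}  b T s le = ℕ.z≤n
  count-bound {suc n} b T s le = ℕP.≤-trans (step (b zero) refl) (ℕP.≤-reflexive (sym (sumFin-suc n s)))
    where
    step : ∀ c → b zero ≡ c → ∣ c ∷ tabulate (b ∘ suc) ∣ * T ≤ s zero + sumFin n (s ∘ suc)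
    step true  e = ℕP.+-mono-≤ (le zero e) (count-bound (b ∘ suc) T (s ∘ suc) (λ i → le (suc i)))
    step false e = ℕP.≤-trans (count-bound (b ∘ suc) T (s ∘ suc) (λ i → le (suc i))) (ℕP.m≤n+m _ (s zero))

  -- Bernoulli's inequality (1 - 1/(q+1))^j ≥ 1 - j/(q+1) with denominators cleared; `c` stands for
  -- q + 1 - j, so that no truncated subtraction occurs.
  bernoulli : ∀ q j c → c + j ≡ suc q → suc q ^ j * c ≤ q ^ j * suc q
  bernoulli q zero    c e = ℕP.≤-reflexive (cong (1 *_) (trans (sym (ℕP.+-identityʳ c)) e))
  bernoulli q (suc j) c e = begin
    suc q * suc q ^ j * c        ≡⟨ ring₁ (suc q) (suc q ^ j) c ⟩
    suc q ^ j * (c + q * c)      ≤⟨ ℕP.*-monoʳ-≤ (suc q ^ j) (ℕP.+-monoˡ-≤ (q * c) c≤q) ⟩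
    suc q ^ j * (q + q * c)      ≡⟨ ring₂ (suc q ^ j) q c ⟩
    q * (suc q ^ j * suc c)      ≤⟨ ℕP.*-monoʳ-≤ q (bernoulli q j (suc c) (trans (sym (ℕP.+-suc c j)) e)) ⟩
    q * (q ^ j * suc q)          ≡⟨ ℕP.*-assoc q (q ^ j) (suc q) ⟨
    q * q ^ j * suc q            ∎
    where
    open ℕP.≤-Reasoning
    c≤q : c ≤ q
    c≤q = ℕP.≤-pred (ℕP.≤-trans (ℕP.≤-trans (ℕP.≤-reflexive (ℕP.+-comm 1 c)) (ℕP.+-monoʳ-≤ c (ℕ.s≤s (ℕ.z≤n {j})))) (ℕP.≤-reflexive e))
    ring₁ : ∀ s t c → s * t * c ≡ t * (s * c)
    ring₁ = ℕ-ring
    ring₂ : ∀ t q c → t * (q + q * c) ≡ q * (t * suc c)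
    ring₂ = ℕ-ring

  -- With j = 2n this bounds the loss, on pairs of points, from rounding 2^R / k down to the block
  -- length q.
  suc-^-≤ : ∀ q j → j + j ≤ q → suc q ^ j ≤ 2 * q ^ j
  suc-^-≤ q j 2j≤q = ℕP.*-cancelʳ-≤ (suc q ^ j) (2 * q ^ j) (suc q) (begin
    suc q ^ j * suc q        ≤⟨ ℕP.*-monoʳ-≤ (suc q ^ j) 1+q≤2c ⟩
    suc q ^ j * (2 * c)      ≡⟨ ring₁ (suc q ^ j) c ⟩
    2 * (suc q ^ j * c)      ≤⟨ ℕP.*-monoʳ-≤ 2 (bernoulli q j c c+j) ⟩
    2 * (q ^ j * suc q)      ≡⟨ ℕP.*-assoc 2 (q ^ j) (suc q) ⟨
    2 * q ^ j * suc q        ∎)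
    where
    open ℕP.≤-Reasoning
    c = suc q ∸ j
    c+j : c + j ≡ suc q
    c+j = ℕP.m∸n+n≡m (ℕP.≤-trans (ℕP.≤-trans (ℕP.m≤m+n j j) 2j≤q) (ℕP.n≤1+n q))
    ring₁ : ∀ s c → s * (2 * c) ≡ 2 * (s * c)
    ring₁ = ℕ-ring
    ring₂ : ∀ c j → c + c + (j + j) ≡ (c + j) + (c + j)
    ring₂ = ℕ-ring
    1+q≤2c : suc q ≤ 2 * c
    1+q≤2c = ℕP.+-cancelʳ-≤ (j + j) (suc q) (2 * c) (begin
      suc q + (j + j)        ≤⟨ ℕP.+-monoʳ-≤ (suc q) (ℕP.≤-trans 2j≤q (ℕP.n≤1+n q)) ⟩
      suc q + suc q          ≡⟨ cong₂ _+_ c+j c+j ⟨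
      (c + j) + (c + j)      ≡⟨ ring₂ c j ⟨
      c + c + (j + j)        ≡⟨ cong (λ s → c + s + (j + j)) (ℕP.+-identityʳ c) ⟨
      2 * c + (j + j)        ∎)

  n<2^n : ∀ n → n < 2 ^ n
  n<2^n zero    = ℕ.s≤s ℕ.z≤n
  n<2^n (suc n) = ℕP.≤-trans (ℕP.+-mono-≤ (ℕP.m^n>0 2 n) (n<2^n n)) (ℕP.≤-reflexive (cong (2 ^ n +_) (sym (ℕP.+-identityʳ (2 ^ n)))))

  -- A string length for which the block encoding is uniform up to a factor 2 on pairs of points.
  resolution : ∀ k′ n → let k = suc k′ in
    Σ ℕ λ R → Σ ℕ λ q → (k * q ≤ 2 ^ R) × (0 < q ^ n) × (2 ^ (n * R) * 2 ^ (n * R) ≤ 2 * ((k ^ n * q ^ n) * (k ^ n * q ^ n)))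
  resolution k′ n = R , q , fits , q^n>0 , bound
    where
    open ℕP.≤-Reasoning
    k = suc k′
    -- Chosen for a cheap lower bound on `q`: from R < 2^R ≤ k (q + 1) it follows that q ≥ 4n + 1,
    -- more than `suc-^-≤` asks for when j = 2n.
    R = k * (suc (n + n + (n + n)))
    q = 2 ^ R / k
    fits : k * q ≤ 2 ^ R
    fits = ℕP.≤-trans (ℕP.≤-reflexive (ℕP.*-comm k q)) (m/n*n≤m (2 ^ R) k)
    2^R≤ : 2 ^ R ≤ k * suc q
    2^R≤ = begin
      2 ^ R                     ≡⟨ m≡m%n+[m/n]*n (2 ^ R) k ⟩
      2 ^ R % k + q * k         ≤⟨ ℕP.+-monoˡ-≤ (q * k) (ℕP.<⇒≤ (m%n<n (2 ^ R) k)) ⟩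
      k + q * k                 ≡⟨ ℕP.*-comm (suc q) k ⟩
      k * suc q                 ∎
    4n≤q : suc (n + n + (n + n)) ≤ q
    4n≤q = ℕP.≤-pred (ℕP.*-cancelˡ-< k _ _ (ℕP.<-≤-trans (n<2^n R) 2^R≤))
    q>0 : 0 < q
    q>0 = ℕP.≤-trans (ℕ.s≤s ℕ.z≤n) 4n≤q
    q^n>0 : 0 < q ^ n
    q^n>0 = ℕP.m^n>0 q {{ℕ.>-nonZero q>0}} n
    bound : 2 ^ (n * R) * 2 ^ (n * R) ≤ 2 * ((k ^ n * q ^ n) * (k ^ n * q ^ n))
    bound = begin
      2 ^ (n * R) * 2 ^ (n * R)
        ≡⟨ cong (λ s → s * s) (trans (cong (2 ^_) (ℕP.*-comm n R)) (sym (ℕP.^-*-assoc 2 R n))) ⟩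
      (2 ^ R) ^ n * (2 ^ R) ^ n
        ≤⟨ ℕP.*-mono-≤ (ℕP.^-monoˡ-≤ n 2^R≤) (ℕP.^-monoˡ-≤ n 2^R≤) ⟩
      (k * suc q) ^ n * (k * suc q) ^ n
        ≡⟨ cong (λ s → s * s) (^-distribʳ-* n k (suc q)) ⟩
      (k ^ n * suc q ^ n) * (k ^ n * suc q ^ n)
        ≡⟨ ring₁ (k ^ n) (suc q ^ n) ⟩
      (k ^ n * k ^ n) * (suc q ^ n * suc q ^ n)
        ≡⟨ cong ((k ^ n * k ^ n) *_) (ℕP.^-distribˡ-+-* (suc q) n n) ⟨
      (k ^ n * k ^ n) * suc q ^ (n + n)
        ≤⟨ ℕP.*-monoʳ-≤ (k ^ n * k ^ n) (suc-^-≤ q (n + n) (ℕP.≤-trans (ℕP.n≤1+n _) 4n≤q)) ⟩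
      (k ^ n * k ^ n) * (2 * q ^ (n + n))
        ≡⟨ cong (λ s → (k ^ n * k ^ n) * (2 * s)) (ℕP.^-distribˡ-+-* q n n) ⟩
      (k ^ n * k ^ n) * (2 * (q ^ n * q ^ n))
        ≡⟨ ring₂ (k ^ n) (q ^ n) ⟩
      2 * ((k ^ n * q ^ n) * (k ^ n * q ^ n)) ∎
      where
      ring₁ : ∀ a b → (a * b) * (a * b) ≡ (a * a) * (b * b)
      ring₁ = ℕ-ring
      ring₂ : ∀ a b → (a * a) * (2 * (b * b)) ≡ 2 * ((a * b) * (a * b))
      ring₂ = ℕ-ring

  -- Averaging, and the set of influential coordinates.

  fin-average : ∀ k (g : Fin (suc k) → ℕ) → Σ (Fin (suc k)) λ a → suc k * g a ≤ sumFin (suc k) g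
  fin-average zero    g = zero , ℕP.≤-refl
  fin-average (suc k) g with fin-average k (g ∘ suc)
  ... | a , le with ℕP.≤-total (g zero) (g (suc a))
  ...   | inj₁ 0≤a = zero , ℕP.≤-trans (ℕP.+-monoʳ-≤ (g zero) (ℕP.≤-trans (ℕP.*-monoʳ-≤ (suc k) 0≤a) le)) (ℕP.≤-reflexive (sym (sumFin-suc (suc k) g)))
  ...   | inj₂ a≤0 = suc a , ℕP.≤-trans (ℕP.+-mono-≤ a≤0 le) (ℕP.≤-reflexive (sym (sumFin-suc (suc k) g)))

  vec-average : ∀ {k} n (g : Vec (Fin (suc k)) n → ℕ) → Σ (Vec (Fin (suc k)) n) λ y → suc k ^ n * g y ≤ sumVec n g
  vec-average     zero    g = [] , ℕP.≤-reflexive (ℕP.*-identityˡ (g []))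
  vec-average {k} (suc n) g with fin-average k (λ a → sumVec n (λ x → g (a ∷ x)))
  ... | a , le with vec-average n (λ x → g (a ∷ x))
  ...   | y , le′ = a ∷ y , (begin
    suc k * suc k ^ n * g (a ∷ y)       ≡⟨ ℕP.*-assoc (suc k) (suc k ^ n) (g (a ∷ y)) ⟩
    suc k * (suc k ^ n * g (a ∷ y))     ≤⟨ ℕP.*-monoʳ-≤ (suc k) le′ ⟩
    suc k * sumVec n (λ x → g (a ∷ x))  ≤⟨ le ⟩
    sumVec (suc n) g                    ∎)
    where open ℕP.≤-Reasoning

  sumVec-const : ∀ {k} n c → sumVec {k} n (λ _ → c) ≡ k ^ n * c
  sumVec-const     zero    c = sym (ℕP.*-identityˡ c)
  sumVec-const {k} (suc n) c = trans (sumFin-cong k λ _ → sumVec-const {k} n c)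
    (trans (sumFin-const k (k ^ n * c)) (sym (ℕP.*-assoc k (k ^ n) c)))

  module Support (k′ R q n : ℕ) (fits : suc k′ * q ≤ 2 ^ R) {l : ℕ} (h : Vec (Fin (suc k′)) n → Fin l) where

    open Encoding k′ R q fits

    private
      k = suc k′
      T = 2 ^ (n * R)

      h′ : Cube (n * R) → Fin l
      h′ w = h (encode n w)

    totalInfluence : ℕ
    totalInfluence = sumFin (n * R) (influence h′)

    module _ (d : ℕ) where

      private
        K = 9 ^ d * (suc d * suc d)

        -- Summing over the R bits of a coordinate keeps the size of `support` independent of `R`,
        -- while still dominating the influence of each single bit.
        score : Fin n → ℕ
        score i = sumFin R (λ r → influence h′ (combine i r))

        influential : Fin n → Bool
        influential i = T <ᵇ 2 * score i * K

      support : Subset n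
      support = tabulate influential

      support-size : ∣ support ∣ * T ≤ 2 * totalInfluence * K
      support-size = begin
        ∣ support ∣ * T
          ≤⟨ count-bound influential T (λ i → 2 * score i * K) (λ i e → ℕP.<⇒≤ (ℕP.<ᵇ⇒< T _ (subst Bool.T (sym e) _))) ⟩
        sumFin n (λ i → 2 * score i * K)
          ≡⟨ sumFin-cong n (λ i → ring₁ (score i) K) ⟩
        sumFin n (λ i → 2 * K * score i)
          ≡⟨ sumFin-* n (2 * K) score ⟩
        2 * K * sumFin n score
          ≡⟨ cong (2 * K *_) (sumFin-combine n R (influence h′)) ⟨
        2 * K * totalInfluence
          ≡⟨ ring₁ totalInfluence K ⟨
        2 * totalInfluence * K ∎
        where
        open ℕP.≤-Reasoning
        ring₁ : ∀ s k → 2 * s * k ≡ 2 * k * s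
        ring₁ = ℕ-ring

      private
        small : ∀ j → lookup (expand support) j ≡ false → 2 * influence h′ j * K ≤ T
        small j = subst (λ j → lookup (expand support) j ≡ false → 2 * influence h′ j * K ≤ T)
          (FinP.combine-remQuot {n} R j) (at (proj₁ (remQuot {n} R j)) (proj₂ (remQuot {n} R j)))
          where
          at : ∀ i r → lookup (expand support) (combine i r) ≡ false → 2 * influence h′ (combine i r) * K ≤ T
          at i r e = ℕP.≤-trans (ℕP.*-monoˡ-≤ K (ℕP.*-monoʳ-≤ 2 (sumFin-term R (λ r → influence h′ (combine i r)) r)))
            (ℕP.≮⇒≥ λ T< → contradiction (trans (sym (<ᵇ-true T<)) (trans (sym (lookup∘tabulate influential i))
              (trans (sym (lookup-expand support i r)) e))) λ ())

      -- `pushforward` is applied once in each variable, whence the square of q^n; by `encode-mix`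
      -- the resulting sum over pairs of strings is the dependence of the encoded function on the
      -- bits outside the expanded support.
      support-dependence : suc d * ((q ^ n * q ^ n) * sumVec n (λ y → sumVec n (λ x → cdist l (h x) (h (mix support x y))))) ≤
        T * (2 * totalInfluence)
      support-dependence = ℕP.≤-trans (ℕP.*-monoʳ-≤ (suc d) (begin
        (q ^ n * q ^ n) * sumVec n (λ y → sumVec n (λ x → G x y))
          ≡⟨ trans (ℕP.*-assoc (q ^ n) (q ^ n) _) (cong (q ^ n *_) (sym (sumVec-* n (q ^ n) (λ y → sumVec n (λ x → G x y))))) ⟩
        q ^ n * sumVec n (λ y → q ^ n * sumVec n (λ x → G x y))
          ≤⟨ ℕP.*-monoʳ-≤ (q ^ n) (sumVec-mono n λ y → pushforward n (λ x → G x y)) ⟩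
        q ^ n * sumVec n (λ y → ∑ᴺ (λ w → G (encode n w) y))
          ≤⟨ pushforward n (λ y → ∑ᴺ (λ w → G (encode n w) y)) ⟩
        ∑ᴺ (λ v → ∑ᴺ (λ w → G (encode n w) (encode n v)))
          ≡⟨ ∑ᴺ-swap (λ w v → G (encode n w) (encode n v)) ⟨
        ∑ᴺ (λ w → ∑ᴺ (λ v → G (encode n w) (encode n v)))
          ≡⟨ ∑ᴺ-cong (λ w → ∑ᴺ-cong λ v → cong (λ z → cdist l (h′ w) (h z)) (sym (encode-mix n support w v))) ⟩
        dependence h′ (expand support) ∎))
        (dependence-bound h′ d (expand support) small)
        where
        open ℕP.≤-Reasoning
        G : Vec (Fin k) n → Vec (Fin k) n → ℕ
        G x y = cdist l (h x) (h (mix support x y))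

  -- Passage between two forms of vectors, Markov's inequality and the exponential bound.

  cdist-≡ : ∀ {q} (a b : Fin q) → cdist q a b ≡ 0 → a ≡ b
  cdist-≡ {q} a b e with ℕP.⊓-sel ∣ toℕ a - toℕ b ∣ (q ∸ ∣ toℕ a - toℕ b ∣)
  ... | inj₁ s = FinP.toℕ-injective (ℕP.∣m-n∣≡0⇒m≡n (trans (sym s) e))
  ... | inj₂ s = contradiction (ℕP.≤-<-trans (ℕP.m∸n≡0⇒m≤n (trans (sym s) e))
      (ℕP.≤-<-trans (ℕP.∣m-n∣≤m⊔n (toℕ a) (toℕ b)) (ℕP.⊔-lub (FinP.toℕ<n a) (FinP.toℕ<n b)))) (ℕP.<-irrefl refl)

  cdist-≤ : ∀ {q} (a b : Fin q) → cdist q a b ≤ q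
  cdist-≤ {q} a b = ℕP.≤-trans (ℕP.m⊓n≤n _ _) (ℕP.m∸n≤m q ∣ toℕ a - toℕ b ∣)

  sumFin-0 : ∀ n (g : Fin n → ℕ) → sumFin n g ≡ 0 → ∀ i → g i ≡ 0
  sumFin-0 n g e i = ℕP.n≤0⇒n≡0 (subst (g i ≤_) e (sumFin-term n g i))

  sumFin-distance : ∀ {k n} (x y : Vec (Fin k) n) → sumFin n (λ i → cdist k (lookup x i) (lookup y i)) ≡ distance x y
  sumFin-distance []      []      = refl
  sumFin-distance {k} {suc n} (a ∷ x) (b ∷ y) =
    trans (sumFin-suc n (λ i → cdist k (lookup (a ∷ x) i) (lookup (b ∷ y) i))) (cong (cdist k a b +_) (sumFin-distance x y))

  sumVec-cong : ∀ {k} n {g h : Vec (Fin k) n → ℕ} → (∀ x → g x ≡ h x) → sumVec n g ≡ sumVec n h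
  sumVec-cong     zero    e = e []
  sumVec-cong {k} (suc n) e = sumFin-cong k λ a → sumVec-cong n λ x → e (a ∷ x)

  -- Functions on Vector are compared pointwise, so passing to Vec requires extensionality of the summand.
  sumCube-Vec : ∀ n k (h : Vector (Fin k) n → ℕ) → (∀ x y → (∀ j → x j ≡ y j) → h x ≡ h y) →
    sumCube n k h ≡ sumVec n (λ v → h (lookup v))
  sumCube-Vec zero    k h ext = ext _ _ λ ()
  sumCube-Vec (suc n) k h ext = sumFin-cong k λ a → trans
    (sumCube-Vec n k (λ x → h (a ∷ᶠ x)) λ x y e → ext _ _ λ { zero → refl ; (suc j) → e j })
    (sumVec-cong n λ v → ext _ _ λ { zero → refl ; (suc j) → refl })

  mix-agree : ∀ {n} {A : Set} (J : Subset n) (x x′ y : Vec A n) →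
    (∀ j → j ∈ J → lookup x j ≡ lookup x′ j) → mix J x y ≡ mix J x′ y
  mix-agree []          []      []        []      e = refl
  mix-agree (true  ∷ J) (a ∷ x) (a′ ∷ x′) (b ∷ y) e = cong₂ _∷_ (e zero here) (mix-agree J x x′ y λ j j∈J → e (suc j) (there j∈J))
  mix-agree (false ∷ J) (a ∷ x) (a′ ∷ x′) (b ∷ y) e = cong (b ∷_) (mix-agree J x x′ y λ j j∈J → e (suc j) (there j∈J))

  markov : ∀ {n} (b : Fin n → Bool) X (s : Fin n → ℕ) → (∀ i → b i ≡ false → X ≤ s i) →
    n * X ≤ ∣ tabulate b ∣ * X + sumFin n s
  markov {zero}  b X s le = ℕ.z≤n
  markov {suc n} b X s le = ℕP.≤-trans (step (b zero) refl)
    (ℕP.≤-reflexive (cong (∣ b zero ∷ tabulate (b ∘ suc) ∣ * X +_) (sym (sumFin-suc n s))))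
    where
    open ℕP.≤-Reasoning
    c = ∣ tabulate (b ∘ suc) ∣
    rest = sumFin n (s ∘ suc)
    ih : n * X ≤ c * X + rest
    ih = markov (b ∘ suc) X (s ∘ suc) (λ i → le (suc i))
    insert : ∀ x y z w → x + (y + w) ≤ x + (y + (z + w))
    insert x y z w = ℕP.+-monoʳ-≤ x (ℕP.+-monoʳ-≤ y (ℕP.m≤n+m w z))
    swap : ∀ s c r → s + (c + r) ≡ c + (s + r)
    swap = ℕ-ring
    step : ∀ β → b zero ≡ β → X + n * X ≤ ∣ β ∷ tabulate (b ∘ suc) ∣ * X + (s zero + rest)
    step true e = begin
      X + n * X                          ≤⟨ ℕP.+-monoʳ-≤ X ih ⟩
      X + (c * X + rest)                 ≤⟨ insert X (c * X) (s zero) rest ⟩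
      X + (c * X + (s zero + rest))      ≡⟨ ℕP.+-assoc X (c * X) (s zero + rest) ⟨
      X + c * X + (s zero + rest)        ∎
    step false e = begin
      X + n * X                          ≤⟨ ℕP.+-mono-≤ (le zero e) ih ⟩
      s zero + (c * X + rest)            ≡⟨ swap (s zero) (c * X) rest ⟩
      c * X + (s zero + rest)            ∎

  -- The exponent is 7 = 4 + 3: from 9 ≤ 2⁴ and three factors d + 1 ≤ 2^d. Two of these factors
  -- belong to the influence threshold; the third comes from bounding 8 α k / (δ ε) by d + 1.
  exp-bound : ∀ d → 9 ^ d * (suc d * suc d) * suc d ≤ 2 ^ (7 * d)
  exp-bound d = begin
    9 ^ d * (suc d * suc d) * suc d
      ≤⟨ ℕP.*-mono-≤ (ℕP.*-mono-≤ (ℕP.^-monoˡ-≤ d (ℕP.m≤m+n 9 7)) (ℕP.*-mono-≤ (n<2^n d) (n<2^n d))) (n<2^n d) ⟩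
    16 ^ d * (2 ^ d * 2 ^ d) * 2 ^ d
      ≡⟨ cong (λ s → s * (2 ^ d * 2 ^ d) * 2 ^ d) (ℕP.^-*-assoc 2 4 d) ⟩
    2 ^ (4 * d) * (2 ^ d * 2 ^ d) * 2 ^ d
      ≡⟨ cong (λ s → 2 ^ (4 * d) * s * 2 ^ d) (ℕP.^-distribˡ-+-* 2 d d) ⟨
    2 ^ (4 * d) * 2 ^ (d + d) * 2 ^ d
      ≡⟨ cong (_* 2 ^ d) (ℕP.^-distribˡ-+-* 2 (4 * d) (d + d)) ⟨
    2 ^ (4 * d + (d + d)) * 2 ^ d
      ≡⟨ ℕP.^-distribˡ-+-* 2 (4 * d + (d + d)) d ⟨
    2 ^ (4 * d + (d + d) + d)
      ≡⟨ cong (2 ^_) (ring₁ d) ⟩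
    2 ^ (7 * d) ∎
    where
    open ℕP.≤-Reasoning
    ring₁ : ∀ d → 4 * d + (d + d) + d ≡ 7 * d
    ring₁ = ℕ-ring

  -- The parameters are fractions: α = p / r, δ = s / t and ε = u / v.
  module Core (k′ l n′ m p r s t u v : ℕ) .{{_ : NonZero p}} .{{_ : NonZero r}} .{{_ : NonZero s}} .{{_ : NonZero t}}
    .{{_ : NonZero u}} .{{_ : NonZero v}}
    (f : Vector (Fin (suc k′)) (suc n′) → Vector (Fin l) m)
    (lipschitz : ∀ x y → r * suc n′ * sumFin m (λ i → cdist l (f x i) (f y i)) ≤
                         p * m * sumFin (suc n′) (λ j → cdist (suc k′) (x j) (y j))) where

    private
      k = suc k′
      n = suc n′

      R q : ℕ
      R = proj₁ (resolution k′ n)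
      q = proj₁ (proj₂ (resolution k′ n))

      fits : k * q ≤ 2 ^ R
      fits = proj₁ (proj₂ (proj₂ (resolution k′ n)))

      q^n>0 : 0 < q ^ n
      q^n>0 = proj₁ (proj₂ (proj₂ (proj₂ (resolution k′ n))))

      T = 2 ^ (n * R)

      T²≤ : T * T ≤ 2 * ((k ^ n * q ^ n) * (k ^ n * q ^ n))
      T²≤ = proj₂ (proj₂ (proj₂ (proj₂ (resolution k′ n))))

      h : Fin m → Vec (Fin k) n → Fin l
      h i x = f (lookup x) i

      open Encoding k′ R q fits using (encode; encode-edges)
      module Sup i = Support k′ R q n fits (h i)

      I : Fin m → ℕ
      I i = Sup.totalInfluence i

    -- Vectors are functions, and pointwise equal ones need not be propositionally equal. The
    -- Lipschitz condition at distance zero nevertheless forces equal values of `f`.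
    extensional : ∀ x y → (∀ j → x j ≡ y j) → ∀ i → f x i ≡ f y i
    extensional x y e i = cdist-≡ (f x i) (f y i) (sumFin-0 m (λ i → cdist l (f x i) (f y i)) sum≡0 i)
      where
      sum≡0 : sumFin m (λ i → cdist l (f x i) (f y i)) ≡ 0
      sum≡0 = ℕP.n≤0⇒n≡0 (ℕP.*-cancelˡ-≤ (r * n) {{ℕP.m*n≢0 r n}} (ℕP.≤-trans (lipschitz x y) (ℕP.≤-reflexive
        (trans (cong (p * m *_) (trans (sumFin-cong n λ j → trans (cong (cdist k (x j)) (sym (e j))) (cdist-refl (x j)))
          (trans (sumFin-const n 0) (ℕP.*-zeroʳ n)))) (trans (ℕP.*-zeroʳ (p * m)) (sym (ℕP.*-zeroʳ (r * n))))))))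

    private
      -- The Lipschitz condition is applied to every edge of the bit cube. The n coordinates counted
      -- by `encode-edges` cancel against the normalisation of the norm on the domain, so that the
      -- average of `I` over the m outputs is at most 2 α k T.
      total-influence : r * sumFin m I ≤ 2 * p * k * T * m
      total-influence = ℕP.*-cancelˡ-≤ n (begin
        n * (r * sumFin m I)
          ≡⟨ ring₁ n r (sumFin m I) ⟩
        r * n * sumFin m I
          ≡⟨ cong (r * n *_) (sumFin-swap m (n * R) (λ i j → influence (λ w → h i (encode n w)) j)) ⟩
        r * n * sumFin (n * R) (λ j → sumFin m (λ i → ∑ᴺ (λ w → c i j w)))
          ≡⟨ cong (r * n *_) (sumFin-cong (n * R) λ j → sym (∑ᴺ-sumFin m (λ w i → c i j w))) ⟩
        r * n * sumFin (n * R) (λ j → ∑ᴺ (λ w → sumFin m (λ i → c i j w)))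
          ≡⟨ cong (r * n *_) (∑ᴺ-sumFin (n * R) (λ w j → sumFin m (λ i → c i j w))) ⟨
        r * n * ∑ᴺ (λ w → sumFin (n * R) (λ j → sumFin m (λ i → c i j w)))
          ≡⟨ trans (sym (∑ᴺ-* (r * n) (λ w → sumFin (n * R) (λ j → sumFin m (λ i → c i j w)))))
               (∑ᴺ-cong λ w → sym (sumFin-* (n * R) (r * n) (λ j → sumFin m (λ i → c i j w)))) ⟩
        ∑ᴺ (λ w → sumFin (n * R) (λ j → r * n * sumFin m (λ i → c i j w)))
          ≤⟨ ∑ᴺ-≤ (λ w → sumFin-mono (n * R) λ j → ℕP.≤-trans (lipschitz (lookup (encode n w)) (lookup (encode n (flip j w))))
               (ℕP.≤-reflexive (cong (p * m *_) (sumFin-distance (encode n w) (encode n (flip j w)))))) ⟩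
        ∑ᴺ (λ w → sumFin (n * R) (λ j → p * m * e j w))
          ≡⟨ trans (∑ᴺ-cong λ w → sumFin-* (n * R) (p * m) (λ j → e j w)) (∑ᴺ-* (p * m) (λ w → sumFin (n * R) (λ j → e j w))) ⟩
        p * m * ∑ᴺ (λ w → sumFin (n * R) (λ j → e j w))
          ≤⟨ ℕP.*-monoʳ-≤ (p * m) (encode-edges n) ⟩
        p * m * (n * (2 * T * k))
          ≡⟨ ring₂ p m n T k ⟩
        n * (2 * p * k * T * m) ∎)
        where
        open ℕP.≤-Reasoning
        c : Fin m → Fin (n * R) → Cube (n * R) → ℕ
        c i j w = cdist l (h i (encode n w)) (h i (encode n (flip j w)))
        e : Fin (n * R) → Cube (n * R) → ℕ
        e j w = distance (encode n w) (encode n (flip j w))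
        ring₁ : ∀ n r s → n * (r * s) ≡ r * n * s
        ring₁ = ℕ-ring
        ring₂ : ∀ p m n t k → p * m * (n * (2 * t * k)) ≡ n * (2 * p * k * t * m)
        ring₂ = ℕ-ring

      -- The threshold 2 α k T / δ is 1/δ times the bound on the average of `I`.
      good : Fin m → Bool
      good i = r * s * I i ≤ᵇ 2 * p * k * T * t

    selected : Subset m
    selected = tabulate good

    selected-size : m * t ≤ ∣ selected ∣ * t + s * m
    selected-size = ℕP.*-cancelˡ-≤ Y {{Y≢0}} (begin
      Y * (m * t)
        ≡⟨ ring₁ Y m t ⟩
      m * (Y * t)
        ≤⟨ markov good (Y * t) (λ i → r * s * I i) (λ i e → ℕP.<⇒≤ (≤ᵇ-false (r * s * I i) (Y * t) e)) ⟩
      ∣ selected ∣ * (Y * t) + sumFin m (λ i → r * s * I i)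
        ≡⟨ cong (∣ selected ∣ * (Y * t) +_) (trans (sumFin-* m (r * s) I) (ring₂ r s (sumFin m I))) ⟩
      ∣ selected ∣ * (Y * t) + s * (r * sumFin m I)
        ≤⟨ ℕP.+-monoʳ-≤ (∣ selected ∣ * (Y * t)) (ℕP.*-monoʳ-≤ s total-influence) ⟩
      ∣ selected ∣ * (Y * t) + s * (Y * m)
        ≡⟨ ring₃ ∣ selected ∣ Y t s m ⟩
      Y * (∣ selected ∣ * t + s * m) ∎)
      where
      open ℕP.≤-Reasoning
      Y = 2 * p * k * T
      Y≢0 : NonZero Y
      Y≢0 = ℕP.m*n≢0 (2 * p * k) T {{ℕP.m*n≢0 (2 * p) k {{ℕP.m*n≢0 2 p}}}} {{ℕP.m^n≢0 2 (n * R)}}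
      ring₁ : ∀ y m t → y * (m * t) ≡ m * (y * t)
      ring₁ = ℕ-ring
      ring₂ : ∀ r s i → r * s * i ≡ s * (r * i)
      ring₂ = ℕ-ring
      ring₃ : ∀ c y t s m → c * (y * t) + s * (y * m) ≡ y * (c * t + s * m)
      ring₃ = ℕ-ring

    instance
      rsu≢0 : NonZero (r * s * u)
      rsu≢0 = ℕP.m*n≢0 (r * s) u {{ℕP.m*n≢0 r s}}

    -- d = ⌊8 α k / (δ ε)⌋
    degree : ℕ
    degree = (8 * p * k * t * v) / (r * s * u)

    degree-lower : 8 * p * k * t * v ≤ suc degree * (r * s * u)
    degree-lower = ℕP.≤-trans (ℕP.≤-reflexive (m≡m%n+[m/n]*n (8 * p * k * t * v) (r * s * u)))
      (ℕP.+-monoˡ-≤ (degree * (r * s * u)) (ℕP.<⇒≤ (m%n<n (8 * p * k * t * v) (r * s * u))))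

    degree-upper : degree * (r * s * u) ≤ 8 * p * k * t * v
    degree-upper = m/n*n≤m (8 * p * k * t * v) (r * s * u)

    private
      error : Fin m → Subset n → Vec (Fin k) n → ℕ
      error i J y = sumVec n (λ x → cdist l (h i x) (h i (mix J x y)))

      d = degree

      K = 9 ^ d * (suc d * suc d)

      -- For ε ≥ l a constant function is close enough, since no distance exceeds l.
      large-ε : ∀ i → l * v ≤ u → Σ (Subset n) λ J → Σ (Vec (Fin k) n) λ y →
        (∣ J ∣ ≤ l * 2 ^ (7 * d)) × (error i J y * v ≤ u * k ^ n)
      large-ε i lv≤u = ⊥ , replicate n zero , subst (_≤ l * 2 ^ (7 * d)) (sym (∣⊥∣≡0 n)) ℕ.z≤n , (begin
        error i ⊥ (replicate n zero) * v   ≤⟨ ℕP.*-monoˡ-≤ v (sumVec-mono n λ x → cdist-≤ (h i x) (h i (mix ⊥ x (replicate n zero)))) ⟩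
        sumVec {k} n (λ _ → l) * v         ≡⟨ cong (_* v) (sumVec-const {k} n l) ⟩
        k ^ n * l * v                      ≡⟨ ℕP.*-assoc (k ^ n) l v ⟩
        k ^ n * (l * v)                    ≤⟨ ℕP.*-monoʳ-≤ (k ^ n) lv≤u ⟩
        k ^ n * u                          ≡⟨ ℕP.*-comm (k ^ n) u ⟩
        u * k ^ n                          ∎)
        where open ℕP.≤-Reasoning

      -- In real terms the size is at most 2 I K / T ≤ 4 α k K / δ ≤ (ε/2) (d+1) K. The average
      -- error over `y`, divided by k^n, is at most 8 α k / (δ (d+1)) ≤ ε.
      small-ε : ∀ i → r * s * I i ≤ 2 * p * k * T * t → u ≤ l * v → Σ (Subset n) λ J → Σ (Vec (Fin k) n) λ y →
        (∣ J ∣ ≤ l * 2 ^ (7 * d)) × (error i J y * v ≤ u * k ^ n)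
      small-ε i I≤ u≤lv = J , y , size , close
        where
        open ℕP.≤-Reasoning
        J = Sup.support i d
        average = vec-average n (λ y → error i J y)
        y = proj₁ average
        E = error i J y
        Q = q ^ n * q ^ n
        size : ∣ J ∣ ≤ l * 2 ^ (7 * d)
        size = ℕP.*-cancelˡ-≤ (2 * (r * s) * v * T) {{nz}} (begin
          2 * (r * s) * v * T * ∣ J ∣
            ≡⟨ ring₁ (r * s) v T ∣ J ∣ ⟩
          2 * v * (r * s) * (∣ J ∣ * T)
            ≤⟨ ℕP.*-monoʳ-≤ (2 * v * (r * s)) (Sup.support-size i d) ⟩
          2 * v * (r * s) * (2 * I i * K)
            ≡⟨ ring₂ v (r * s) (I i) K ⟩
          4 * v * K * (r * s * I i)
            ≤⟨ ℕP.*-monoʳ-≤ (4 * v * K) I≤ ⟩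
          4 * v * K * (2 * p * k * T * t)
            ≡⟨ ring₃ v K p k T t ⟩
          T * K * (8 * p * k * t * v)
            ≤⟨ ℕP.*-monoʳ-≤ (T * K) degree-lower ⟩
          T * K * (suc d * (r * s * u))
            -- The factor l of the final bound enters here, as an upper bound for ε.
            ≤⟨ ℕP.*-monoʳ-≤ (T * K) (ℕP.*-monoʳ-≤ (suc d) (ℕP.*-monoʳ-≤ (r * s) u≤lv)) ⟩
          T * K * (suc d * (r * s * (l * v)))
            ≡⟨ ring₄ T K (suc d) (r * s) l v ⟩
          (r * s) * v * T * (l * (K * suc d))
            -- A spare factor 2 is given away, so that both sides carry the same multiplier.
            ≤⟨ ℕP.*-monoˡ-≤ (l * (K * suc d)) (ℕP.*-monoˡ-≤ T (ℕP.*-monoˡ-≤ v (ℕP.m≤m+n (r * s) _))) ⟩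
          2 * (r * s) * v * T * (l * (K * suc d))
            ≤⟨ ℕP.*-monoʳ-≤ (2 * (r * s) * v * T) (ℕP.*-monoʳ-≤ l (exp-bound d)) ⟩
          2 * (r * s) * v * T * (l * 2 ^ (7 * d)) ∎)
          where
          nz : NonZero (2 * (r * s) * v * T)
          nz = ℕP.m*n≢0 (2 * (r * s) * v) T {{ℕP.m*n≢0 (2 * (r * s)) v {{ℕP.m*n≢0 2 (r * s) {{_}} {{ℕP.m*n≢0 r s}}}}}} {{ℕP.m^n≢0 2 (n * R)}}
          ring₁ : ∀ a v t j → 2 * a * v * t * j ≡ 2 * v * a * (j * t)
          ring₁ = ℕ-ring
          ring₂ : ∀ v a i k → 2 * v * a * (2 * i * k) ≡ 4 * v * k * (a * i)
          ring₂ = ℕ-ring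
          ring₃ : ∀ v c p k b t → 4 * v * c * (2 * p * k * b * t) ≡ b * c * (8 * p * k * t * v)
          ring₃ = ℕ-ring
          ring₄ : ∀ b c d a l v → b * c * (d * (a * (l * v))) ≡ a * v * b * (l * (c * d))
          ring₄ = ℕ-ring
        close : E * v ≤ u * k ^ n
        close = ℕP.*-cancelˡ-≤ (suc d * (r * s) * Q * k ^ n) {{nz}} (begin
          suc d * (r * s) * Q * k ^ n * (E * v)
            ≡⟨ ring₁ (suc d) (r * s) Q (k ^ n) E v ⟩
          r * s * v * (suc d * (Q * (k ^ n * E)))
            ≤⟨ ℕP.*-monoʳ-≤ (r * s * v) (ℕP.*-monoʳ-≤ (suc d) (ℕP.*-monoʳ-≤ Q (proj₂ average))) ⟩
          r * s * v * (suc d * (Q * sumVec n (λ y → error i J y)))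
            ≤⟨ ℕP.*-monoʳ-≤ (r * s * v) (Sup.support-dependence i d) ⟩
          r * s * v * (T * (2 * I i))
            ≡⟨ ring₂ (r * s) v T (I i) ⟩
          2 * v * T * (r * s * I i)
            ≤⟨ ℕP.*-monoʳ-≤ (2 * v * T) I≤ ⟩
          2 * v * T * (2 * p * k * T * t)
            ≡⟨ ring₃ v T p k t ⟩
          4 * p * k * t * v * (T * T)
            -- Replacing pairs of strings by pairs of points turns the constant 4 into 8.
            ≤⟨ ℕP.*-monoʳ-≤ (4 * p * k * t * v) T²≤ ⟩
          4 * p * k * t * v * (2 * ((k ^ n * q ^ n) * (k ^ n * q ^ n)))
            ≡⟨ ring₄ p k t v (k ^ n) (q ^ n) ⟩
          8 * p * k * t * v * (Q * (k ^ n * k ^ n))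
            ≤⟨ ℕP.*-monoˡ-≤ (Q * (k ^ n * k ^ n)) degree-lower ⟩
          suc d * (r * s * u) * (Q * (k ^ n * k ^ n))
            ≡⟨ ring₅ (suc d) (r * s) u Q (k ^ n) ⟩
          suc d * (r * s) * Q * k ^ n * (u * k ^ n) ∎)
          where
          nz : NonZero (suc d * (r * s) * Q * k ^ n)
          nz = ℕP.m*n≢0 (suc d * (r * s) * Q) (k ^ n)
            {{ℕP.m*n≢0 (suc d * (r * s)) Q {{ℕP.m*n≢0 (suc d) (r * s) {{_}} {{ℕP.m*n≢0 r s}}}}
              {{ℕP.m*n≢0 (q ^ n) (q ^ n) {{ℕ.>-nonZero q^n>0}} {{ℕ.>-nonZero q^n>0}}}}}} {{ℕP.m^n≢0 k n}}
          ring₁ : ∀ d a q k e v → d * a * q * k * (e * v) ≡ a * v * (d * (q * (k * e)))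
          ring₁ = ℕ-ring
          ring₂ : ∀ a v t i → a * v * (t * (2 * i)) ≡ 2 * v * t * (a * i)
          ring₂ = ℕ-ring
          ring₃ : ∀ v b p k t → 2 * v * b * (2 * p * k * b * t) ≡ 4 * p * k * t * v * (b * b)
          ring₃ = ℕ-ring
          ring₄ : ∀ p k t v a q → 4 * p * k * t * v * (2 * ((a * q) * (a * q))) ≡ 8 * p * k * t * v * ((q * q) * (a * a))
          ring₄ = ℕ-ring
          ring₅ : ∀ d a u q k → d * (a * u) * (q * (k * k)) ≡ d * a * q * k * (u * k)
          ring₅ = ℕ-ring

    approximation : ∀ i → i ∈ selected → Σ (Subset n) λ J → Σ (Vec (Fin k) n) λ y →
      (∣ J ∣ ≤ l * 2 ^ (7 * d)) × (sumVec n (λ x → cdist l (f (lookup x) i) (f (lookup (mix J x y)) i)) * v ≤ u * k ^ n)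
    approximation i i∈ = [ large-ε i , small-ε i (≤ᵇ-true (r * s * I i) (2 * p * k * T * t)
      (trans (sym (lookup∘tabulate good i)) ([]=⇒lookup i∈))) ]′ (ℕP.≤-total (l * v) u)

-- Translation to rational numbers.

open Counting using (mix-agree; module Core; sumCube-Vec; sumVec-cong)

open import Data.Integer using (+_; +[1+_]; -[1+_])
open import Data.Rational as ℚ using (ℚ; 0ℚ; 1ℚ; _<_; _≤_; _*_; _-_; mkℚ; toℚᵘ)
import Data.Rational.Properties as ℚP
open import Data.Rational.Unnormalised as ℚᵘ using (mkℚᵘ; *≤*)
import Data.Rational.Unnormalised.Properties as ℚᵘP

toℚᵘ-frac : ∀ a d → toℚᵘ (frac a (suc d)) ℚᵘ.≃ mkℚᵘ (+ a) d
toℚᵘ-frac a d = ℚP.toℚᵘ-fromℚᵘ (mkℚᵘ (+ a) d)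

frac-lipschitz : ∀ {a b m n p r} .{c : Coprime (suc p) (suc r)} → frac a (suc m) ≤ mkℚ +[1+ p ] r c * frac b (suc n) →
  suc r ℕ.* suc n ℕ.* a ℕ.≤ suc p ℕ.* suc m ℕ.* b
frac-lipschitz {a} {b} {m} {n} {p} {r} {c} le = convert (ℚᵘP.≤-respˡ-≃ (toℚᵘ-frac a m)
  (ℚᵘP.≤-respʳ-≃ (ℚᵘP.≃-trans (ℚP.toℚᵘ-homo-* (mkℚ +[1+ p ] r c) (frac b (suc n))) (ℚᵘP.*-congˡ {mkℚᵘ +[1+ p ] r} (toℚᵘ-frac b n)))
    (ℚP.toℚᵘ-mono-≤ le)))
  where
  ring₁ : ∀ a r n → a ℕ.* (r ℕ.* n) ≡ r ℕ.* n ℕ.* a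
  ring₁ = ℕ-ring
  ring₂ : ∀ p b m → p ℕ.* b ℕ.* m ≡ p ℕ.* m ℕ.* b
  ring₂ = ℕ-ring
  convert : mkℚᵘ (+ a) m ℚᵘ.≤ mkℚᵘ +[1+ p ] r ℚᵘ.* mkℚᵘ (+ b) n → suc r ℕ.* suc n ℕ.* a ℕ.≤ suc p ℕ.* suc m ℕ.* b
  convert (*≤* h) = subst₂ ℕ._≤_ (ring₁ a (suc r) (suc n)) (ring₂ (suc p) b (suc m)) (ℤP.drop‿+≤+ (subst₂ ℤ._≤_
    (sym (ℤP.pos-* a (suc r ℕ.* suc n)))
    (sym (trans (ℤP.pos-* (suc p ℕ.* b) (suc m)) (cong (ℤ._* + suc m) (ℤP.pos-* (suc p) b)))) h))

frac-≤ : ∀ {a K u v} .{c : Coprime (suc u) (suc v)} .{{_ : NonZero K}} → a ℕ.* suc v ℕ.≤ suc u ℕ.* K → frac a K ≤ mkℚ +[1+ u ] v c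
frac-≤ {a} {suc w} {u} {v} le = ℚP.toℚᵘ-cancel-≤ (ℚᵘP.≤-respˡ-≃ (ℚᵘP.≃-sym (toℚᵘ-frac a w))
  (*≤* (subst₂ ℤ._≤_ (ℤP.pos-* a (suc v)) (ℤP.pos-* (suc u) (suc w)) (ℤ.+≤+ le))))

frac-complement : ∀ {m a s t} .{c : Coprime (suc s) (suc t)} → m ℕ.* suc t ℕ.≤ a ℕ.* suc t ℕ.+ suc s ℕ.* m →
  (1ℚ - mkℚ +[1+ s ] t c) * frac m 1 ≤ frac a 1
frac-complement {m} {a} {s} {t} {c} le = ℚP.toℚᵘ-cancel-≤ (ℚᵘP.≤-respˡ-≃ (ℚᵘP.≃-sym lhs)
  (ℚᵘP.≤-respʳ-≃ (ℚᵘP.≃-sym (toℚᵘ-frac a 0)) (*≤* ineq)))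
  where
  δ = mkℚ +[1+ s ] t c
  lhs : toℚᵘ ((1ℚ - δ) * frac m 1) ℚᵘ.≃ (mkℚᵘ (+ 1) 0 ℚᵘ.+ ℚᵘ.- mkℚᵘ +[1+ s ] t) ℚᵘ.* mkℚᵘ (+ m) 0
  lhs = ℚᵘP.≃-trans (ℚP.toℚᵘ-homo-* (1ℚ - δ) (frac m 1)) (ℚᵘP.*-cong
    (ℚᵘP.≃-trans (ℚP.toℚᵘ-homo-+ 1ℚ (ℚ.- δ)) (ℚᵘP.+-congʳ (mkℚᵘ (+ 1) 0) (ℚP.toℚᵘ-homo‿- δ))) (toℚᵘ-frac m 0))
  ring₁ : ∀ m s t → (+ 1 ℤ.* t ℤ.+ ℤ.- s ℤ.* + 1) ℤ.* m ℤ.* + 1 ≡ m ℤ.* t ℤ.- s ℤ.* m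
  ring₁ = ℤ-ring
  ring₂ : ∀ a s m t → a ℤ.* t ℤ.+ s ℤ.* m ℤ.- s ℤ.* m ≡ a ℤ.* t
  ring₂ = ℤ-ring
  ineq : (+ 1 ℤ.* + suc t ℤ.+ -[1+ s ] ℤ.* + 1) ℤ.* + m ℤ.* + 1 ℤ.≤ + a ℤ.* + (1 ℕ.* suc t ℕ.* 1)
  ineq = begin
    (+ 1 ℤ.* + suc t ℤ.+ -[1+ s ] ℤ.* + 1) ℤ.* + m ℤ.* + 1
      ≡⟨ ring₁ (+ m) +[1+ s ] (+ suc t) ⟩
    + m ℤ.* + suc t ℤ.- +[1+ s ] ℤ.* + m
      ≤⟨ ℤP.+-monoˡ-≤ (ℤ.- (+[1+ s ] ℤ.* + m)) (subst₂ ℤ._≤_ (ℤP.pos-* m (suc t))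
           (trans (ℤP.pos-+ (a ℕ.* suc t) (suc s ℕ.* m)) (cong₂ ℤ._+_ (ℤP.pos-* a (suc t)) (ℤP.pos-* (suc s) m))) (ℤ.+≤+ le)) ⟩
    + a ℤ.* + suc t ℤ.+ +[1+ s ] ℤ.* + m ℤ.- +[1+ s ] ℤ.* + m
      ≡⟨ ring₂ (+ a) +[1+ s ] (+ m) (+ suc t) ⟩
    + a ℤ.* + suc t
      ≡⟨ cong (λ z → + a ℤ.* + z) (trans (ℕP.*-identityʳ (1 ℕ.* suc t)) (ℕP.*-identityˡ (suc t))) ⟨
    + a ℤ.* + (1 ℕ.* suc t ℕ.* 1) ∎
    where open ℤP.≤-Reasoning

-- The bound M ≤ l 2^e is raised to the power of the denominator of `y`; then e ≤ y,
-- cross-multiplied, compares the exponents of 2.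
boundPow2 : ∀ M l e y → mkℚᵘ (+ e) 0 ℚᵘ.≤ toℚᵘ y → M ℕ.≤ l ℕ.* 2 ℕ.^ e → BoundPow2 M l y
boundPow2 M l e (mkℚ a b _) (*≤* h) M≤ with a | subst₂ ℤ._≤_ (sym (ℤP.pos-* e (suc b))) (ℤP.*-identityʳ a) h
... | + a | ℤ.+≤+ le = begin
  M ℕ.^ suc b                              ≤⟨ ℕP.^-monoˡ-≤ (suc b) M≤ ⟩
  (l ℕ.* 2 ℕ.^ e) ℕ.^ suc b                ≡⟨ ^-distribʳ-* (suc b) l (2 ℕ.^ e) ⟩
  l ℕ.^ suc b ℕ.* (2 ℕ.^ e) ℕ.^ suc b      ≡⟨ cong (l ℕ.^ suc b ℕ.*_) (ℕP.^-*-assoc 2 e (suc b)) ⟩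
  l ℕ.^ suc b ℕ.* 2 ℕ.^ (e ℕ.* suc b)      ≤⟨ ℕP.*-monoʳ-≤ (l ℕ.^ suc b) (ℕP.^-monoʳ-≤ 2 le) ⟩
  l ℕ.^ suc b ℕ.* 2 ℕ.^ a                  ∎
  where
  open ℕP.≤-Reasoning

-- 56 = 7 · 8: the support has size at most l · 2^(7d) with d ≤ 8 α k / (δ ε).
C₂ : ℚ
C₂ = + 56 ℚ./ 1

exponent-≤ : ∀ {d k p r s t u v} .{c₁ : Coprime (suc p) (suc r)} .{c₂ : Coprime (suc s) (suc t)} .{c₃ : Coprime (suc u) (suc v)} →
  d ℕ.* (suc r ℕ.* suc s ℕ.* suc u) ℕ.≤ 8 ℕ.* suc p ℕ.* k ℕ.* suc t ℕ.* suc v →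
  mkℚᵘ (+ (7 ℕ.* d)) 0 ℚᵘ.≤
  toℚᵘ (C₂ * mkℚ +[1+ p ] r c₁ * frac k 1 * recip (mkℚ +[1+ s ] t c₂) * recip (mkℚ +[1+ u ] v c₃))
exponent-≤ {d} {k} {p} {r} {s} {t} {u} {v} {c₁} {c₂} {c₃} le = ℚᵘP.≤-respʳ-≃ (ℚᵘP.≃-sym unfold) (*≤* ineq)
  where
  α = mkℚ +[1+ p ] r c₁
  δ⁻¹ = recip (mkℚ +[1+ s ] t c₂)
  ε⁻¹ = recip (mkℚ +[1+ u ] v c₃)
  unfold : toℚᵘ (C₂ * α * frac k 1 * δ⁻¹ * ε⁻¹) ℚᵘ.≃
    mkℚᵘ (+ 56) 0 ℚᵘ.* mkℚᵘ +[1+ p ] r ℚᵘ.* mkℚᵘ (+ k) 0 ℚᵘ.* mkℚᵘ +[1+ t ] s ℚᵘ.* mkℚᵘ +[1+ v ] u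
  -- On explicit positive fractions `recip` computes to the swapped fraction, so both reciprocals
  -- match by definition.
  unfold =
    ℚᵘP.≃-trans (ℚP.toℚᵘ-homo-* (C₂ * α * frac k 1 * δ⁻¹) ε⁻¹) (ℚᵘP.*-congʳ {mkℚᵘ +[1+ v ] u}
    (ℚᵘP.≃-trans (ℚP.toℚᵘ-homo-* (C₂ * α * frac k 1) δ⁻¹) (ℚᵘP.*-congʳ {mkℚᵘ +[1+ t ] s}
    (ℚᵘP.≃-trans (ℚP.toℚᵘ-homo-* (C₂ * α) (frac k 1)) (ℚᵘP.*-cong (ℚP.toℚᵘ-homo-* C₂ α) (toℚᵘ-frac k 0))))))
  ring₁ : ∀ d r s u → 7 ℕ.* d ℕ.* (1 ℕ.* r ℕ.* 1 ℕ.* s ℕ.* u) ≡ 7 ℕ.* (d ℕ.* (r ℕ.* s ℕ.* u))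
  ring₁ = ℕ-ring
  ring₂ : ∀ p k t v → 7 ℕ.* (8 ℕ.* p ℕ.* k ℕ.* t ℕ.* v) ≡ 56 ℕ.* p ℕ.* k ℕ.* t ℕ.* v ℕ.* 1
  ring₂ = ℕ-ring
  natural : 7 ℕ.* d ℕ.* (1 ℕ.* suc r ℕ.* 1 ℕ.* suc s ℕ.* suc u) ℕ.≤ 56 ℕ.* suc p ℕ.* k ℕ.* suc t ℕ.* suc v ℕ.* 1
  natural = subst₂ ℕ._≤_ (sym (ring₁ d (suc r) (suc s) (suc u))) (ring₂ (suc p) k (suc t) (suc v)) (ℕP.*-monoʳ-≤ 7 le)
  pos-product : ∀ a b c d e → + (a ℕ.* b ℕ.* c ℕ.* d ℕ.* e ℕ.* 1) ≡ + a ℤ.* + b ℤ.* + c ℤ.* + d ℤ.* + e ℤ.* + 1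
  pos-product a b c d e = trans (ℤP.pos-* (a ℕ.* b ℕ.* c ℕ.* d ℕ.* e) 1) (cong (ℤ._* + 1)
    (trans (ℤP.pos-* (a ℕ.* b ℕ.* c ℕ.* d) e) (cong (ℤ._* + e)
    (trans (ℤP.pos-* (a ℕ.* b ℕ.* c) d) (cong (ℤ._* + d)
    (trans (ℤP.pos-* (a ℕ.* b) c) (cong (ℤ._* + c) (ℤP.pos-* a b))))))))
  ineq : + (7 ℕ.* d) ℤ.* + (1 ℕ.* suc r ℕ.* 1 ℕ.* suc s ℕ.* suc u) ℤ.≤
    + 56 ℤ.* +[1+ p ] ℤ.* + k ℤ.* +[1+ t ] ℤ.* +[1+ v ] ℤ.* + 1
  ineq = subst₂ ℤ._≤_ (ℤP.pos-* (7 ℕ.* d) (1 ℕ.* suc r ℕ.* 1 ℕ.* suc s ℕ.* suc u))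
    (pos-product 56 (suc p) k (suc t) (suc v)) (ℤ.+≤+ natural)

-- Matching on this view exposes numerators and denominators as successors, which settles the
-- non-zero instances of `Core` and lets `recip` compute.
data Positive : ℚ → Set where
  positive : ∀ a b .(c : Coprime (suc a) (suc b)) → Positive (mkℚ +[1+ a ] b c)

positive-view : ∀ p → 0ℚ < p → Positive p
positive-view (mkℚ +[1+ a ] b c) _ = positive a b c
positive-view (mkℚ (+ 0) b c) (ℚ.*<* (ℤ.+<+ ()))
positive-view (mkℚ -[1+ a ] b c) (ℚ.*<* ())

Conclusion : (k l n m : ℕ) → ℚ → (Vector (Fin k) n → Vector (Fin l) m) → ℚ → ℚ → Set
Conclusion k l n m α f δ ε =
  Σ (Subset m) λ S → ((1ℚ - δ) * frac m 1 ≤ frac ∣ S ∣ 1) ×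
    (∀ i → i ∈ S → ∃ λ M → ∃ λ (g : Vector (Fin k) n → Fin l) →
      Junta k l n M g × Close k l n ε (λ x → f x i) g ×
      BoundPow2 M l (C₂ * α * frac k 1 * recip δ * recip ε))

conclusion : ∀ k l n m {α δ ε} → Positive α → Positive δ → Positive ε →
  ∀ (f : Vector (Fin (suc k)) (suc n) → Vector (Fin l) (suc m)) → Lipschitz (suc k) l (suc n) (suc m) α f →
  Conclusion (suc k) l (suc n) (suc m) α f δ ε
conclusion k l n m (positive p r c₁) (positive s t c₂) (positive u v c₃) f lip =
  selected , frac-complement {suc m} {∣ selected ∣} {s} {t} {c₂} selected-size , junta
  where
  open Core k l n (suc m) (suc p) (suc r) (suc s) (suc t) (suc u) (suc v) f 
    (λ x y → frac-lipschitz {sumFin (suc m) (λ i → cdist l (f x i) (f y i))} {sumFin (suc n) (λ j → cdist (suc k) (x j) (y j))} {m} {n} {p} {r} {c₁} (lip x y))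
  α′ = mkℚ +[1+ p ] r c₁
  δ′ = mkℚ +[1+ s ] t c₂
  ε′ = mkℚ +[1+ u ] v c₃
  junta : ∀ i → i ∈ selected → ∃ λ M → ∃ λ (g : Vector (Fin (suc k)) (suc n) → Fin l) →
    Junta (suc k) l (suc n) M g × Close (suc k) l (suc n) ε′ (λ x → f x i) g ×
    BoundPow2 M l (C₂ * α′ * frac (suc k) 1 * recip δ′ * recip ε′)
  junta i i∈ = ∣ J ∣ , g , (J , refl , depends) , close , boundPow2 ∣ J ∣ l (7 ℕ.* degree)
      (C₂ * α′ * frac (suc k) 1 * recip δ′ * recip ε′)
      (exponent-≤ {degree} {suc k} {p} {r} {s} {t} {u} {v} {c₁} {c₂} {c₃} degree-upper) size
    where
    result = approximation i i∈
    J = proj₁ result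
    y = proj₁ (proj₂ result)
    size = proj₁ (proj₂ (proj₂ result))
    g : Vector (Fin (suc k)) (suc n) → Fin l
    g x = f (lookup (mix J (tabulate x) y)) i
    depends : ∀ x x′ → (∀ j → j ∈ J → x j ≡ x′ j) → g x ≡ g x′
    depends x x′ agree = cong (λ z → f (lookup z) i) (mix-agree J (tabulate x) (tabulate x′) y λ j j∈J →
      trans (lookup∘tabulate x j) (trans (agree j j∈J) (sym (lookup∘tabulate x′ j))))
    difference : Vector (Fin (suc k)) (suc n) → ℕ
    difference x = cdist l (f x i) (g x)
    difference-ext : ∀ x x′ → (∀ j → x j ≡ x′ j) → difference x ≡ difference x′
    difference-ext x x′ e = cong₂ (cdist l) (extensional x x′ e i)
      (cong (λ z → f (lookup (mix J z y)) i) (tabulate-cong e))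
    close : Close (suc k) l (suc n) ε′ (λ x → f x i) g
    close = frac-≤ {sumCube (suc n) (suc k) difference} {suc k ℕ.^ suc n} {u} {v} {c₃} {{ℕP.m^n≢0 (suc k) (suc n)}} (subst (λ z → z ℕ.* suc v ℕ.≤ suc u ℕ.* suc k ℕ.^ suc n)
      (sym (trans (sumCube-Vec (suc n) (suc k) difference difference-ext)
        (sumVec-cong (suc n) λ z → cong (λ w → cdist l (f (lookup z) i) (f (lookup (mix J w y)) i)) (tabulate∘lookup z))))
      (proj₂ (proj₂ (proj₂ result))))

theorem4 : Σ ℚ λ C₂ → (0ℚ < C₂) ×
    (∀ (k l n m : ℕ) → 2 ℕ.≤ k → 2 ℕ.≤ l → 1 ℕ.≤ n → 1 ℕ.≤ m →
    ∀ (α : ℚ) → 0ℚ < α →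
    ∀ (f : Vector (Fin k) n → Vector (Fin l) m) → Lipschitz k l n m α f →
    ∀ (δ ε : ℚ) → 0ℚ < δ → 0ℚ < ε →
    Σ (Subset m) λ S → ((1ℚ - δ) * frac m 1 ≤ frac ∣ S ∣ 1) ×
    (∀ i → i ∈ S → ∃ λ M → ∃ λ (g : Vector (Fin k) n → Fin l) →
    Junta k l n M g × Close k l n ε (λ x → f x i) g ×
    BoundPow2 M l (C₂ * α * frac k 1 * recip δ * recip ε)))
theorem4 = C₂ , from-yes (0ℚ ℚP.<? C₂) , λ where
  (suc k) l (suc n) (suc m) _ _ _ _ α 0<α f lip δ ε 0<δ 0<ε →
    conclusion k l n m (positive-view α 0<α) (positive-view δ 0<δ) (positive-view ε 0<ε) f lip
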